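{- Let $G$ be a $d$-dimensional simplicial complex, and let $L_G=\partial_d^{G}\cdot(\partial_d^{G})^T$ be its Laplacian matrix. Then, $x$ being an indeterminate, $$\sum_{(F,R,\phi,\phi')}\Lambda(\phi)\Lambda(\phi')\,x^{|R|}=\det(L_G+x\cdot \mathrm{Id}),$$ where the sum is over all bi-directed rooted forests $(F,R,\phi,\phi')$ of $G$ and $\mathrm{Id}$ is the identity matrix of dimension $|G_{d-1}|$. More generally, given indeterminates $\{w_{r,f}\}_{r\in G_{d-1},f\in G_d}$, define the weighted Laplacian matrix $L_{G,w}=\partial_d^{G,w}\cdot (\partial_d^{G})^T$, where $\partial_d^{G,w}$ is the matrix obtained from $\partial_d^{G}$ by multiplying by $w_{r,f}$ the entry corresponding to the faces $r$ and $f$. Then, for any indeterminates $\{x_{r}\}_{r\in G_{d-1}}$, $$\sum_{(F,R,\phi,\phi')}\Lambda(\phi)\Lambda(\phi')\left(\prod_{r\in \overline{R}}w_{r,\phi(r)}\right) \left(\prod_{r\in R}x_r\right)=\det(L_{G,w}+X),$$ where the sum is over all bi-directed rooted forests $(F,R,\phi,\phi')$ of $G$, and $X$ is the diagonal matrix whose rows and columns are indexed by $G_{d-1}$ and whose diagonal entry in the row indexed by $r$ is $x_r$.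
   Context: A simplicial complex on $n$ vertices is a nonempty collection $G$ of subsets of $[n]=\{1,\dots,n\}$ closed under taking subsets; its elements are called faces. A $k$-face is a face of cardinality $k+1$ (so $\emptyset$ is the $(-1)$-face), $G_k$ is the set of $k$-faces, and the dimension $d\ge 0$ of $G$ is the maximal dimension of its faces. Incidence matrix: for $k\ge 0$, $\partial_k^{G}$ is the matrix with rows indexed by $G_{k-1}$ and columns indexed by $G_k$ whose entry $\partial_k^{G}[r,f]$ is $(-1)^j$ if $f=\{v_0,\dots,v_k\}$ with $v_0<\cdots<v_k$ and $r=f\setminus\{v_j\}$, and $0$ if $r\not\subset f$. A subset $F\subseteq G_d$ is a forest of $G$ if the columns of $\partial_d^{G}$ indexed by $F$ are linearly independent (over $\mathbb{R}$). For $R\subseteq G_{d-1}$ write $\overline{R}=G_{d-1}\setminus R$. For a forest $F$, let $\partial_d^{F}$ be the submatrix of $\partial_d^{G}$ with columns indexed by $F$ and all rows indexed by $G_{d-1}$; $R$ is a root of $F$ if the rows of $\partial_d^{F}$ indexed by $\overline{R}$ form a basis of the row space of $\partial_d^{F}$. A rooted forest of $G$ is a pair $(F,R)$ where $F\subseteq G_d$ is a forest of $G$ (possibly empty) and $R\subseteq G_{d-1}$ is a root of $F$. In this case $|F|=|\overline{R}|$ and the submatrix $\partial_{\overline{R},F}$ of $\partial_d^{G}$ with rows $\overline{R}$ and columns $F$ has nonzero determinant. A fitting orientation of a rooted forest $(F,R)$ is a bijection $\phi:\overline{R}\to F$ such that $r\subset\phi(r)$ for every $r\in\overline{R}$. A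 bi-directed rooted forest of $G$ is a tuple $(F,R,\phi,\phi')$ such that $(F,R)$ is a rooted forest of $G$ and $\phi,\phi'$ are fitting orientations of $(F,R)$ (possibly equal). Signs: let $(F,R)$ be a rooted forest, $m=|F|=|\overline{R}|$, let $\alpha$ be a linear ordering of $\overline{R}$ and $\beta$ a linear ordering of $F$. For a bijection $\phi:\overline{R}\to F$ let $\pi_{\alpha,\beta,\phi}\in S_m$ be the permutation such that $\phi$ maps the $i$th face of $\overline{R}$ (in the order $\alpha$) to the $\pi_{\alpha,\beta,\phi}(i)$th face of $F$ (in the order $\beta$). For a fitting orientation $\phi$ put $$\lambda_{\alpha,\beta}(\phi)=\operatorname{sign}(\pi_{\alpha,\beta,\phi})\prod_{r\in\overline{R}}\partial_d^{G}[r,\phi(r)].$$ Let $\operatorname{sign}(\alpha,\beta)\in\{ -1,1\}$ be the sign of the determinant of the matrix obtained from $\partial_{\overline{R},F}$ by ordering its rows according to $\alpha$ and its columns according to $\beta$. The sign of $\phi$ is $\Lambda(\phi)=\Lambda_{\alpha,\beta}(\phi)=\operatorname{sign}(\alpha,\beta)\cdot\lambda_{\alpha,\beta}(\phi)\in\{ -1,1\}$; it does not depend on the choice of $(\alpha,\beta)$. -}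

module Defs where

open import Algebra.Bundles using (CommutativeRing; Semiring)
import Algebra.Definitions.RawSemiring
open import Algebra.Structures using (IsCommutativeRing)
open import Data.Bool.Base using (if_then_else_)
open import Data.Fin.Base as Fin using (Fin; zero; suc; toℕ; punchIn)
import Data.Fin.Properties as Fin
open import Data.Fin.Permutation using (↔⇒≡)
open import Data.Fin.Subset using (Subset; inside; outside; _∈_; _⊆_; _⊂_; ∁; ∣_∣; _-_)
open import Data.Integer.Base as ℤ using (ℤ; +_; -[1+_]; 1ℤ; -1ℤ; _◃_)
import Data.Integer.Properties as ℤ
open import Data.List.Base as List using (List; []; _∷_; _++_; length; filter; lookup)
open import Data.Nat.Base as ℕ using (ℕ; zero; suc; _⊔_)
import Data.Nat.Properties as ℕ
open import Data.Product.Base using (∃; _×_; _,_; proj₁; proj₂)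
open import Data.Rational.Base as ℚ using (ℚ; 0ℚ; 1ℚ; ½)
import Data.Rational.Properties as ℚ
open import Data.Rational.Solver using (module +-*-Solver)
open import Data.Vec.Base using ([]; _∷_; here; there)
open import Data.Vec.Properties using (≡-dec)
open import Data.Vec.Properties.WithK using ([]=-irrelevant)
import Data.Bool.Properties as Bool
open import Function.Bundles using (Inverse; _↔_; mk↔ₛ′)
import Function.Properties.Inverse as ↔
open import Level using (Level; 0ℓ) renaming (_⊔_ to _⊔ˡ_)
open import Relation.Binary.Bundles using (Setoid)
open import Relation.Binary.PropositionalEquality
  using (_≡_; refl; sym; trans; cong; subst; setoid)
open import Relation.Nullary.Decidable using (yes; no; ⌊_⌋; _×-dec_)
open import Relation.Unary using (Pred; Decidable)

open Inverse using (to; from)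

private variable
  c ℓ : Level
  m n p q d : ℕ

-- The real numbers, as Cauchy sequences of rationals.

-- For Cauchy sequences a and b, a ∼ b says that they have the same limit;
-- a ∼ a says precisely that a is a Cauchy sequence.
infix 4 _∼_
record _∼_ (a b : ℕ → ℚ) : Set where
  constructor mk∼
  field
    close : ∀ ε → 0ℚ ℚ.< ε →
      ∃ λ N → ∀ i j → N ℕ.≤ i → N ℕ.≤ j → ℚ.∣ a i ℚ.- b j ∣ ℚ.< ε

open _∼_

record ℝ : Set where
  constructor real
  field
    seq    : ℕ → ℚ
    cauchy : seq ∼ seq

open ℝ

infix 4 _≃_
record _≃_ (x y : ℝ) : Set where
  constructor mk≃
  field
    same-limit : seq x ∼ seq y

private
  half>0 : ∀ {ε} → 0ℚ ℚ.< ε → 0ℚ ℚ.< ½ ℚ.* ε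
  half>0 {ε} ε>0 = subst (ℚ._< ½ ℚ.* ε) (ℚ.*-zeroʳ ½) (ℚ.*-monoʳ-<-pos ½ ε>0)

  half+half : ∀ ε → ½ ℚ.* ε ℚ.+ ½ ℚ.* ε ≡ ε
  half+half ε = trans (sym (ℚ.*-distribʳ-+ ε ½ ½)) (ℚ.*-identityˡ ε)

  ∣-∣-sym : ∀ x y → ℚ.∣ x ℚ.- y ∣ ≡ ℚ.∣ y ℚ.- x ∣
  ∣-∣-sym x y = trans (sym (ℚ.∣-p∣≡∣p∣ (x ℚ.- y)))
    (cong ℚ.∣_∣ (solve 2 (λ x y → :- (x :- y) := y :- x) refl x y))
    where open +-*-Solver

  +-bound : ∀ {x} y z {ε δ η} → x ≡ y ℚ.+ z → δ ℚ.+ η ≡ ε →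
    ℚ.∣ y ∣ ℚ.< δ → ℚ.∣ z ∣ ℚ.< η → ℚ.∣ x ∣ ℚ.< ε
  +-bound y z refl refl p q =
    ℚ.≤-<-trans (ℚ.∣p+q∣≤∣p∣+∣q∣ y z) (ℚ.+-mono-< p q)

  *-bound : ∀ x y {A δ} → 0ℚ ℚ.< δ →
    ℚ.∣ x ∣ ℚ.< A → ℚ.∣ y ∣ ℚ.< δ → ℚ.∣ x ℚ.* y ∣ ℚ.< A ℚ.* δ
  *-bound x y {A} {δ} δ>0 p q = subst (ℚ._< A ℚ.* δ) (sym (ℚ.∣p*q∣≡∣p∣*∣q∣ x y))
    (ℚ.≤-<-trans
      (ℚ.*-monoˡ-≤-nonNeg ℚ.∣ x ∣ {{ℚ.nonNegative (ℚ.0≤∣p∣ x)}} (ℚ.<⇒≤ q))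
      (ℚ.*-monoˡ-<-pos δ {{ℚ.positive δ>0}} p))

  ∼-sym : ∀ {a b} → a ∼ b → b ∼ a
  ∼-sym {a} {b} a∼b = mk∼ λ ε ε>0 → let N , h = close a∼b ε ε>0 in N , λ i j N≤i N≤j →
    subst (ℚ._< ε) (∣-∣-sym (a j) (b i)) (h j i N≤j N≤i)

  ∼-trans : ∀ {a b c} → a ∼ b → b ∼ c → a ∼ c
  ∼-trans {a} {b} {c} a∼b b∼c = mk∼ λ ε ε>0 →
    let M , h = close a∼b (½ ℚ.* ε) (half>0 ε>0)
        N , k = close b∼c (½ ℚ.* ε) (half>0 ε>0)
    in M ⊔ N , λ i j ≤i ≤j →
    +-bound (a i ℚ.- b (M ⊔ N)) (b (M ⊔ N) ℚ.- c j)
      (solve 3 (λ x y z → x :- z := (x :- y) :+ (y :- z)) refl (a i) (b (M ⊔ N)) (c j))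
      (half+half ε)
      (h i (M ⊔ N) (ℕ.m⊔n≤o⇒m≤o M N ≤i) (ℕ.m≤m⊔n M N))
      (k (M ⊔ N) j (ℕ.m≤n⊔m M N) (ℕ.m⊔n≤o⇒n≤o M N ≤j))
    where open +-*-Solver

  ∼-respʳ : ∀ {a b c} → (∀ i → b i ≡ c i) → a ∼ b → a ∼ c
  ∼-respʳ {a} b≗c a∼b = mk∼ λ ε ε>0 → let N , h = close a∼b ε ε>0 in N , λ i j N≤i N≤j →
    subst (λ y → ℚ.∣ a i ℚ.- y ∣ ℚ.< ε) (b≗c j) (h i j N≤i N≤j)

  const∼ : ∀ r → (λ _ → r) ∼ (λ _ → r)
  const∼ r = mk∼ λ ε ε>0 → 0 , λ _ _ _ _ →
    subst (λ y → ℚ.∣ y ∣ ℚ.< ε) (sym (ℚ.+-inverseʳ r)) ε>0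

  +-cong∼ : ∀ {a a′ b b′} → a ∼ a′ → b ∼ b′ →
    (λ i → a i ℚ.+ b i) ∼ (λ i → a′ i ℚ.+ b′ i)
  +-cong∼ {a} {a′} {b} {b′} a∼ b∼ = mk∼ λ ε ε>0 →
    let M , h = close a∼ (½ ℚ.* ε) (half>0 ε>0)
        N , k = close b∼ (½ ℚ.* ε) (half>0 ε>0)
    in M ⊔ N , λ i j ≤i ≤j →
    +-bound (a i ℚ.- a′ j) (b i ℚ.- b′ j)
      (solve 4 (λ x y x′ y′ → (x :+ y) :- (x′ :+ y′) := (x :- x′) :+ (y :- y′)) refl
               (a i) (b i) (a′ j) (b′ j))
      (half+half ε)
      (h i j (ℕ.m⊔n≤o⇒m≤o M N ≤i) (ℕ.m⊔n≤o⇒m≤o M N ≤j))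
      (k i j (ℕ.m⊔n≤o⇒n≤o M N ≤i) (ℕ.m⊔n≤o⇒n≤o M N ≤j))
    where open +-*-Solver

  -‿cong∼ : ∀ {a b} → a ∼ b → (λ i → ℚ.- a i) ∼ (λ i → ℚ.- b i)
  -‿cong∼ {a} {b} a∼b = mk∼ λ ε ε>0 → let N , h = close a∼b ε ε>0 in N , λ i j N≤i N≤j →
    subst (ℚ._< ε) (trans (∣-∣-sym (a i) (b j))
        (cong ℚ.∣_∣ (solve 2 (λ x y → y :- x := :- x :- :- y) refl (a i) (b j))))
      (h i j N≤i N≤j)
    where open +-*-Solver

  bounded : ∀ {a b} → a ∼ b →
    ∃ λ A → 0ℚ ℚ.< A × ∃ λ N → ∀ i → N ℕ.≤ i → ℚ.∣ a i ∣ ℚ.< A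
  bounded {a} {b} a∼b with close a∼b 1ℚ (ℚ.positive⁻¹ 1ℚ)
  ... | N , h = 1ℚ ℚ.+ suc∣b∣ ,
    ℚ.+-mono-<  (ℚ.positive⁻¹ 1ℚ) 0<suc∣b∣ , N , λ i N≤i →
    +-bound (a i ℚ.- b N) (b N)
      (solve 2 (λ x y → x := (x :- y) :+ y) refl (a i) (b N)) refl
      (h i N N≤i ℕ.≤-refl) ∣b∣<suc∣b∣
    where
    open +-*-Solver
    suc∣b∣ = ℚ.∣ b N ∣ ℚ.+ 1ℚ
    ∣b∣<suc∣b∣ : ℚ.∣ b N ∣ ℚ.< suc∣b∣
    ∣b∣<suc∣b∣ = subst (ℚ._< suc∣b∣) (ℚ.+-identityʳ ℚ.∣ b N ∣)
      (ℚ.+-mono-≤-< (ℚ.≤-refl {ℚ.∣ b N ∣}) (ℚ.positive⁻¹ 1ℚ))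
    0<suc∣b∣ : 0ℚ ℚ.< suc∣b∣
    0<suc∣b∣ = ℚ.≤-<-trans (ℚ.0≤∣p∣ (b N)) ∣b∣<suc∣b∣

  reciprocal : ∀ {C} → 0ℚ ℚ.< C → ∃ λ r → 0ℚ ℚ.< r × r ℚ.* C ≡ 1ℚ
  reciprocal {C} C>0 = ℚ.1/ C , ℚ.positive⁻¹ (ℚ.1/ C) {{ℚ.1/pos⇒pos C}} , ℚ.*-inverseˡ C
    where instance
      C-positive : ℚ.Positive C
      C-positive = ℚ.positive C>0
      C-nonZero : ℚ.NonZero C
      C-nonZero = ℚ.pos⇒nonZero C

  split : ∀ {A B ε} → 0ℚ ℚ.< A → 0ℚ ℚ.< B → 0ℚ ℚ.< ε →
    ∃ λ δ → 0ℚ ℚ.< δ × A ℚ.* δ ℚ.+ B ℚ.* δ ≡ ε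
  split {A} {B} {ε} A>0 B>0 ε>0 with reciprocal (ℚ.+-mono-< A>0 B>0)
  ... | r , r>0 , r[A+B]≡1 = ε ℚ.* r
    , subst (ℚ._< ε ℚ.* r) (ℚ.*-zeroˡ r) (ℚ.*-monoˡ-<-pos r {{ℚ.positive r>0}} ε>0)
    , trans
        (solve 4 (λ A B ε r → A :* (ε :* r) :+ B :* (ε :* r) := ε :* (r :* (A :+ B))) refl A B ε r)
        (trans (cong (ε ℚ.*_) r[A+B]≡1) (ℚ.*-identityʳ ε))
    where open +-*-Solver

  *-cong∼ : ∀ {a a′ b b′} → a ∼ a′ → b ∼ b′ →
    (λ i → a i ℚ.* b i) ∼ (λ i → a′ i ℚ.* b′ i)
  *-cong∼ {a} {a′} {b} {b′} a∼ b∼ = mk∼ λ ε ε>0 →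
    let A , A>0 , P , f = bounded a∼
        B , B>0 , Q , g = bounded (∼-sym b∼)
        δ , δ>0 , total = split A>0 B>0 ε>0
        M , h = close a∼ δ δ>0
        N , k = close b∼ δ δ>0
        l : ∀ {i} → (M ⊔ N) ⊔ (P ⊔ Q) ℕ.≤ i → M ⊔ N ℕ.≤ i
        l = ℕ.m⊔n≤o⇒m≤o (M ⊔ N) (P ⊔ Q)
        r : ∀ {i} → (M ⊔ N) ⊔ (P ⊔ Q) ℕ.≤ i → P ⊔ Q ℕ.≤ i
        r = ℕ.m⊔n≤o⇒n≤o (M ⊔ N) (P ⊔ Q)
    in (M ⊔ N) ⊔ (P ⊔ Q) , λ i j ≤i ≤j →
      +-bound (a i ℚ.* (b i ℚ.- b′ j)) (b′ j ℚ.* (a i ℚ.- a′ j))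
        (difference (a i) (b i) (a′ j) (b′ j))
        total
        (*-bound (a i) (b i ℚ.- b′ j) δ>0 (f i (ℕ.m⊔n≤o⇒m≤o P Q (r ≤i)))
          (k i j (ℕ.m⊔n≤o⇒n≤o M N (l ≤i)) (ℕ.m⊔n≤o⇒n≤o M N (l ≤j))))
        (*-bound (b′ j) (a i ℚ.- a′ j) δ>0 (g j (ℕ.m⊔n≤o⇒n≤o P Q (r ≤j)))
          (h i j (ℕ.m⊔n≤o⇒m≤o M N (l ≤i)) (ℕ.m⊔n≤o⇒m≤o M N (l ≤j))))
    where
    difference : ∀ x y x′ y′ →
      x ℚ.* y ℚ.- x′ ℚ.* y′ ≡ x ℚ.* (y ℚ.- y′) ℚ.+ y′ ℚ.* (x ℚ.- x′)
    difference = solve 4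
      (λ x y x′ y′ → x :* y :- x′ :* y′ := x :* (y :- y′) :+ y′ :* (x :- x′)) refl
      where open +-*-Solver

-- Kept opaque only so that the type checker does not normalise rational arithmetic.
opaque
  infixl 6 _+ʳ_
  infixl 7 _*ʳ_
  infix  8 -ʳ_

  _+ʳ_ _*ʳ_ : ℝ → ℝ → ℝ
  x +ʳ y = real (λ i → seq x i ℚ.+ seq y i) (+-cong∼ (cauchy x) (cauchy y))
  x *ʳ y = real (λ i → seq x i ℚ.* seq y i) (*-cong∼ (cauchy x) (cauchy y))

  -ʳ_ : ℝ → ℝ
  -ʳ x = real (λ i → ℚ.- seq x i) (-‿cong∼ (cauchy x))

  0ʳ 1ʳ : ℝ
  0ʳ = real (λ _ → 0ℚ) (const∼ 0ℚ)
  1ʳ = real (λ _ → 1ℚ) (const∼ 1ℚ)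

private
  pointwise : ∀ x {y} → (∀ i → seq x i ≡ seq y i) → x ≃ y
  pointwise x eq = mk≃ (∼-respʳ eq (cauchy x))

opaque
  unfolding _+ʳ_

  ℝ-isCommutativeRing : IsCommutativeRing _≃_ _+ʳ_ _*ʳ_ -ʳ_ 0ʳ 1ʳ
  ℝ-isCommutativeRing = record
    { isRing = record
      { +-isAbelianGroup = record
        { isGroup = record
          { isMonoid = record
            { isSemigroup = record
              { isMagma = record
                { isEquivalence = record
                  { refl  = λ {x} → mk≃ (cauchy x)
                  ; sym   = λ (mk≃ p) → mk≃ (∼-sym p)
                  ; trans = λ (mk≃ p) (mk≃ q) → mk≃ (∼-trans p q)
                  }
                ; ∙-cong = λ (mk≃ p) (mk≃ q) → mk≃ (+-cong∼ p q)
                }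
              ; assoc = λ x y z → pointwise ((x +ʳ y) +ʳ z) λ i → ℚ.+-assoc (seq x i) (seq y i) (seq z i)
              }
            ; identity = (λ x → pointwise (0ʳ +ʳ x) λ i → ℚ.+-identityˡ (seq x i))
                       , (λ x → pointwise (x +ʳ 0ʳ) λ i → ℚ.+-identityʳ (seq x i))
            }
          ; inverse = (λ x → pointwise ((-ʳ x) +ʳ x) λ i → ℚ.+-inverseˡ (seq x i))
                    , (λ x → pointwise (x +ʳ (-ʳ x)) λ i → ℚ.+-inverseʳ (seq x i))
          ; ⁻¹-cong = λ (mk≃ p) → mk≃ (-‿cong∼ p)
          }
        ; comm = λ x y → pointwise (x +ʳ y) λ i → ℚ.+-comm (seq x i) (seq y i)
        }
      ; *-cong = λ (mk≃ p) (mk≃ q) → mk≃ (*-cong∼ p q)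
      ; *-assoc = λ x y z → pointwise ((x *ʳ y) *ʳ z) λ i → ℚ.*-assoc (seq x i) (seq y i) (seq z i)
      ; *-identity = (λ x → pointwise (1ʳ *ʳ x) λ i → ℚ.*-identityˡ (seq x i))
                   , (λ x → pointwise (x *ʳ 1ʳ) λ i → ℚ.*-identityʳ (seq x i))
      ; distrib = (λ x y z → pointwise (x *ʳ (y +ʳ z)) λ i → ℚ.*-distribˡ-+ (seq x i) (seq y i) (seq z i))
                , (λ x y z → pointwise ((y +ʳ z) *ʳ x) λ i → ℚ.*-distribʳ-+ (seq x i) (seq y i) (seq z i))
      }
    ; *-comm = λ x y → pointwise (x *ʳ y) λ i → ℚ.*-comm (seq x i) (seq y i)
    }

ℝ-commutativeRing : CommutativeRing 0ℓ 0ℓ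
ℝ-commutativeRing = record { isCommutativeRing = ℝ-isCommutativeRing }

Matrix : Set c → ℕ → ℕ → Set c
Matrix A p q = Fin p → Fin q → A

module LinearAlgebra (A : CommutativeRing c ℓ) where
  open CommutativeRing A hiding (zero; refl; sym; trans; setoid)
  private
    module Raw = Algebra.Definitions.RawSemiring (Semiring.rawSemiring semiring)

  open Raw public using (sum; product; _^_)

  fromℤ : ℤ → Carrier
  fromℤ (+ k)    = k Raw.× 1#
  fromℤ -[1+ k ] = - (suc k Raw.× 1#)

  infixl 7 _⊛_
  infixl 6 _⊕_

  _⊛_ : Matrix Carrier m p → Matrix Carrier p q → Matrix Carrier m q
  (M ⊛ N) i k = sum λ j → M i j * N j k

  _⊕_ : Matrix Carrier p q → Matrix Carrier p q → Matrix Carrier p q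
  (M ⊕ N) i j = M i j + N i j

  _ᵀ : Matrix Carrier p q → Matrix Carrier q p
  (M ᵀ) i j = M j i

  diagonal : (Fin p → Carrier) → Matrix Carrier p p
  diagonal x i j = if ⌊ i Fin.≟ j ⌋ then x i else 0#

  Id : Matrix Carrier p p
  Id = diagonal λ _ → 1#

  infixl 7 _·_
  _·_ : Carrier → Matrix Carrier p q → Matrix Carrier p q
  (x · M) i j = x * M i j

  -- Laplace expansion along the first row.
  det : Matrix Carrier p p → Carrier
  det {zero}  M = 1#
  det {suc p} M = sum λ j →
    (- 1#) ^ toℕ j * M zero j * det λ i k → M (suc i) (punchIn j k)

  LinearlyIndependent : (Fin m → Fin p → Carrier) → Set (c ⊔ˡ ℓ)
  LinearlyIndependent v =
    ∀ (a : Fin _ → Carrier) → (∀ j → sum (λ i → a i * v i j) ≈ 0#) → ∀ i → a i ≈ 0#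

  Span : (Fin m → Fin p → Carrier) → Pred (Fin p → Carrier) (c ⊔ˡ ℓ)
  Span v u = ∃ λ (a : Fin _ → Carrier) → ∀ j → u j ≈ sum λ i → a i * v i j

  IsBasis : ∀ {ℓ′} → (Fin m → Fin p → Carrier) → Pred (Fin p → Carrier) ℓ′ → Set (c ⊔ˡ ℓ ⊔ˡ ℓ′)
  IsBasis v U = (∀ i → U (v i)) × LinearlyIndependent v × (∀ u → U u → Span v u)

  RowSpace : Matrix Carrier p q → Pred (Fin q → Carrier) (c ⊔ˡ ℓ)
  RowSpace M = Span M

module ℤ-LinearAlgebra = LinearAlgebra ℤ.+-*-commutativeRing
module ℝ-LinearAlgebra = LinearAlgebra ℝ-commutativeRing

-- Each inversion i < j, π j < π i contributes a factor -1.
signPerm : (Fin p → Fin p) → ℤ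
signPerm π = product λ i → product λ j →
  if ⌊ i Fin.<? j ×-dec π j Fin.<? π i ⌋ then -1ℤ else 1ℤ
  where open ℤ-LinearAlgebra

Elements : Subset p → Set
Elements S = ∃ λ i → i ∈ S

-- The increasing enumeration of a subset.
increasing : (S : Subset p) → Fin ∣ S ∣ ↔ Elements S
increasing S = mk↔ₛ′ (index S) (position S) (index∘position S) (position∘index S)
  where
  index : (S : Subset p) → Fin ∣ S ∣ → Elements S
  index (inside  ∷ S) zero    = zero , here
  index (inside  ∷ S) (suc k) = let i , i∈S = index S k in suc i , there i∈S
  index (outside ∷ S) k       = let i , i∈S = index S k in suc i , there i∈S

  position : (S : Subset p) → Elements S → Fin ∣ S ∣
  position (inside  ∷ S) (zero  , here)      = zero
  position (inside  ∷ S) (suc i , there i∈S) = suc (position S (i , i∈S))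
  position (outside ∷ S) (suc i , there i∈S) = position S (i , i∈S)

  shift : ∀ {s} {S : Subset p} → Elements S → Elements (s ∷ S)
  shift (i , i∈S) = suc i , there i∈S

  index∘position : (S : Subset p) (e : Elements S) → index S (position S e) ≡ e
  index∘position (inside  ∷ S) (zero  , here)      = refl
  index∘position (inside  ∷ S) (suc i , there i∈S) = cong shift (index∘position S (i , i∈S))
  index∘position (outside ∷ S) (suc i , there i∈S) = cong shift (index∘position S (i , i∈S))

  position∘index : (S : Subset p) (k : Fin ∣ S ∣) → position S (index S k) ≡ k
  position∘index (inside  ∷ S) zero    = refl
  position∘index (inside  ∷ S) (suc k) = cong suc (position∘index S k)
  position∘index (outside ∷ S) k       = position∘index S k

element : (S : Subset p) → Fin ∣ S ∣ → Fin p
element S k = proj₁ (to (increasing S) k)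

Enumeration : Setoid c ℓ → Set (c ⊔ˡ ℓ)
Enumeration S = ∃ λ N → Inverse (setoid (Fin N)) S

module _ (A : CommutativeRing c ℓ) where
  open CommutativeRing A using (Carrier)
  open LinearAlgebra A

  ∏ : (S : Subset p) → (Elements S → Carrier) → Carrier
  ∏ S f = product λ k → f (to (increasing S) k)

  ∑ : ∀ {c′ ℓ′} {S : Setoid c′ ℓ′} → Enumeration S → (Setoid.Carrier S → Carrier) → Carrier
  ∑ (N , e) f = sum λ k → f (to e k)

-- The vertices 1 < ⋯ < n are the elements of Fin n.
record SimplicialComplex (n : ℕ) : Set₁ where
  field
    IsFace   : Pred (Subset n) 0ℓ
    isFace?  : Decidable IsFace
    nonempty : ∃ IsFace
    closed   : ∀ {s t} → t ⊆ s → IsFace s → IsFace t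

open SimplicialComplex public

HasDimension : SimplicialComplex n → ℕ → Set
HasDimension G d =
  (∃ λ s → IsFace G s × ∣ s ∣ ≡ suc d) × (∀ s → IsFace G s → ∣ s ∣ ℕ.≤ suc d)

subsets : ∀ n → List (Subset n)
subsets zero    = [] ∷ []
subsets (suc n) = List.map (outside ∷_) (subsets n) ++ List.map (inside ∷_) (subsets n)

-- Faces are graded by cardinality rather than by dimension, so that
-- faces G d lists G_{d-1} and faces G (suc d) lists G_d.
faces : SimplicialComplex n → ℕ → List (Subset n)
faces G k = filter (λ s → isFace? G s ×-dec ∣ s ∣ ℕ.≟ k) (subsets _)

∣faces∣ : SimplicialComplex n → ℕ → ℕ
∣faces∣ G k = length (faces G k)

-- A face with k elements, represented by its index in faces G k.
Face : SimplicialComplex n → ℕ → Set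
Face G k = Fin (∣faces∣ G k)

vertices : (G : SimplicialComplex n) {k : ℕ} → Face G k → Subset n
vertices G {k} f = lookup (faces G k) f

-- (-1)^j if r is f with its j-th smallest vertex (counting from 0) removed;
-- for ∣ f ∣ = ∣ r ∣ + 1 there is such a j, necessarily unique, iff r ⊂ f.
incidence : (r f : Subset n) → ℤ
incidence r f with Fin.any? (λ j → ≡-dec Bool._≟_ r (f - element f j))
... | yes (j , _) = -1ℤ ℤ.^ toℕ j
... | no  _       = ℤ.0ℤ

∂ : (G : SimplicialComplex n) (d : ℕ) → Matrix ℤ (∣faces∣ G d) (∣faces∣ G (suc d))
∂ G d r f = incidence (vertices G r) (vertices G f)

-- Matrices over an arbitrary commutative ring A: taking A to be a polynomial ring
-- and w its variables gives indeterminate weights.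
module _ (A : CommutativeRing c ℓ) (G : SimplicialComplex n) (d : ℕ) where
  open CommutativeRing A using (Carrier; _*_)
  open LinearAlgebra A

  ∂ᴬ : Matrix Carrier (∣faces∣ G d) (∣faces∣ G (suc d))
  ∂ᴬ r f = fromℤ (∂ G d r f)

  ∂ʷ : (Face G d → Face G (suc d) → Carrier) → Matrix Carrier (∣faces∣ G d) (∣faces∣ G (suc d))
  ∂ʷ w r f = w r f * ∂ᴬ r f

  Laplacian : Matrix Carrier (∣faces∣ G d) (∣faces∣ G d)
  Laplacian = ∂ᴬ ⊛ ∂ᴬ ᵀ

  weightedLaplacian :
    (Face G d → Face G (suc d) → Carrier) → Matrix Carrier (∣faces∣ G d) (∣faces∣ G d)
  weightedLaplacian w = ∂ʷ w ⊛ ∂ᴬ ᵀ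

module _ (G : SimplicialComplex n) (d : ℕ) where
  open ℝ-LinearAlgebra

  ∂ℝ : Matrix ℝ (∣faces∣ G d) (∣faces∣ G (suc d))
  ∂ℝ = ∂ᴬ ℝ-commutativeRing G d

  IsForest : Subset (∣faces∣ G (suc d)) → Set
  IsForest F = LinearlyIndependent λ k → (∂ℝ ᵀ) (element F k)

  ∂ℝ^ : (F : Subset (∣faces∣ G (suc d))) → Matrix ℝ (∣faces∣ G d) ∣ F ∣
  ∂ℝ^ F r k = ∂ℝ r (element F k)

  IsRoot : Subset (∣faces∣ G (suc d)) → Subset (∣faces∣ G d) → Set
  IsRoot F R = IsBasis (λ k → ∂ℝ^ F (element (∁ R) k)) (RowSpace (∂ℝ^ F))

  record RootedForest : Set where
    field
      F        : Subset (∣faces∣ G (suc d))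
      R        : Subset (∣faces∣ G d)
      isForest : IsForest F
      isRoot   : IsRoot F R

    R̄ : Subset (∣faces∣ G d)
    R̄ = ∁ R

  record FittingOrientation (T : RootedForest) : Set where
    open RootedForest T
    field
      bijection : Elements R̄ ↔ Elements F
      fits      : ∀ r → vertices G (proj₁ r) ⊂ vertices G (proj₁ (to bijection r))

    image : Elements R̄ → Face G (suc d)
    image r = proj₁ (to bijection r)

  record BiDirectedRootedForest : Set where
    field
      forest : RootedForest
      φ φ′   : FittingOrientation forest

    open RootedForest forest public

module _ {G : SimplicialComplex n} where

  -- The linear orderings α of R̄ and β of F are given as enumerations.
  module Signs (T : RootedForest G d) (α : Fin m ↔ Elements (RootedForest.R̄ T))
              (β : Fin m ↔ Elements (RootedForest.F T)) where
    open ℤ-LinearAlgebra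

    orderedMatrix : Matrix ℤ m m
    orderedMatrix i j = ∂ G d (proj₁ (to α i)) (proj₁ (to β j))

    signDet : ℤ
    signDet = ℤ.sign (det orderedMatrix) ◃ 1

    module _ (φ : FittingOrientation G d T) where
      open FittingOrientation φ

      π : Fin m → Fin m
      π i = from β (to bijection (to α i))

      lam : ℤ
      lam = signPerm π ℤ.* product λ i → ∂ G d (proj₁ (to α i)) (image (to α i))

      Λ[] : ℤ
      Λ[] = signDet ℤ.* lam

  -- Λ[] does not depend on the orderings; take R̄ and F in increasing order.
  Λ : {T : RootedForest G d} → FittingOrientation G d T → ℤ
  Λ {T = T} φ = Signs.Λ[] T (increasing R̄)
    (subst (λ k → Fin k ↔ Elements F) (sym ∣R̄∣≡∣F∣) (increasing F)) φ
    where
    open RootedForest T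
    open FittingOrientation φ
    ∣R̄∣≡∣F∣ : ∣ R̄ ∣ ≡ ∣ F ∣
    ∣R̄∣≡∣F∣ = ↔⇒≡ (↔.↔-trans (increasing R̄) (↔.↔-trans bijection (↔.↔-sym (increasing F))))

-- Equality of bi-directed rooted forests: proofs are ignored, and
-- orientations are compared as functions.
module _ (G : SimplicialComplex n) (d : ℕ) where
  private
    B = BiDirectedRootedForest G d
    module B = BiDirectedRootedForest

    SameImage : {S T : RootedForest G d} → FittingOrientation G d S → FittingOrientation G d T → Set
    SameImage {S} {T} φ ψ = ∀ r (r∈S : r ∈ RootedForest.R̄ S) (r∈T : r ∈ RootedForest.R̄ T) →
      FittingOrientation.image φ (r , r∈S) ≡ FittingOrientation.image ψ (r , r∈T)

    SameImage-refl : {T : RootedForest G d} (φ : FittingOrientation G d T) → SameImage φ φ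
    SameImage-refl φ r p q =
      cong (λ r∈R̄ → FittingOrientation.image φ (r , r∈R̄)) ([]=-irrelevant p q)

  BiDirectedRootedForests : Setoid 0ℓ 0ℓ
  BiDirectedRootedForests = record
    { Carrier = B
    ; _≈_ = λ S T → B.F S ≡ B.F T × B.R S ≡ B.R T
                  × SameImage (B.φ S) (B.φ T) × SameImage (B.φ′ S) (B.φ′ T)
    ; isEquivalence = record
      { refl  = λ {S} → refl , refl , SameImage-refl (B.φ S) , SameImage-refl (B.φ′ S)
      ; sym   = λ (F≡ , R≡ , φ≡ , φ′≡) →
          sym F≡ , sym R≡ , (λ r p q → sym (φ≡ r q p)) , (λ r p q → sym (φ′≡ r q p))
      ; trans = λ (F≡ , R≡ , φ≡ , φ′≡) (F≡′ , R≡′ , ψ≡ , ψ′≡) →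
          trans F≡ F≡′ , trans R≡ R≡′
        , (λ r p q → let t = subst (λ R → r ∈ ∁ R) R≡ p in trans (φ≡ r p t) (ψ≡ r t q))
        , (λ r p q → let t = subst (λ R → r ∈ ∁ R) R≡ p in trans (φ′≡ r p t) (ψ′≡ r t q))
      }
    }

{-# OPTIONS --safe #-}

-- Encode a bi-directed rooted forest (F, R, φ, φ′) by the pair (h, σ), where h is φ extended by
-- "undefined" on R, and σ is the permutation of G_{d-1} equal to φ′⁻¹ ∘ φ outside R and to the
-- identity on R. Each row of L + X is the sum of x_r e_r and of w_{r,f} ∂[r,f] times the columns f
-- of ∂, so multilinearity gives det (L + X) = ∑_h (weight of h) · K_h, where K_h is the
-- determinant whose row r is the column h r of ∂, or e_r if h r is undefined. The Leibniz formula
-- writes K_h as a sum over σ, whose nonzero terms are ± products of incidences. The term of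
-- (h, σ) is the contribution of the forest that it encodes, because the sign of σ is the product
-- of the signs of φ and φ′. Finally K_h ≠ 0 says precisely that the image F and the undefined
-- set R of h form a rooted forest: a singular integer matrix has a nonzero integer kernel vector,
-- and a nonsingular one is invertible over ℝ.

module Submission where

open import Defs
open import Algebra.Bundles using (CommutativeMonoid; CommutativeRing)
import Algebra.Properties.CommutativeMonoid.Sum
import Algebra.Properties.CommutativeSemigroup
import Algebra.Properties.Ring
import Algebra.Properties.Semiring.Mult
import Algebra.Properties.Semiring.Sum
import Algebra.Solver.CommutativeMonoid
open import Data.Bool.Base using (if_then_else_; _∧_; not)
import Data.Bool.Properties as Bool
open import Data.Empty using (⊥-elim)
open import Data.Fin.Base as Fin using (Fin; zero; suc; toℕ; punchIn; punchOut; combine; funToFin; finToFun)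
open import Data.Fin.Permutation using (Permutation′; permutation; ↔⇒≡)
import Data.Fin.Properties as Fin
open import Data.Fin.Subset using (Subset; inside; outside; _∈_; _∉_; _⊂_; ∣_∣; ∁) renaming (_-_ to _∖_)
open import Data.Fin.Subset.Properties
  using (_∈?_; _⊂?_; x∈∁p⇒x∉p; x∉∁p⇒x∈p; x∉p⇒x∈∁p; x∈p⇒x∉∁p; ⊆-antisym; x∈p⇒p-x⊂p)
open import Data.Integer using () renaming (_*_ to _*ℤ_)
open import Data.Integer.Base as ℤ using (ℤ; 0ℤ; 1ℤ; -1ℤ)
import Data.Integer.Properties as ℤ
open import Data.Nat.Base as ℕ using (ℕ; zero; suc; z≤n; s≤s; z<s; s<s)
import Data.Nat.Properties as ℕ
open import Data.Product using (∃; _×_; _,_; proj₁; proj₂)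
open import Data.Rational.Base as ℚ using (ℚ; 0ℚ; 1ℚ; ½)
import Data.Rational.Properties as ℚ
import Data.Sign.Base as Sign
open import Data.Sum.Base using (_⊎_; inj₁; inj₂)
open import Data.Unit.Base using (⊤; tt)
open import Data.Vec.Base using (lookup; []; _∷_; tabulate)
open import Data.Vec.Functional using () renaming (_∷_ to _◂_)
open import Data.Vec.Properties using (≡-dec; lookup⇒[]=; []=⇒lookup; lookup∘tabulate; lookup-map)
open import Data.Vec.Properties.WithK using ([]=-irrelevant)
open import Function.Base using (_∘_; case_of_)
open import Function.Bundles using (Inverse; _↔_; mk↔ₛ′)
open import Function.Definitions using (Injective)
import Function.Properties.Inverse as ↔
open import Relation.Binary.Bundles using (Setoid)
open import Relation.Binary.Definitions using (tri<; tri≈; tri>)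
open import Relation.Binary.PropositionalEquality as ≡ using (_≡_; _≢_; _≗_; cong; cong₂; subst)
import Relation.Binary.Reasoning.Setoid
open import Relation.Nullary using (Dec; yes; no; ¬_; contradiction)
open import Relation.Nullary.Decidable using (⌊_⌋; _×-dec_; ¬?; decidable-stable)
open import Relation.Unary using (Pred; Decidable)

open Inverse using (to; from; strictlyInverseˡ; strictlyInverseʳ)
open ℤ-LinearAlgebra using ()
  renaming (sum to sumᶻ; product to productᶻ; _^_ to _^ᶻ_; det to detᶻ; _⊛_ to _⊛ᶻ_; fromℤ to fromℤᶻ)

-- Everything discrete is decided on integers. Linear independence over `ℝ` has no direct test, but
-- nonvanishing of the integer K_h has one, and the same test both enumerates the forests and
-- selects the summands. A vanishing K_h does not make its Leibniz terms vanish one by one: they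
-- only cancel. Such terms belong to no forest, so they are discarded for a whole h at once, before
-- the sum is split over σ. The permutation φ′⁻¹ ∘ φ arises because row r of K_h contributes
-- ∂[σ r, φ r] to the Leibniz term of σ, and this is the incidence ∂[σ r, φ′(σ r)] that φ′ requires.
-- The incidences of φ come from the weights. In Λ(φ)Λ(φ′) the sign of the determinant is squared,
-- and the ordering of F cancels between the two permutations. The ring of coefficients is
-- arbitrary, so division and cancellation take place only in ℤ, ℚ and ℝ, and integers enter the
-- ring through `fromℤ`.

private variable
  d m n p q : ℕ

-- Signs of functions between finite sets

module ℤ-Product = Algebra.Properties.CommutativeMonoid.Sum ℤ.*-1-commutativeMonoid

IsInjective : (Fin m → Fin n) → Set
IsInjective = Injective _≡_ _≡_

-- Pigeonhole: a missed value `j` could be punched out of the codomain, leaving an injection into a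
-- smaller set.
injection⇒surjection : {σ : Fin n → Fin n} → IsInjective σ → ∀ j → ∃ λ i → σ i ≡ j
injection⇒surjection {zero}  σ-inj ()
injection⇒surjection {suc n} {σ} σ-inj j with Fin.any? (λ i → σ i Fin.≟ j)
... | yes hit = hit
... | no miss = ⊥-elim (ℕ.1+n≰n (Fin.injective⇒≤ {f = σ′} λ eq →
    σ-inj (Fin.punchOut-injective (j≢ _) (j≢ _) eq)))
  where
  j≢ : ∀ i → j ≢ σ i
  j≢ i eq = miss (i , ≡.sym eq)
  σ′ : Fin (suc n) → Fin n
  σ′ i = punchOut (j≢ i)

injection⇒permutation : {σ : Fin n → Fin n} → IsInjective σ → Permutation′ n
injection⇒permutation {σ = σ} σ-inj =
  permutation σ (proj₁ ∘ surj) (proj₂ ∘ surj) (λ i → σ-inj (proj₂ (surj (σ i))))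
  where surj = injection⇒surjection σ-inj

productᶻ-cong : {f g : Fin n → ℤ} → f ≗ g → productᶻ f ≡ productᶻ g
productᶻ-cong = ℤ-Product.sum-cong-≗

productᶻ-1 : {f : Fin n → ℤ} → (∀ i → f i ≡ 1ℤ) → productᶻ f ≡ 1ℤ
productᶻ-1 {n} f≗1 = ≡.trans (productᶻ-cong f≗1) (ℤ-Product.sum-replicate-zero n)

productᶻ-reindex : {σ : Fin n → Fin n} → IsInjective σ → ∀ f → productᶻ (f ∘ σ) ≡ productᶻ f
productᶻ-reindex σ-inj f = ≡.sym (ℤ-Product.sum-permute f (injection⇒permutation σ-inj))

productᶻ-0 : (f : Fin n → ℤ) → ∀ i → f i ≡ 0ℤ → productᶻ f ≡ 0ℤ
productᶻ-0 f zero    fi≡0 = cong (_*ℤ productᶻ (f ∘ suc)) fi≡0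
productᶻ-0 f (suc i) fi≡0 =
  ≡.trans (cong (f zero *ℤ_) (productᶻ-0 (f ∘ suc) i fi≡0)) (ℤ.*-zeroʳ (f zero))

-- The sign of `j - i`, so that a collision `g i ≡ g j` gives `sg (g i) (g j) ≡ 0ℤ`.
sg : Fin n → Fin n → ℤ
sg zero    zero    = 0ℤ
sg zero    (suc j) = 1ℤ
sg (suc i) zero    = -1ℤ
sg (suc i) (suc j) = sg i j

-- Writes a product over pairs `i < j` as a product over all ordered pairs, which can be reindexed
-- by a permutation in each variable separately.
when< : Fin n → Fin n → ℤ → ℤ
when< zero    zero    x = 1ℤ
when< zero    (suc j) x = x
when< (suc i) zero    x = 1ℤ
when< (suc i) (suc j) x = when< i j x

sg-< : {i j : Fin n} → i Fin.< j → sg i j ≡ 1ℤ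
sg-< {i = zero}  {suc j} _         = ≡.refl
sg-< {i = suc i} {suc j} (s<s i<j) = sg-< i<j

sg-> : {i j : Fin n} → i Fin.< j → sg j i ≡ -1ℤ
sg-> {i = zero}  {suc j} _         = ≡.refl
sg-> {i = suc i} {suc j} (s<s i<j) = sg-> i<j

sg-refl : (i : Fin n) → sg i i ≡ 0ℤ
sg-refl zero    = ≡.refl
sg-refl (suc i) = sg-refl i

sg² : (i j : Fin n) → i ≢ j → sg i j *ℤ sg i j ≡ 1ℤ
sg² zero    zero    i≢j = contradiction ≡.refl i≢j
sg² zero    (suc j) i≢j = ≡.refl
sg² (suc i) zero    i≢j = ≡.refl
sg² (suc i) (suc j) i≢j = sg² i j (i≢j ∘ cong suc)

sg-antisym : (i j : Fin n) → sg i j ≡ -1ℤ *ℤ sg j i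
sg-antisym zero    zero    = ≡.refl
sg-antisym zero    (suc j) = ≡.refl
sg-antisym (suc i) zero    = ≡.refl
sg-antisym (suc i) (suc j) = sg-antisym i j

when<-< : ∀ {i j : Fin n} x → i Fin.< j → when< i j x ≡ x
when<-< {i = zero}  {suc j} x _         = ≡.refl
when<-< {i = suc i} {suc j} x (s<s i<j) = when<-< x i<j

when<-> : ∀ {i j : Fin n} x → i Fin.< j → when< j i x ≡ 1ℤ
when<-> {i = zero}  {suc j} x _         = ≡.refl
when<-> {i = suc i} {suc j} x (s<s i<j) = when<-> x i<j

when<-refl : ∀ (i : Fin n) x → when< i i x ≡ 1ℤ
when<-refl zero    x = ≡.refl
when<-refl (suc i) x = when<-refl i x

-- The product over all `i < j`. Splitting off the first row matches prepending a value to a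
-- function, as in `ε-◂`.
pairs : (Fin n → Fin n → ℤ) → ℤ
pairs {zero}  A = 1ℤ
pairs {suc n} A = productᶻ (λ j → A zero (suc j)) *ℤ pairs (λ i j → A (suc i) (suc j))

pairs-cong : {A B : Fin n → Fin n → ℤ} → (∀ i j → i Fin.< j → A i j ≡ B i j) → pairs A ≡ pairs B
pairs-cong {zero}  A≗B = ≡.refl
pairs-cong {suc n} A≗B = cong₂ _*ℤ_ (productᶻ-cong λ j → A≗B zero (suc j) z<s)
  (pairs-cong λ i j i<j → A≗B (suc i) (suc j) (s<s i<j))

*-interchange : ∀ a b c d → (a *ℤ b) *ℤ (c *ℤ d) ≡ (a *ℤ c) *ℤ (b *ℤ d)
*-interchange = Algebra.Properties.CommutativeSemigroup.interchange ℤ.*-commutativeSemigroup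

pairs-* : (A B : Fin n → Fin n → ℤ) → pairs (λ i j → A i j *ℤ B i j) ≡ pairs A *ℤ pairs B
pairs-* {zero}  A B = ≡.refl
pairs-* {suc n} A B = ≡.trans
  (cong₂ _*ℤ_ (ℤ-Product.∑-distrib-+ (λ j → A zero (suc j)) (λ j → B zero (suc j)))
             (pairs-* (λ i j → A (suc i) (suc j)) (λ i j → B (suc i) (suc j))))
  (*-interchange (productᶻ λ j → A zero (suc j)) _ _ _)

pairs-1 : {A : Fin n → Fin n → ℤ} → (∀ i j → i Fin.< j → A i j ≡ 1ℤ) → pairs A ≡ 1ℤ
pairs-1 {zero}  A≗1 = ≡.refl
pairs-1 {suc n} A≗1 = cong₂ _*ℤ_ (productᶻ-1 λ j → A≗1 zero (suc j) z<s)
  (pairs-1 λ i j i<j → A≗1 (suc i) (suc j) (s<s i<j))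

pairs-0 : ∀ {A : Fin n → Fin n → ℤ} {i j} → i Fin.< j → A i j ≡ 0ℤ → pairs A ≡ 0ℤ
pairs-0 {A = A} {zero}  {suc j} _ eq = cong (_*ℤ pairs (λ i j → A (suc i) (suc j)))
  (productᶻ-0 (λ j → A zero (suc j)) j eq)
pairs-0 {A = A} {suc i} {suc j} (s<s i<j) eq = ≡.trans
  (cong (productᶻ (λ j → A zero (suc j)) *ℤ_) (pairs-0 i<j eq)) (ℤ.*-zeroʳ (productᶻ λ j → A zero (suc j)))

-- The factors at `(i , j)` and `(j , i)` merge into one and the diagonal contributes 1. This is the
-- passage between double products, which can be reindexed, and products over `i < j`, which define
-- signs.
product²≡pairs : (B : Fin n → Fin n → ℤ) {C : Fin n → Fin n → ℤ} → (∀ i → B i i ≡ 1ℤ) →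
  (∀ i j → i Fin.< j → B i j *ℤ B j i ≡ C i j) →
  productᶻ (λ i → productᶻ (B i)) ≡ pairs C
product²≡pairs {zero} _ _ _ = ≡.refl
product²≡pairs {suc n} B {C} Bii BB = begin
  (B zero zero *ℤ productᶻ (λ j → B zero (suc j))) *ℤ productᶻ (λ i → productᶻ (B (suc i)))
    ≡⟨ cong₂ _*ℤ_ (≡.trans (cong (_*ℤ r) (Bii zero)) (ℤ.*-identityˡ r))
         (ℤ-Product.∑-distrib-+ (λ i → B (suc i) zero) (λ i → productᶻ (λ j → B (suc i) (suc j)))) ⟩
  r *ℤ (productᶻ (λ i → B (suc i) zero) *ℤ productᶻ (λ i → productᶻ (λ j → B (suc i) (suc j))))
    ≡⟨ ℤ.*-assoc r _ _ ⟨
  (r *ℤ productᶻ (λ i → B (suc i) zero)) *ℤ productᶻ (λ i → productᶻ (λ j → B (suc i) (suc j)))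
    ≡⟨ cong₂ _*ℤ_ (≡.sym (ℤ-Product.∑-distrib-+ (λ j → B zero (suc j)) (λ i → B (suc i) zero)))
         (product²≡pairs (λ i j → B (suc i) (suc j)) (Bii ∘ suc)
           (λ i j i<j → BB (suc i) (suc j) (s<s i<j))) ⟩
  productᶻ (λ j → B zero (suc j) *ℤ B (suc j) zero) *ℤ pairs (λ i j → C (suc i) (suc j))
    ≡⟨ cong (_*ℤ pairs (λ i j → C (suc i) (suc j))) (productᶻ-cong λ j → BB zero (suc j) z<s) ⟩
  pairs C ∎
  where
  open ≡.≡-Reasoning
  r = productᶻ (λ j → B zero (suc j))

-- The sign of a permutation, and 0 for functions that are not injective.
opaque
  ε : (Fin m → Fin n) → ℤ
  ε g = pairs λ i j → sg (g i) (g j)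

opaque
  unfolding ε

  ε-cong : {f g : Fin m → Fin n} → f ≗ g → ε f ≡ ε g
  ε-cong f≗g = pairs-cong λ i j _ → cong₂ sg (f≗g i) (f≗g j)

opaque
  unfolding ε

  ε-collision : (g : Fin m → Fin n) → ∀ {i j} → i ≢ j → g i ≡ g j → ε g ≡ 0ℤ
  ε-collision g {i} {j} i≢j eq with Fin.<-cmp i j
  ... | tri< i<j _ _ = pairs-0 i<j (≡.trans (cong (sg (g i)) (≡.sym eq)) (sg-refl (g i)))
  ... | tri≈ _ i≡j _ = contradiction i≡j i≢j
  ... | tri> _ _ j<i = pairs-0 j<i (≡.trans (cong (sg (g j)) eq) (sg-refl (g j)))

opaque
  unfolding ε

  ε²≡1 : {g : Fin m → Fin n} → IsInjective g → ε g *ℤ ε g ≡ 1ℤ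
  ε²≡1 {g = g} g-inj = ≡.trans (≡.sym (pairs-* (λ i j → sg (g i) (g j)) (λ i j → sg (g i) (g j))))
    (pairs-1 λ i j i<j → sg² (g i) (g j) (Fin.<⇒≢ i<j ∘ g-inj))

opaque
  unfolding ε

  -- Reindexing by `τ` permutes the unordered pairs. A pair whose order `τ` reverses has its factor
  -- negated by antisymmetry of `sg`, and `sg (τ i) (τ j)` records exactly that.
  ε-reindex : (g : Fin m → Fin n) {τ : Fin m → Fin m} → IsInjective τ → ε g ≡ ε τ *ℤ ε (g ∘ τ)
  ε-reindex {m} g {τ} τ-inj = begin
    ε g
      ≡⟨ product²≡pairs B (λ i → when<-refl i _)
           (λ i j i<j → ≡.trans (cong₂ _*ℤ_ (when<-< _ i<j) (when<-> (sg (g j) (g i)) i<j)) (ℤ.*-identityʳ _)) ⟨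
    productᶻ (λ i → productᶻ (B i))
      ≡⟨ productᶻ-reindex τ-inj (λ i → productᶻ (B i)) ⟨
    productᶻ (λ i → productᶻ (B (τ i)))
      ≡⟨ productᶻ-cong (λ i → productᶻ-reindex τ-inj (B (τ i))) ⟨
    productᶻ (λ i → productᶻ (λ j → B (τ i) (τ j)))
      ≡⟨ product²≡pairs (λ i j → B (τ i) (τ j)) (λ i → when<-refl (τ i) _) step ⟩
    pairs (λ i j → sg (τ i) (τ j) *ℤ sg (g (τ i)) (g (τ j)))
      ≡⟨ pairs-* (λ i j → sg (τ i) (τ j)) (λ i j → sg (g (τ i)) (g (τ j))) ⟩
    ε τ *ℤ ε (g ∘ τ) ∎
    where
    open ≡.≡-Reasoning
    B : Fin m → Fin m → ℤ
    B i j = when< i j (sg (g i) (g j))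
    step : ∀ i j → i Fin.< j →
      B (τ i) (τ j) *ℤ B (τ j) (τ i) ≡ sg (τ i) (τ j) *ℤ sg (g (τ i)) (g (τ j))
    step i j i<j with Fin.<-cmp (τ i) (τ j)
    ... | tri< lt _ _ = ≡.trans (cong₂ _*ℤ_ (when<-< _ lt) (when<-> _ lt))
      (≡.trans (ℤ.*-comm _ 1ℤ) (cong (_*ℤ sg (g (τ i)) (g (τ j))) (≡.sym (sg-< lt))))
    ... | tri≈ _ eq _ = contradiction (τ-inj eq) (Fin.<⇒≢ i<j)
    ... | tri> _ _ gt = ≡.trans (cong₂ _*ℤ_ (when<-> _ gt) (when<-< _ gt))
      (≡.trans (ℤ.*-identityˡ _) (≡.trans (sg-antisym (g (τ j)) (g (τ i)))
        (cong (_*ℤ sg (g (τ i)) (g (τ j))) (≡.sym (sg-> gt)))))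

-- Multiply `ε-reindex` by `ε τ`, whose square is 1. The function `g` is arbitrary because the
-- Leibniz sum runs over all functions.
ε-∘ : (g : Fin m → Fin n) {τ : Fin m → Fin m} → IsInjective τ → ε (g ∘ τ) ≡ ε τ *ℤ ε g
ε-∘ g {τ} τ-inj = begin
  ε (g ∘ τ)                  ≡⟨ ℤ.*-identityˡ (ε (g ∘ τ)) ⟨
  1ℤ *ℤ ε (g ∘ τ)            ≡⟨ cong (_*ℤ ε (g ∘ τ)) (ε²≡1 τ-inj) ⟨
  (ε τ *ℤ ε τ) *ℤ ε (g ∘ τ)  ≡⟨ ℤ.*-assoc (ε τ) (ε τ) (ε (g ∘ τ)) ⟩
  ε τ *ℤ (ε τ *ℤ ε (g ∘ τ))  ≡⟨ cong (ε τ *ℤ_) (ε-reindex g τ-inj) ⟨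
  ε τ *ℤ ε g                 ∎
  where open ≡.≡-Reasoning

opaque
  unfolding ε

  -- Of the two factors of `signPerm` at an unordered pair, only the one with `i < j` can differ
  -- from 1, and it is -1 exactly at an inversion.
  signPerm≡ε : {π : Fin n → Fin n} → IsInjective π → signPerm π ≡ ε π
  signPerm≡ε {n} {π} π-inj = product²≡pairs B diag step
    where
    B : Fin n → Fin n → ℤ
    B i j = if ⌊ i Fin.<? j ×-dec π j Fin.<? π i ⌋ then -1ℤ else 1ℤ
    diag : ∀ i → B i i ≡ 1ℤ
    diag i with i Fin.<? i | π i Fin.<? π i
    ... | yes i<i | _ = contradiction ≡.refl (Fin.<⇒≢ i<i)
    ... | no _    | _ = ≡.refl
    step : ∀ i j → i Fin.< j → B i j *ℤ B j i ≡ sg (π i) (π j)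
    step i j i<j with i Fin.<? j | j Fin.<? i | π j Fin.<? π i | π i Fin.<? π j
    ... | no i≮j | _       | _       | _       = contradiction i<j i≮j
    ... | yes _  | yes j<i | _       | _       = contradiction j<i (ℕ.<-asym i<j)
    ... | yes _  | no _    | yes gt  | _       = ≡.sym (sg-> gt)
    ... | yes _  | no _    | no _    | yes lt  = ≡.sym (sg-< lt)
    ... | yes _  | no _    | no ≯    | no ≮    =
      contradiction (π-inj (Fin.toℕ-injective (ℕ.≤-antisym (ℕ.≮⇒≥ ≯) (ℕ.≮⇒≥ ≮)))) (Fin.<⇒≢ i<j)

-- The values `punchIn j k` are all those other than `j`, and `toℕ j` of them lie below `j`.
product-sg-punchIn : (j : Fin (suc n)) → productᶻ (λ k → sg j (punchIn j k)) ≡ -1ℤ ^ᶻ toℕ j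
product-sg-punchIn {n}     zero    = productᶻ-1 {n} λ k → ≡.refl
product-sg-punchIn {suc n} (suc j) = cong (-1ℤ *ℤ_) (product-sg-punchIn j)

injective? : (σ : Fin m → Fin n) → Dec (IsInjective σ)
injective? σ with Fin.all? (λ i → Fin.all? (λ j → dec i j))
  where
  dec : ∀ i j → Dec (σ i ≡ σ j → i ≡ j)
  dec i j with σ i Fin.≟ σ j | i Fin.≟ j
  ... | _      | yes eq = yes λ _ → eq
  ... | no neq | no _   = yes λ eq → contradiction eq neq
  ... | yes eq | no neq = no λ inj → neq (inj eq)
... | yes inj = yes λ {i} {j} → inj i j
... | no ¬inj = no λ inj → ¬inj λ i j → inj

collision : (σ : Fin m → Fin n) → ¬ IsInjective σ → ∃ λ i → ∃ λ j → i ≢ j × σ i ≡ σ j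
collision σ ¬inj with Fin.any? (λ i → Fin.any? (λ j → ¬? (i Fin.≟ j) ×-dec σ i Fin.≟ σ j))
... | yes found = found
... | no none = ⊥-elim (¬inj inj)
  where
  inj : IsInjective σ
  inj {i} {j} eq with i Fin.≟ j
  ... | yes i≡j = i≡j
  ... | no i≢j = contradiction (i , j , i≢j , eq) none

ε-¬injective : (σ : Fin m → Fin n) → ¬ IsInjective σ → ε σ ≡ 0ℤ
ε-¬injective σ ¬inj = let i , j , i≢j , eq = collision σ ¬inj in ε-collision σ i≢j eq

sg-punchIn : (j : Fin (suc n)) (k l : Fin n) → sg (punchIn j k) (punchIn j l) ≡ sg k l
sg-punchIn zero    k       l       = ≡.refl
sg-punchIn (suc j) zero    zero    = ≡.refl
sg-punchIn (suc j) zero    (suc l) = ≡.refl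
sg-punchIn (suc j) (suc k) zero    = ≡.refl
sg-punchIn (suc j) (suc k) (suc l) = sg-punchIn j k l

opaque
  unfolding ε

  ε-[] : (g : Fin 0 → Fin n) → ε g ≡ 1ℤ
  ε-[] g = ≡.refl

opaque
  unfolding ε

  -- The sign rule of Laplace expansion. Since `punchIn j` is monotone, pairs away from the first
  -- position give `ε σ`. Pairs with the first position compare `j` with every other value when `σ`
  -- is a permutation; otherwise both sides vanish.
  ε-◂ : (j : Fin (suc n)) (σ : Fin n → Fin n) → ε (j ◂ (punchIn j ∘ σ)) ≡ -1ℤ ^ᶻ toℕ j *ℤ ε σ
  ε-◂ j σ with injective? σ
  ... | yes σ-inj = cong₂ _*ℤ_
    (≡.trans (productᶻ-reindex σ-inj (λ k → sg j (punchIn j k))) (product-sg-punchIn j))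
    (pairs-cong λ i k _ → sg-punchIn j (σ i) (σ k))
  ... | no ¬σ-inj = ≡.trans
    (cong (productᶻ (λ k → sg j (punchIn j (σ k))) *ℤ_)
      (≡.trans (pairs-cong λ i k _ → sg-punchIn j (σ i) (σ k)) ε≡0))
    (≡.trans (ℤ.*-zeroʳ (productᶻ (λ k → sg j (punchIn j (σ k)))))
      (≡.sym (≡.trans (cong (-1ℤ ^ᶻ toℕ j *ℤ_) ε≡0) (ℤ.*-zeroʳ (-1ℤ ^ᶻ toℕ j)))))
    where
    ε≡0 : ε σ ≡ 0ℤ
    ε≡0 = ε-¬injective σ ¬σ-inj

-- Stated for a commutative monoid to serve both the sums over `ℝ` that express linear dependence
-- and the products of incidences and weights.
module SubsetSums {c ℓ} (M : CommutativeMonoid c ℓ) where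
  open CommutativeMonoid M renaming (ε to 0#)
  open Algebra.Properties.CommutativeMonoid.Sum M

  sum-element : (S : Subset n) (f : Fin n → Carrier) →
    sum (λ k → f (element S k)) ≈ sum (λ i → if lookup S i then f i else 0#)
  sum-element []            f = refl
  sum-element (inside ∷ S)  f = ∙-congˡ (sum-element S (f ∘ suc))
  sum-element (outside ∷ S) f = trans (sum-element S (f ∘ suc)) (sym (identityˡ _))

  sum-element-support : (S : Subset n) (f : Fin n → Carrier) → (∀ i → i ∉ S → f i ≈ 0#) →
    sum (λ k → f (element S k)) ≈ sum f
  sum-element-support S f f≈0 = trans (sum-element S f) (sum-cong-≋ restrict)
    where
    restrict : ∀ i → (if lookup S i then f i else 0#) ≈ f i
    restrict i with lookup S i in eq
    ... | inside  = refl
    ... | outside = sym (f≈0 i λ i∈S → case ≡.trans (≡.sym eq) ([]=⇒lookup i∈S) of λ ())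

  sum-split : (S : Subset n) (f : Fin n → Carrier) →
    sum f ≈ sum (λ k → f (element (∁ S) k)) ∙ sum (λ k → f (element S k))
  sum-split S f = begin
    sum f
      ≈⟨ sum-cong-≋ split ⟩
    sum (λ i → (if lookup (∁ S) i then f i else 0#) ∙ (if lookup S i then f i else 0#))
      ≈⟨ ∑-distrib-+ (λ i → if lookup (∁ S) i then f i else 0#) (λ i → if lookup S i then f i else 0#) ⟩
    sum (λ i → if lookup (∁ S) i then f i else 0#) ∙ sum (λ i → if lookup S i then f i else 0#)
      ≈⟨ ∙-cong (sum-element (∁ S) f) (sum-element S f) ⟨
    sum (λ k → f (element (∁ S) k)) ∙ sum (λ k → f (element S k)) ∎
    where
    open Relation.Binary.Reasoning.Setoid setoid
    split : ∀ i → f i ≈ (if lookup (∁ S) i then f i else 0#) ∙ (if lookup S i then f i else 0#)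
    split i rewrite lookup-map i not S with lookup S i
    ... | inside  = sym (identityˡ (f i))
    ... | outside = sym (identityʳ (f i))

open SubsetSums ℤ.*-1-commutativeMonoid using ()
  renaming (sum-element to productᶻ-element; sum-split to productᶻ-split)

sg-element : (S : Subset n) (k l : Fin ∣ S ∣) → sg (element S k) (element S l) ≡ sg k l
sg-element (inside ∷ S)  zero    zero    = ≡.refl
sg-element (inside ∷ S)  zero    (suc l) = ≡.refl
sg-element (inside ∷ S)  (suc k) zero    = ≡.refl
sg-element (inside ∷ S)  (suc k) (suc l) = sg-element S k l
sg-element (outside ∷ S) k       l       = sg-element S k l

pairs-element : (S : Subset n) (A : Fin n → Fin n → ℤ) →
  pairs (λ k l → A (element S k) (element S l))
    ≡ pairs (λ i j → if lookup S i ∧ lookup S j then A i j else 1ℤ)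
pairs-element []            A = ≡.refl
pairs-element (inside ∷ S)  A = cong₂ _*ℤ_ (productᶻ-element S (λ j → A zero (suc j)))
  (pairs-element S (λ i j → A (suc i) (suc j)))
pairs-element {suc n} (outside ∷ S) A = ≡.trans (pairs-element S (λ i j → A (suc i) (suc j)))
  (≡.sym (≡.trans (cong (_*ℤ rest) (ℤ-Product.sum-replicate-zero n)) (ℤ.*-identityˡ rest)))
  where rest = pairs λ i j → if lookup S i ∧ lookup S j then A (suc i) (suc j) else 1ℤ

opaque
  unfolding ε

  -- For i fixed and j moved by σ, the pair i, j contributes sg i j * sg i (σ j) to the
  -- sign of σ, and for fixed i the product over all moved j is a square.
  ε-restriction : (S : Subset n) {σ : Fin n → Fin n} → IsInjective σ →
    (∀ i → lookup S i ≡ outside → σ i ≡ i) →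
    {σ̄ : Fin ∣ S ∣ → Fin ∣ S ∣} → (∀ k → element S (σ̄ k) ≡ σ (element S k)) →
    ε σ ≡ ε σ̄
  ε-restriction {n} S {σ} σ-inj fixed {σ̄} eq = ≡.sym (begin
    ε σ̄
      ≡⟨ pairs-cong (λ k l _ → ≡.trans (≡.sym (sg-element S (σ̄ k) (σ̄ l))) (cong₂ sg (eq k) (eq l))) ⟩
    pairs (λ k l → sg (σ (element S k)) (σ (element S l)))
      ≡⟨ pairs-element S (λ i j → sg (σ i) (σ j)) ⟩
    pairs Inner
      ≡⟨ ℤ.*-identityʳ (pairs Inner) ⟨
    pairs Inner *ℤ 1ℤ
      ≡⟨ cong (pairs Inner *ℤ_) (productᶻ-1 row) ⟨
    pairs Inner *ℤ productᶻ (λ i → productᶻ (Mixed i))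
      ≡⟨ cong (pairs Inner *ℤ_) (product²≡pairs Mixed Mixed-diag (λ _ _ _ → ≡.refl)) ⟩
    pairs Inner *ℤ pairs (λ i j → Mixed i j *ℤ Mixed j i)
      ≡⟨ pairs-* Inner (λ i j → Mixed i j *ℤ Mixed j i) ⟨
    pairs (λ i j → Inner i j *ℤ (Mixed i j *ℤ Mixed j i))
      ≡⟨ pairs-cong recombine ⟩
    ε σ ∎)
    where
    open ≡.≡-Reasoning

    -- If `σ j` were outside `S`, it would be fixed, and injectivity would give `σ j ≡ j`.
    stable : ∀ j → lookup S (σ j) ≡ lookup S j
    stable j with lookup S j in Sj | lookup S (σ j) in Sσj
    ... | outside | s       = ≡.trans (≡.sym Sσj) (≡.trans (cong (lookup S) (fixed j Sj)) Sj)
    ... | inside  | inside  = ≡.refl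
    ... | inside  | outside = ≡.trans (≡.sym Sσj) (≡.trans (cong (lookup S) (σ-inj (fixed (σ j) Sσj))) Sj)

    Inner Mixed : Fin n → Fin n → ℤ
    Inner i j = if lookup S i ∧ lookup S j then sg (σ i) (σ j) else 1ℤ
    Mixed i j = if not (lookup S i) ∧ lookup S j then sg i j *ℤ sg i (σ j) else 1ℤ

    Mixed-diag : ∀ i → Mixed i i ≡ 1ℤ
    Mixed-diag i with lookup S i
    ... | inside  = ≡.refl
    ... | outside = ≡.refl

    row : ∀ i → productᶻ (Mixed i) ≡ 1ℤ
    row i with lookup S i in Si
    ... | inside  = ℤ-Product.sum-replicate-zero n
    ... | outside = begin
      productᶻ (λ j → if lookup S j then sg i j *ℤ sg i (σ j) else 1ℤ)
        ≡⟨ productᶻ-cong distribute ⟩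
      productᶻ (λ j → X j *ℤ X (σ j))
        ≡⟨ ℤ-Product.∑-distrib-+ X (X ∘ σ) ⟩
      productᶻ X *ℤ productᶻ (X ∘ σ)
        ≡⟨ cong (productᶻ X *ℤ_) (productᶻ-reindex σ-inj X) ⟩
      productᶻ X *ℤ productᶻ X
        ≡⟨ ℤ-Product.∑-distrib-+ X X ⟨
      productᶻ (λ j → X j *ℤ X j)
        ≡⟨ productᶻ-1 square ⟩
      1ℤ ∎
      where
      X : Fin n → ℤ
      X j = if lookup S j then sg i j else 1ℤ
      distribute : ∀ j → (if lookup S j then sg i j *ℤ sg i (σ j) else 1ℤ) ≡ X j *ℤ X (σ j)
      distribute j rewrite stable j with lookup S j
      ... | inside  = ≡.refl
      ... | outside = ≡.refl
      square : ∀ j → X j *ℤ X j ≡ 1ℤ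
      square j with lookup S j in Sj
      ... | inside  = sg² i j λ { ≡.refl → case ≡.trans (≡.sym Si) Sj of λ () }
      ... | outside = ≡.refl

    -- For one index inside `S` and one outside, the surviving `Mixed` factor is the wanted sign
    -- times `sg` of the unmoved pair; as `i < j`, the latter is 1, or -1 together with the
    -- arguments exchanged.
    recombine : ∀ i j → i Fin.< j →
      Inner i j *ℤ (Mixed i j *ℤ Mixed j i) ≡ sg (σ i) (σ j)
    recombine i j i<j with lookup S i in Si | lookup S j in Sj
    ... | inside  | inside  = ℤ.*-identityʳ (sg (σ i) (σ j))
    ... | outside | outside rewrite fixed i Si | fixed j Sj = ≡.sym (sg-< i<j)
    ... | outside | inside  rewrite fixed i Si | sg-< i<j =
      ≡.trans (ℤ.*-identityˡ _) (≡.trans (ℤ.*-identityʳ _) (ℤ.*-identityˡ _))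
    ... | inside  | outside rewrite fixed j Sj | sg-> i<j =
      ≡.trans (ℤ.*-identityˡ _) (≡.trans (ℤ.*-identityˡ _) (≡.sym (sg-antisym (σ i) j)))

-- `M ∘ rotate j` is `M` with row `j` brought to the top and the other rows in their order.
rotate : Fin (suc n) → Fin (suc n) → Fin (suc n)
rotate j = j ◂ punchIn j

◂-injective : {j : Fin n} {g : Fin m → Fin n} → (∀ i → g i ≢ j) → IsInjective g → IsInjective (j ◂ g)
◂-injective g≢j g-inj {zero}  {zero}  _  = ≡.refl
◂-injective g≢j g-inj {zero}  {suc k} eq = contradiction (≡.sym eq) (g≢j k)
◂-injective g≢j g-inj {suc i} {zero}  eq = contradiction eq (g≢j i)
◂-injective g≢j g-inj {suc i} {suc k} eq = cong suc (g-inj eq)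

rotate-injective : (j : Fin (suc n)) → IsInjective (rotate j)
rotate-injective j = ◂-injective (Fin.punchInᵢ≢i j) (Fin.punchIn-injective j _ _)

swap₀₁ : Fin (suc (suc n)) → Fin (suc (suc n))
swap₀₁ = suc zero ◂ (zero ◂ λ i → suc (suc i))

swap₀₁-injective : IsInjective (swap₀₁ {n})
swap₀₁-injective = ◂-injective (λ { zero () ; (suc _) () })
  (◂-injective (λ _ ()) (Fin.suc-injective ∘ Fin.suc-injective))

opaque
  unfolding ε

  ε-identity : ∀ n → ε {n} (λ i → i) ≡ 1ℤ
  ε-identity n = pairs-1 {A = sg {n}} λ _ _ → sg-<

  ε-swap₀₁ : ε (swap₀₁ {n}) ≡ -1ℤ
  ε-swap₀₁ {n} = cong₂ (λ x y → (-1ℤ *ℤ x) *ℤ (x *ℤ y)) {y = 1ℤ} {v = 1ℤ}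
    (ℤ-Product.sum-replicate-zero n) (ε-identity n)

-- Sums over all functions and the Leibniz formula

infix 4 _≗?_
_≗?_ : (f g : Fin m → Fin n) → Dec (f ≗ g)
f ≗? g = Fin.all? λ i → f i Fin.≟ g i

module RingSums {c ℓ} (A : CommutativeRing c ℓ) where
  open CommutativeRing A hiding (zero)
  open LinearAlgebra A
  open Relation.Binary.Reasoning.Setoid setoid
  module Sum = Algebra.Properties.Semiring.Sum semiring
  module Product = Algebra.Properties.CommutativeMonoid.Sum *-commutativeMonoid
  open Algebra.Properties.Semiring.Mult semiring using (×-homo-+; ×1-homo-*) renaming (_×_ to infixr 8 _×ᴺ_)
  open Algebra.Properties.Ring ring using (-0#≈0#; -‿involutive; -‿+-comm; xyx⁻¹≈y; -1*x≈-x)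
  open Algebra.Properties.CommutativeSemigroup *-commutativeSemigroup using (interchange; x∙yz≈y∙xz)

  sum-cong : {f g : Fin n → Carrier} → (∀ i → f i ≈ g i) → sum f ≈ sum g
  sum-cong = Sum.sum-cong-≋

  product-cong : {f g : Fin n → Carrier} → (∀ i → f i ≈ g i) → product f ≈ product g
  product-cong = Product.sum-cong-≋

  sum-0 : {f : Fin n → Carrier} → (∀ i → f i ≈ 0#) → sum f ≈ 0#
  sum-0 {n} f≈0 = trans (sum-cong f≈0) (Sum.sum-replicate-zero n)

  product-0 : (f : Fin n → Carrier) → ∀ i → f i ≈ 0# → product f ≈ 0#
  product-0 f zero    fi≈0 = trans (*-congʳ fi≈0) (zeroˡ _)
  product-0 f (suc i) fi≈0 = trans (*-congˡ (product-0 (f ∘ suc) i fi≈0)) (zeroʳ _)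

  sum-single : (f : Fin n → Carrier) → ∀ i → (∀ j → j ≢ i → f j ≈ 0#) → sum f ≈ f i
  sum-single {suc n} f i rest = trans (Sum.sum-remove {i = i} f)
    (trans (+-congˡ (sum-0 λ j → rest (punchIn i j) (Fin.punchInᵢ≢i i j))) (+-identityʳ (f i)))

  -- One nested sum per argument, so that expanding a product of sums is an induction on the number
  -- of factors.
  sumF : ((Fin m → Fin n) → Carrier) → Carrier
  sumF {zero}  f = f λ ()
  sumF {suc m} f = sum λ j → sumF λ g → f (j ◂ g)

  sumF-cong : {f f′ : (Fin m → Fin n) → Carrier} → (∀ g → f g ≈ f′ g) → sumF f ≈ sumF f′
  sumF-cong {zero}  f≈f′ = f≈f′ _
  sumF-cong {suc m} f≈f′ = sum-cong λ j → sumF-cong λ g → f≈f′ (j ◂ g)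

  sumF-0 : {f : (Fin m → Fin n) → Carrier} → (∀ g → f g ≈ 0#) → sumF f ≈ 0#
  sumF-0 {zero}  f≈0 = f≈0 _
  sumF-0 {suc m} f≈0 = sum-0 λ j → sumF-0 λ g → f≈0 (j ◂ g)

  *-distribˡ-sumF : ∀ x (f : (Fin m → Fin n) → Carrier) → x * sumF f ≈ sumF λ g → x * f g
  *-distribˡ-sumF {zero}  x f = refl
  *-distribˡ-sumF {suc m} x f = trans (Sum.*-distribˡ-sum x λ j → sumF λ g → f (j ◂ g))
    (sum-cong λ j → *-distribˡ-sumF x λ g → f (j ◂ g))

  sum-sumF-comm : (f : Fin p → (Fin m → Fin n) → Carrier) →
    (sum λ k → sumF (f k)) ≈ sumF λ g → sum λ k → f k g
  sum-sumF-comm {m = zero}  f = refl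
  sum-sumF-comm {m = suc m} f = trans (Sum.∑-comm λ k j → sumF λ g → f k (j ◂ g))
    (sum-cong λ j → sum-sumF-comm λ k g → f k (j ◂ g))

  sumF-comm : ∀ {m′ n′} (f : (Fin m → Fin n) → (Fin m′ → Fin n′) → Carrier) →
    (sumF λ g → sumF (f g)) ≈ sumF λ h → sumF λ g → f g h
  sumF-comm {zero}  f = refl
  sumF-comm {suc m} f = trans (sum-cong λ j → sumF-comm λ g → f (j ◂ g))
    (sum-sumF-comm λ j h → sumF λ g → f (j ◂ g) h)

  product-sum : (U : Fin m → Fin n → Carrier) →
    (product λ i → sum (U i)) ≈ sumF λ h → product λ i → U i (h i)
  product-sum {zero}  U = refl
  product-sum {suc m} U = begin
    sum (U zero) * (product λ i → sum (U (suc i)))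
      ≈⟨ *-congˡ (product-sum (U ∘ suc)) ⟩
    sum (U zero) * (sumF λ h → product λ i → U (suc i) (h i))
      ≈⟨ Sum.*-distribʳ-sum _ (U zero) ⟩
    (sum λ j → U zero j * (sumF λ h → product λ i → U (suc i) (h i)))
      ≈⟨ sum-cong (λ j → *-distribˡ-sumF (U zero j) (λ h → product λ i → U (suc i) (h i))) ⟩
    (sum λ j → sumF λ h → U zero j * (product λ i → U (suc i) (h i))) ∎

  -- `sumF` evaluates its summand at functions assembled by `◂`. Naming any other function with the
  -- same values requires the summand to respect `≗`.
  Extensional : ((Fin m → Fin n) → Carrier) → Set _
  Extensional f = ∀ {g g′} → g ≗ g′ → f g ≈ f g′

  sumF-single : (f : (Fin m → Fin n) → Carrier) → Extensional f →
    ∀ g₀ → (∀ g → ¬ g ≗ g₀ → f g ≈ 0#) → sumF f ≈ f g₀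
  sumF-single {zero}  f ext g₀ rest = ext λ ()
  sumF-single {suc m} f ext g₀ rest = begin
    (sum λ j → sumF λ g → f (j ◂ g))
      ≈⟨ sum-single _ (g₀ zero) (λ j j≢ → sumF-0 λ g → rest (j ◂ g) λ eq → j≢ (eq zero)) ⟩
    (sumF λ g → f (g₀ zero ◂ g))
      ≈⟨ sumF-single (λ g → f (g₀ zero ◂ g)) (λ eq → ext λ { zero → ≡.refl ; (suc i) → eq i })
           (g₀ ∘ suc) (λ g g≢ → rest _ λ eq → g≢ (eq ∘ suc)) ⟩
    f (g₀ zero ◂ (g₀ ∘ suc))
      ≈⟨ ext (λ { zero → ≡.refl ; (suc i) → ≡.refl }) ⟩
    f g₀ ∎

  infix 8 _if_
  _if_ : ∀ {r} {P : Set r} → Carrier → Dec P → Carrier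
  x if P? = if ⌊ P? ⌋ then x else 0#

  if-yes : ∀ {r} {P : Set r} (P? : Dec P) x → P → x if P? ≈ x
  if-yes (yes _) x _ = refl
  if-yes (no ¬p) x p = contradiction p ¬p

  if-no : ∀ {r} {P : Set r} (P? : Dec P) x → ¬ P → x if P? ≈ 0#
  if-no (yes p) x ¬p = contradiction p ¬p
  if-no (no _)  x _  = refl

  if-cong : ∀ {r s} {P : Set r} {Q : Set s} (P? : Dec P) (Q? : Dec Q) → (P → Q) → (Q → P) →
    ∀ {x y} → x ≈ y → x if P? ≈ y if Q?
  if-cong (yes _) (yes _) _ _ eq = eq
  if-cong (yes p) (no ¬q) f _ _  = contradiction (f p) ¬q
  if-cong (no ¬p) (yes q) _ g _  = contradiction (g q) ¬p
  if-cong (no _)  (no _)  _ _ _  = refl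

  -- Insert the indicator of `h ≗ g ∘ τ`, exchange the two sums, and observe that each `h` arises
  -- from `h ∘ τ⁻¹` alone.
  sumF-∘ : {τ : Fin m → Fin m} → IsInjective τ → (f : (Fin m → Fin n) → Carrier) → Extensional f →
    (sumF λ g → f (g ∘ τ)) ≈ sumF f
  sumF-∘ {τ = τ} τ-inj f ext = begin
    (sumF λ g → f (g ∘ τ))
      ≈⟨ sumF-cong (λ g → trans
           (sumF-single (λ h → f h if (h ≗? g ∘ τ))
             (λ {h} {h′} eq → if-cong (h ≗? g ∘ τ) (h′ ≗? g ∘ τ)
               (λ p i → ≡.trans (≡.sym (eq i)) (p i)) (λ p i → ≡.trans (eq i) (p i)) (ext eq))
             (g ∘ τ) (λ h → if-no (h ≗? g ∘ τ) (f h)))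
           (if-yes (g ∘ τ ≗? g ∘ τ) (f (g ∘ τ)) (λ _ → ≡.refl))) ⟨
    (sumF λ g → sumF λ h → f h if (h ≗? g ∘ τ))
      ≈⟨ sumF-comm (λ g h → f h if (h ≗? g ∘ τ)) ⟩
    (sumF λ h → sumF λ g → f h if (h ≗? g ∘ τ))
      ≈⟨ sumF-cong (λ h → trans
           (sumF-single (λ g → f h if (h ≗? g ∘ τ))
             (λ {g} {g′} eq → if-cong (h ≗? g ∘ τ) (h ≗? g′ ∘ τ)
               (λ p i → ≡.trans (p i) (eq (τ i))) (λ p i → ≡.trans (p i) (≡.sym (eq (τ i)))) refl)
             (h ∘ τ⁻¹) (λ g g≢ → if-no (h ≗? g ∘ τ) (f h) λ p → g≢ λ j →
               ≡.trans (cong g (≡.sym (τ∘τ⁻¹ j))) (≡.sym (p (τ⁻¹ j)))))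
           (if-yes (h ≗? h ∘ τ⁻¹ ∘ τ) (f h) (λ i → cong h (≡.sym (τ-inj (τ∘τ⁻¹ (τ i))))))) ⟩
    sumF f ∎
    where
    τ⁻¹ : Fin _ → Fin _
    τ⁻¹ = proj₁ ∘ injection⇒surjection τ-inj
    τ∘τ⁻¹ : ∀ j → τ (τ⁻¹ j) ≡ j
    τ∘τ⁻¹ = proj₂ ∘ injection⇒surjection τ-inj

  -- Functions that take the value `j` contribute nothing, so `j` can be removed from the sum over
  -- each argument. In the Leibniz formula `j` is the column already used by the first row.
  sumF-punchIn : (j : Fin (suc n)) (f : (Fin m → Fin (suc n)) → Carrier) →
    (∀ g i → g i ≡ j → f g ≈ 0#) → Extensional f →
    sumF f ≈ sumF λ σ → f (punchIn j ∘ σ)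
  sumF-punchIn {m = zero}  j f f-0 ext = ext λ ()
  sumF-punchIn {m = suc m} j f f-0 ext = begin
    (sum λ k → sumF λ g → f (k ◂ g))
      ≈⟨ Sum.sum-remove {i = j} (λ k → sumF λ g → f (k ◂ g)) ⟩
    (sumF λ g → f (j ◂ g)) + (sum λ k → sumF λ g → f (punchIn j k ◂ g))
      ≈⟨ +-cong (sumF-0 λ g → f-0 (j ◂ g) zero ≡.refl)
           (sum-cong λ k → sumF-punchIn j (λ g → f (punchIn j k ◂ g)) (λ g i → f-0 _ (suc i))
             λ eq → ext λ { zero → ≡.refl ; (suc i) → eq i }) ⟩
    0# + (sum λ k → sumF λ σ → f (punchIn j k ◂ (punchIn j ∘ σ)))
      ≈⟨ +-identityˡ _ ⟩
    (sum λ k → sumF λ σ → f (punchIn j k ◂ (punchIn j ∘ σ)))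
      ≈⟨ sum-cong (λ k → sumF-cong λ σ →
           ext {punchIn j k ◂ (punchIn j ∘ σ)} {punchIn j ∘ (k ◂ σ)} λ { zero → ≡.refl ; (suc i) → ≡.refl }) ⟩
    (sumF λ σ → f (punchIn j ∘ σ)) ∎

  -- The change of variables from forests to pairs (h, σ). Each summand on the left becomes a double
  -- sum with an indicator; after exchanging the sums, a pair collects its own value from its unique
  -- index, or the value is zero anyway.
  sum-image : ∀ {N m′ n′} (f : (Fin m → Fin n) → (Fin m′ → Fin n′) → Carrier) →
    (∀ {g g′ h h′} → g ≗ g′ → h ≗ h′ → f g h ≈ f g′ h′) →
    (ι : Fin N → Fin m → Fin n) (κ : Fin N → Fin m′ → Fin n′) →
    (∀ {i j} → ι i ≗ ι j → κ i ≗ κ j → i ≡ j) →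
    (∀ g h → f g h ≈ 0# ⊎ (∃ λ i → ι i ≗ g × κ i ≗ h)) →
    (sum λ i → f (ι i) (κ i)) ≈ sumF λ g → sumF (f g)
  sum-image f ext ι κ inj onto = begin
    (sum λ i → f (ι i) (κ i))
      ≈⟨ sum-cong (λ i → begin
           (sumF λ g → sumF (term i g))
             ≈⟨ sumF-single (λ g → sumF (term i g))
                  (λ g≗g′ → sumF-cong λ h → term-ext i {h = h} g≗g′ (λ _ → ≡.refl)) (ι i)
                  (λ g g≢ → sumF-0 λ h → if-no (at? i g h) (f g h) (g≢ ∘ proj₁)) ⟩
           sumF (term i (ι i))
             ≈⟨ sumF-single (term i (ι i)) (term-ext i {ι i} (λ _ → ≡.refl)) (κ i)
                  (λ h h≢ → if-no (at? i (ι i) h) (f (ι i) h) (h≢ ∘ proj₂)) ⟩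
           term i (ι i) (κ i)
             ≈⟨ if-yes (at? i (ι i) (κ i)) _ ((λ _ → ≡.refl) , (λ _ → ≡.refl)) ⟩
           f (ι i) (κ i) ∎) ⟨
    (sum λ i → sumF λ g → sumF (term i g))
      ≈⟨ sum-sumF-comm (λ i g → sumF (term i g)) ⟩
    (sumF λ g → sum λ i → sumF (term i g))
      ≈⟨ sumF-cong (λ g → sum-sumF-comm λ i → term i g) ⟩
    (sumF λ g → sumF λ h → sum λ i → term i g h)
      ≈⟨ sumF-cong (λ g → sumF-cong (collapse g)) ⟩
    (sumF λ g → sumF (f g)) ∎
    where
    at? : ∀ i g h → Dec (g ≗ ι i × h ≗ κ i)
    at? i g h = g ≗? ι i ×-dec h ≗? κ i
    term : Fin _ → (Fin _ → Fin _) → (Fin _ → Fin _) → Carrier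
    term i g h = f g h if at? i g h
    term-ext : ∀ i {g g′ h h′} → g ≗ g′ → h ≗ h′ → term i g h ≈ term i g′ h′
    term-ext i {g} {g′} {h} {h′} g≗g′ h≗h′ = if-cong (at? i g h) (at? i g′ h′)
      (λ (p , q) → (λ k → ≡.trans (≡.sym (g≗g′ k)) (p k)) , (λ k → ≡.trans (≡.sym (h≗h′ k)) (q k)))
      (λ (p , q) → (λ k → ≡.trans (g≗g′ k) (p k)) , (λ k → ≡.trans (h≗h′ k) (q k)))
      (ext g≗g′ h≗h′)
    collapse : ∀ g h → (sum λ i → term i g h) ≈ f g h
    collapse g h with onto g h
    ... | inj₁ f≈0 = trans (sum-0 λ i → vanish i) (sym f≈0)
      where
      vanish : ∀ i → term i g h ≈ 0#
      vanish i with at? i g h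
      ... | yes _ = f≈0
      ... | no _  = refl
    ... | inj₂ (i , p , q) = trans
      (sum-single (λ j → term j g h) i λ j j≢i → if-no (at? j g h) (f g h) λ (p′ , q′) →
        j≢i (inj (λ k → ≡.trans (≡.sym (p′ k)) (≡.sym (p k)))
                 (λ k → ≡.trans (≡.sym (q′ k)) (≡.sym (q k)))))
      (if-yes (at? i g h) (f g h) ((λ k → ≡.sym (p k)) , (λ k → ≡.sym (q k))))

  -- The homomorphism from the integers

  fromℤ-⊖ : ∀ m n → fromℤ (m ℤ.⊖ n) ≈ m ×ᴺ 1# - n ×ᴺ 1#
  fromℤ-⊖ zero    zero    = sym (-‿inverseʳ 0#)
  fromℤ-⊖ zero    (suc n) = sym (+-identityˡ _)
  fromℤ-⊖ (suc m) zero    = sym (trans (+-congˡ -0#≈0#) (+-identityʳ _))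
  fromℤ-⊖ (suc m) (suc n) = begin
    fromℤ (suc m ℤ.⊖ suc n)                ≡⟨ cong fromℤ (ℤ.[1+m]⊖[1+n]≡m⊖n m n) ⟩
    fromℤ (m ℤ.⊖ n)                        ≈⟨ fromℤ-⊖ m n ⟩
    m ×ᴺ 1# - n ×ᴺ 1#                        ≈⟨ +-congʳ (xyx⁻¹≈y 1# (m ×ᴺ 1#)) ⟨
    1# + m ×ᴺ 1# - 1# - n ×ᴺ 1#              ≈⟨ +-assoc _ _ _ ⟩
    1# + m ×ᴺ 1# + (- 1# - n ×ᴺ 1#)          ≈⟨ +-congˡ (-‿+-comm 1# (n ×ᴺ 1#)) ⟩
    suc m ×ᴺ 1# - suc n ×ᴺ 1#                ∎

  fromℤ-+ : ∀ i j → fromℤ (i ℤ.+ j) ≈ fromℤ i + fromℤ j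
  fromℤ-+ (ℤ.+ m)    (ℤ.+ n)    = ×-homo-+ 1# m n
  fromℤ-+ (ℤ.+ m)    ℤ.-[1+ n ] = fromℤ-⊖ m (suc n)
  fromℤ-+ ℤ.-[1+ m ] (ℤ.+ n)    = trans (fromℤ-⊖ n (suc m)) (+-comm _ _)
  fromℤ-+ ℤ.-[1+ m ] ℤ.-[1+ n ] = begin
    - (suc (suc (m ℕ.+ n)) ×ᴺ 1#)          ≡⟨ cong (λ k → - (suc k ×ᴺ 1#)) (ℕ.+-suc m n) ⟨
    - ((suc m ℕ.+ suc n) ×ᴺ 1#)            ≈⟨ -‿cong (×-homo-+ 1# (suc m) (suc n)) ⟩
    - (suc m ×ᴺ 1# + suc n ×ᴺ 1#)           ≈⟨ -‿+-comm _ _ ⟨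
    - (suc m ×ᴺ 1#) - suc n ×ᴺ 1#           ∎

  fromSign : Sign.Sign → Carrier
  fromSign Sign.+ = 1#
  fromSign Sign.- = - 1#

  fromℤ-◃ : ∀ s n → fromℤ (s ℤ.◃ n) ≈ fromSign s * n ×ᴺ 1#
  fromℤ-◃ s      zero    = sym (zeroʳ _)
  fromℤ-◃ Sign.+ (suc n) = sym (*-identityˡ _)
  fromℤ-◃ Sign.- (suc n) = sym (-1*x≈-x _)

  fromℤ-sign : ∀ i → fromℤ i ≈ fromSign (ℤ.sign i) * ℤ.∣ i ∣ ×ᴺ 1#
  fromℤ-sign i = trans (reflexive (cong fromℤ (≡.sym (ℤ.◃-inverse i)))) (fromℤ-◃ (ℤ.sign i) ℤ.∣ i ∣)

  fromSign-* : ∀ s t → fromSign (s Sign.* t) ≈ fromSign s * fromSign t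
  fromSign-* Sign.+ t      = sym (*-identityˡ _)
  fromSign-* Sign.- Sign.+ = sym (*-identityʳ _)
  fromSign-* Sign.- Sign.- = sym (trans (-1*x≈-x (- 1#)) (-‿involutive 1#))

  fromℤ-* : ∀ i j → fromℤ (i *ℤ j) ≈ fromℤ i * fromℤ j
  fromℤ-* i j = begin
    fromℤ (i *ℤ j)
      ≈⟨ fromℤ-◃ (ℤ.sign i Sign.* ℤ.sign j) (ℤ.∣ i ∣ ℕ.* ℤ.∣ j ∣) ⟩
    fromSign (ℤ.sign i Sign.* ℤ.sign j) * (ℤ.∣ i ∣ ℕ.* ℤ.∣ j ∣) ×ᴺ 1#
      ≈⟨ *-cong (fromSign-* (ℤ.sign i) (ℤ.sign j)) (×1-homo-* ℤ.∣ i ∣ ℤ.∣ j ∣) ⟩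
    fromSign (ℤ.sign i) * fromSign (ℤ.sign j) * (ℤ.∣ i ∣ ×ᴺ 1# * ℤ.∣ j ∣ ×ᴺ 1#)
      ≈⟨ interchange _ _ _ _ ⟩
    fromSign (ℤ.sign i) * ℤ.∣ i ∣ ×ᴺ 1# * (fromSign (ℤ.sign j) * ℤ.∣ j ∣ ×ᴺ 1#)
      ≈⟨ *-cong (fromℤ-sign i) (fromℤ-sign j) ⟨
    fromℤ i * fromℤ j ∎

  fromℤ-1 : fromℤ 1ℤ ≈ 1#
  fromℤ-1 = +-identityʳ 1#

  fromℤ-product : (f : Fin n → ℤ) → fromℤ (productᶻ f) ≈ product λ i → fromℤ (f i)
  fromℤ-product {zero}  f = fromℤ-1
  fromℤ-product {suc n} f = trans (fromℤ-* (f zero) (productᶻ (f ∘ suc))) (*-congˡ (fromℤ-product (f ∘ suc)))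

  fromℤ-sum : (f : Fin n → ℤ) → fromℤ (sumᶻ f) ≈ sum λ i → fromℤ (f i)
  fromℤ-sum {zero}  f = refl
  fromℤ-sum {suc n} f = trans (fromℤ-+ (f zero) (sumᶻ (f ∘ suc))) (+-congˡ (fromℤ-sum (f ∘ suc)))

  fromℤ-−1^ : ∀ k → fromℤ (-1ℤ ^ᶻ k) ≈ (- 1#) ^ k
  fromℤ-−1^ zero    = fromℤ-1
  fromℤ-−1^ (suc k) = trans (fromℤ-* -1ℤ (-1ℤ ^ᶻ k)) (*-cong (-‿cong fromℤ-1) (fromℤ-−1^ k))

  -- Determinants as sums over functions

  det-cong : {M N : Matrix Carrier n n} → (∀ i j → M i j ≈ N i j) → det M ≈ det N
  det-cong {zero}  M≈N = refl
  det-cong {suc n} M≈N = sum-cong λ j → *-cong (*-congˡ {(- 1#) ^ toℕ j} (M≈N zero j))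
    (det-cong λ i k → M≈N (suc i) (punchIn j k))

  -- The sum may run over all functions because `ε` vanishes off permutations. In Laplace expansion
  -- along column `j` of the first row, a `σ` of the minor becomes `punchIn j ∘ σ`, and functions
  -- that use `j` again have sign 0.
  leibniz : (M : Matrix Carrier n n) → det M ≈ sumF λ σ → fromℤ (ε σ) * product λ i → M i (σ i)
  leibniz {zero}  M = sym (trans (*-identityʳ _) (trans (reflexive (cong fromℤ (ε-[] λ ()))) fromℤ-1))
  leibniz {suc n} M = sum-cong λ j → begin
    (- 1#) ^ toℕ j * M zero j * det (minor j)
      ≈⟨ *-congˡ (leibniz (minor j)) ⟩
    (- 1#) ^ toℕ j * M zero j * (sumF λ σ → fromℤ (ε σ) * product λ i → minor j i (σ i))
      ≈⟨ *-distribˡ-sumF _ (λ σ → fromℤ (ε σ) * product λ i → minor j i (σ i)) ⟩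
    (sumF λ σ → (- 1#) ^ toℕ j * M zero j * (fromℤ (ε σ) * product λ i → minor j i (σ i)))
      ≈⟨ sumF-cong (λ σ → trans (interchange _ _ _ _)
           (*-congʳ (trans (*-congʳ (sym (fromℤ-−1^ (toℕ j))))
             (trans (sym (fromℤ-* (-1ℤ ^ᶻ toℕ j) (ε σ))) (reflexive (cong fromℤ (≡.sym (ε-◂ j σ)))))))) ⟩
    (sumF λ σ → term j (punchIn j ∘ σ))
      ≈⟨ sumF-punchIn j (term j)
           (λ g i gi≡j → trans (*-congʳ (reflexive (cong fromℤ
             (ε-collision (j ◂ g) {zero} {suc i} (λ ()) (≡.sym gi≡j))))) (zeroˡ _))
           (λ {g} {g′} eq → *-cong (reflexive (cong fromℤ (ε-cong {f = j ◂ g} {j ◂ g′}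
               λ { zero → ≡.refl ; (suc i) → eq i })))
             (*-congˡ (product-cong λ i → reflexive (cong (M (suc i)) (eq i))))) ⟨
    sumF (term j) ∎
    where
    minor : Fin _ → Matrix Carrier _ _
    minor j i k = M (suc i) (punchIn j k)
    term : Fin _ → (Fin _ → Fin _) → Carrier
    term j g = fromℤ (ε (j ◂ g)) * (M zero j * product λ i → M (suc i) (g i))

  -- Multilinearity in all rows at once: expand each Leibniz product over the choices `h` and
  -- exchange the sums. `V` may depend on the row because the choice "undefined" stands for the unit
  -- vector of that very row.
  det-sum : (U : Fin m → Fin n → Carrier) (V : Fin n → Fin m → Fin m → Carrier) →
    det (λ i j → sum λ a → U i a * V a i j)
      ≈ sumF λ h → (product λ i → U i (h i)) * det (λ i j → V (h i) i j)
  det-sum U V = begin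
    det (λ i j → sum λ a → U i a * V a i j)
      ≈⟨ leibniz (λ i j → sum λ a → U i a * V a i j) ⟩
    (sumF λ σ → fromℤ (ε σ) * product λ i → sum λ a → U i a * V a i (σ i))
      ≈⟨ sumF-cong (λ σ → *-congˡ (product-sum λ i a → U i a * V a i (σ i))) ⟩
    (sumF λ σ → fromℤ (ε σ) * sumF λ h → product λ i → U i (h i) * V (h i) i (σ i))
      ≈⟨ sumF-cong (λ σ → *-distribˡ-sumF (fromℤ (ε σ)) λ h → product λ i → U i (h i) * V (h i) i (σ i)) ⟩
    (sumF λ σ → sumF λ h → fromℤ (ε σ) * product λ i → U i (h i) * V (h i) i (σ i))
      ≈⟨ sumF-comm (λ σ h → fromℤ (ε σ) * product λ i → U i (h i) * V (h i) i (σ i)) ⟩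
    (sumF λ h → sumF λ σ → fromℤ (ε σ) * product λ i → U i (h i) * V (h i) i (σ i))
      ≈⟨ sumF-cong (λ h → trans
           (sumF-cong λ σ → trans
             (*-congˡ (Product.∑-distrib-+ (λ i → U i (h i)) (λ i → V (h i) i (σ i))))
             (x∙yz≈y∙xz _ _ _))
           (sym (*-distribˡ-sumF _ λ σ → fromℤ (ε σ) * product λ i → V (h i) i (σ i)))) ⟩
    (sumF λ h → (product λ i → U i (h i)) * sumF λ σ → fromℤ (ε σ) * product λ i → V (h i) i (σ i))
      ≈⟨ sumF-cong (λ h → *-congˡ (leibniz λ i j → V (h i) i j)) ⟨
    (sumF λ h → (product λ i → U i (h i)) * det (λ i j → V (h i) i j)) ∎

  fromℤ-det : (M : Matrix ℤ n n) → fromℤ (detᶻ M) ≈ det λ i j → fromℤ (M i j)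
  fromℤ-det {zero}  M = fromℤ-1
  fromℤ-det {suc n} M = trans
    (fromℤ-sum λ j → -1ℤ ^ᶻ toℕ j *ℤ M zero j *ℤ minor j)
    (sum-cong λ j → trans (fromℤ-* (-1ℤ ^ᶻ toℕ j *ℤ M zero j) (minor j))
      (*-cong (trans (fromℤ-* (-1ℤ ^ᶻ toℕ j) (M zero j)) (*-congʳ (fromℤ-−1^ (toℕ j))))
        (fromℤ-det λ i k → M (suc i) (punchIn j k))))
    where
    minor : Fin _ → ℤ
    minor j = detᶻ λ i k → M (suc i) (punchIn j k)

-- Determinants, adjugates and integer kernels

module RingMatrices {c ℓ} (A : CommutativeRing c ℓ) where
  open CommutativeRing A hiding (zero)
  open LinearAlgebra A
  open RingSums A
  open Relation.Binary.Reasoning.Setoid setoid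
  open Algebra.Properties.CommutativeSemigroup *-commutativeSemigroup using (x∙yz≈y∙xz)

  ⊛-assoc : ∀ {k} (X : Matrix Carrier m n) (Y : Matrix Carrier n p) (Z : Matrix Carrier p k) →
    ∀ i j → ((X ⊛ Y) ⊛ Z) i j ≈ (X ⊛ (Y ⊛ Z)) i j
  ⊛-assoc X Y Z i j = begin
    (sum λ l → (sum λ k → X i k * Y k l) * Z l j)
      ≈⟨ sum-cong (λ l → Sum.*-distribʳ-sum (Z l j) (λ k → X i k * Y k l)) ⟩
    (sum λ l → sum λ k → X i k * Y k l * Z l j)
      ≈⟨ Sum.∑-comm (λ l k → X i k * Y k l * Z l j) ⟩
    (sum λ k → sum λ l → X i k * Y k l * Z l j)
      ≈⟨ sum-cong (λ k → trans (sum-cong λ l → *-assoc (X i k) (Y k l) (Z l j))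
           (sym (Sum.*-distribˡ-sum (X i k) (λ l → Y k l * Z l j)))) ⟩
    (sum λ k → X i k * sum λ l → Y k l * Z l j) ∎

  ⊛-congˡ : {X Y : Matrix Carrier m n} (Z : Matrix Carrier n p) → (∀ i j → X i j ≈ Y i j) →
    ∀ i j → (X ⊛ Z) i j ≈ (Y ⊛ Z) i j
  ⊛-congˡ Z X≈Y i j = sum-cong λ k → *-congʳ (X≈Y i k)

  ⊛-congʳ : (X : Matrix Carrier m n) {Y Z : Matrix Carrier n p} → (∀ i j → Y i j ≈ Z i j) →
    ∀ i j → (X ⊛ Y) i j ≈ (X ⊛ Z) i j
  ⊛-congʳ X Y≈Z i j = sum-cong λ k → *-congˡ (Y≈Z k j)

  scalar : Carrier → Matrix Carrier n n
  scalar x = diagonal λ _ → x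

  scalar-≡ : ∀ x (i : Fin n) → scalar x i i ≈ x
  scalar-≡ x i = if-yes (i Fin.≟ i) x ≡.refl

  scalar-≢ : ∀ x {i j : Fin n} → i ≢ j → scalar x i j ≈ 0#
  scalar-≢ x {i} {j} = if-no (i Fin.≟ j) x

  scalar-⊛ : ∀ x (Y : Matrix Carrier m n) i j → (scalar x ⊛ Y) i j ≈ x * Y i j
  scalar-⊛ x Y i j = trans
    (sum-single (λ k → scalar x i k * Y k j) i
      (λ k k≢i → trans (*-congʳ (scalar-≢ x (k≢i ∘ ≡.sym))) (zeroˡ _)))
    (*-congʳ (scalar-≡ x i))

  ⊛-scalar : ∀ x (Y : Matrix Carrier m n) i j → (Y ⊛ scalar x) i j ≈ Y i j * x
  ⊛-scalar x Y i j = trans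
    (sum-single (λ k → Y i k * scalar x k j) j
      (λ k k≢j → trans (*-congˡ (scalar-≢ x k≢j)) (zeroʳ _)))
    (*-congˡ (scalar-≡ x j))

  -- If D E = x and E D′ = y are scalar, then E D y = E D E D′ = x E D′ = x y.
  left-from-right : ∀ {x y} (D E D′ : Matrix Carrier n n) →
    (∀ i j → (D ⊛ E) i j ≈ scalar x i j) → (∀ i j → (E ⊛ D′) i j ≈ scalar y i j) →
    ∀ i j → (E ⊛ D) i j * y ≈ x * scalar y i j
  left-from-right {x = x} {y} D E D′ DE ED′ i j = begin
    (E ⊛ D) i j * y                  ≈⟨ ⊛-scalar y (E ⊛ D) i j ⟨
    ((E ⊛ D) ⊛ scalar y) i j         ≈⟨ ⊛-congʳ (E ⊛ D) ED′ i j ⟨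
    ((E ⊛ D) ⊛ (E ⊛ D′)) i j         ≈⟨ ⊛-assoc E D (E ⊛ D′) i j ⟩
    (E ⊛ (D ⊛ (E ⊛ D′))) i j         ≈⟨ ⊛-congʳ E (⊛-assoc D E D′) i j ⟨
    (E ⊛ ((D ⊛ E) ⊛ D′)) i j         ≈⟨ ⊛-congʳ E (⊛-congˡ D′ DE) i j ⟩
    (E ⊛ (scalar x ⊛ D′)) i j        ≈⟨ sum-cong (λ k → trans (*-congˡ (scalar-⊛ x D′ k j)) (x∙yz≈y∙xz _ _ _)) ⟩
    (sum λ k → x * (E i k * D′ k j)) ≈⟨ Sum.*-distribˡ-sum x (λ k → E i k * D′ k j) ⟨
    x * (E ⊛ D′) i j                 ≈⟨ *-congˡ (ED′ i j) ⟩
    x * scalar y i j                 ∎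

  -- Substituting `σ ∘ τ` for `σ` in the Leibniz sum restores each product and changes each sign by
  -- `ε τ`.
  det-∘ : (M : Matrix Carrier n n) {τ : Fin n → Fin n} → IsInjective τ →
    det (M ∘ τ) ≈ fromℤ (ε τ) * det M
  det-∘ M {τ} τ-inj = begin
    det (M ∘ τ)
      ≈⟨ leibniz (M ∘ τ) ⟩
    sumF f
      ≈⟨ sumF-∘ τ-inj f (λ {σ} {σ′} eq → *-cong (reflexive (cong fromℤ (ε-cong {f = σ} {σ′} eq)))
           (product-cong λ i → reflexive (cong (M (τ i)) (eq i)))) ⟨
    (sumF λ σ → f (σ ∘ τ))
      ≈⟨ sumF-cong (λ σ → trans (*-cong (sign σ) (reindex σ)) (*-assoc _ _ _)) ⟩
    (sumF λ σ → fromℤ (ε τ) * (fromℤ (ε σ) * product λ i → M i (σ i)))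
      ≈⟨ *-distribˡ-sumF (fromℤ (ε τ)) (λ σ → fromℤ (ε σ) * product λ i → M i (σ i)) ⟨
    fromℤ (ε τ) * (sumF λ σ → fromℤ (ε σ) * product λ i → M i (σ i))
      ≈⟨ *-congˡ (leibniz M) ⟨
    fromℤ (ε τ) * det M ∎
    where
    f : (Fin _ → Fin _) → Carrier
    f σ = fromℤ (ε σ) * product λ i → M (τ i) (σ i)
    reindex : ∀ σ → (product λ i → M (τ i) (σ (τ i))) ≈ product λ i → M i (σ i)
    reindex σ = sym (Product.sum-permute (λ i → M i (σ i)) (injection⇒permutation τ-inj))
    sign : ∀ σ → fromℤ (ε (σ ∘ τ)) ≈ fromℤ (ε τ) * fromℤ (ε σ)
    sign σ = trans (reflexive (cong fromℤ (ε-∘ σ τ-inj))) (fromℤ-* (ε τ) (ε σ))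

  -- Exchanging equal rows leaves `M` unchanged. The conclusion `det M ≈ 0#` needs a ring without
  -- 2-torsion and is drawn over ℤ only.
  det-swap₀₁ : (M : Matrix Carrier (suc (suc n)) (suc (suc n))) →
    (∀ k → M zero k ≈ M (suc zero) k) → det M ≈ - 1# * det M
  det-swap₀₁ M eq = begin
    det M                     ≈⟨ det-cong rows ⟩
    det (M ∘ swap₀₁)          ≈⟨ det-∘ M swap₀₁-injective ⟩
    fromℤ (ε swap₀₁) * det M  ≈⟨ *-congʳ (trans (reflexive (cong fromℤ ε-swap₀₁)) (-‿cong fromℤ-1)) ⟩
    - 1# * det M              ∎
    where
    rows : ∀ i k → M i k ≈ M (swap₀₁ i) k
    rows zero          k = eq k
    rows (suc zero)    k = sym (eq k)
    rows (suc (suc i)) k = refl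

module ℤ-Sums = RingSums ℤ.+-*-commutativeRing
module ℤ-Matrices = RingMatrices ℤ.+-*-commutativeRing

open ℤ-Matrices using () renaming (scalar to scalarᶻ)

fromℤ≡id : ∀ i → fromℤᶻ i ≡ i
fromℤ≡id (ℤ.+ n)    = fromℕ n
  where
  fromℕ : ∀ n → fromℤᶻ (ℤ.+ n) ≡ ℤ.+ n
  fromℕ zero    = ≡.refl
  fromℕ (suc n) = cong ℤ.suc (fromℕ n)
fromℤ≡id ℤ.-[1+ n ] = cong ℤ.-_ (fromℤ≡id (ℤ.+ suc n))

i≡-i⇒i≡0 : ∀ i → i ≡ -1ℤ *ℤ i → i ≡ 0ℤ
i≡-i⇒i≡0 (ℤ.+ zero) _ = ≡.refl

det-permute : (M : Matrix ℤ n n) {τ : Fin n → Fin n} → IsInjective τ → detᶻ (M ∘ τ) ≡ ε τ *ℤ detᶻ M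
det-permute M {τ} τ-inj =
  ≡.trans (ℤ-Matrices.det-∘ M τ-inj) (cong (_*ℤ detᶻ M) (fromℤ≡id (ε τ)))

det-permute-0 : (M : Matrix ℤ n n) {τ : Fin n → Fin n} → IsInjective τ → detᶻ (M ∘ τ) ≡ 0ℤ → detᶻ M ≡ 0ℤ
det-permute-0 M {τ} τ-inj eq with ℤ.i*j≡0⇒i≡0∨j≡0 (ε τ) (≡.trans (≡.sym (det-permute M τ-inj)) eq)
... | inj₂ detM≡0 = detM≡0
... | inj₁ ετ≡0 = contradiction (≡.trans (≡.sym (ε²≡1 τ-inj)) (cong (_*ℤ ε τ) ετ≡0)) λ ()

det-equal-rows : (M : Matrix ℤ n n) {i j : Fin n} → i ≢ j → (∀ k → M i k ≡ M j k) → detᶻ M ≡ 0ℤ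
det-equal-rows {suc zero}    M {zero} {zero} i≢j _ = contradiction ≡.refl i≢j
det-equal-rows {suc (suc n)} M {i} {j} i≢j eq = det-permute-0 M {τ} τ-inj
  (i≡-i⇒i≡0 (detᶻ (M ∘ τ)) (ℤ-Matrices.det-swap₀₁ (M ∘ τ) λ k →
    ≡.trans (eq k) (cong (λ r → M r k) (≡.sym (Fin.punchIn-punchOut i≢j)))))
  where
  τ : Fin (suc (suc n)) → Fin (suc (suc n))
  -- `τ` sends 0 to `i` and 1 to `j`: `punchIn i` skips `i`, and the rotation brings the place of
  -- `j` among the remaining rows to the front.
  τ = i ◂ (punchIn i ∘ rotate (punchOut i≢j))
  τ-inj : IsInjective τ
  τ-inj = ◂-injective (λ _ → Fin.punchInᵢ≢i i _)
    (λ {x} {y} → rotate-injective (punchOut i≢j) ∘ Fin.punchIn-injective i _ _)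

-- The coefficients of the linear form that sends `u` to the determinant of `u` placed on top of
-- `M`; a generalised cross product of the rows of `M`.
cofactor : Matrix ℤ n (suc n) → Fin (suc n) → ℤ
cofactor M k = -1ℤ ^ᶻ toℕ k *ℤ detᶻ λ i l → M i (punchIn k l)

sum-cofactor : (u : Fin (suc n) → ℤ) (M : Matrix ℤ n (suc n)) →
  sumᶻ (λ k → u k *ℤ cofactor M k) ≡ detᶻ (u ◂ M)
sum-cofactor u M = ℤ-Sums.sum-cong λ k → ≡.trans
  (≡.sym (ℤ.*-assoc (u k) (-1ℤ ^ᶻ toℕ k) (minor k)))
  (cong (_*ℤ minor k) (ℤ.*-comm (u k) (-1ℤ ^ᶻ toℕ k)))
  where
  minor : Fin _ → ℤ
  minor k = detᶻ λ i l → M i (punchIn k l)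

-- `ε (rotate j)` is the usual sign of `j`, in the form in which it arises: from bringing row `j` to
-- the top.
adjugate : Matrix ℤ n n → Matrix ℤ n n
adjugate {suc n} M k j = ε (rotate j) *ℤ cofactor (M ∘ punchIn j) k

-- The entry is, up to `ε (rotate j)`, the determinant of row `i` on top of all rows but `j`. For
-- `i ≡ j` this is a rotation of `M`; otherwise row `i` occurs twice.
⊛-adjugate : (M : Matrix ℤ n n) → ∀ i j → (M ⊛ᶻ adjugate M) i j ≡ scalarᶻ (detᶻ M) i j
⊛-adjugate {suc n} M i j = ≡.trans expand (det-rows (i Fin.≟ j))
  where
  open ≡.≡-Reasoning
  expand : (M ⊛ᶻ adjugate M) i j ≡ ε (rotate j) *ℤ detᶻ (M i ◂ (M ∘ punchIn j))
  expand = begin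
    sumᶻ (λ k → M i k *ℤ (ε (rotate j) *ℤ cofactor (M ∘ punchIn j) k))
      ≡⟨ ℤ-Sums.sum-cong (λ k → x∙yz≈y∙xz (M i k) (ε (rotate j)) (cofactor (M ∘ punchIn j) k)) ⟩
    sumᶻ (λ k → ε (rotate j) *ℤ (M i k *ℤ cofactor (M ∘ punchIn j) k))
      ≡⟨ ℤ-Sums.Sum.*-distribˡ-sum (ε (rotate j)) (λ k → M i k *ℤ cofactor (M ∘ punchIn j) k) ⟨
    ε (rotate j) *ℤ sumᶻ (λ k → M i k *ℤ cofactor (M ∘ punchIn j) k)
      ≡⟨ cong (ε (rotate j) *ℤ_) (sum-cofactor (M i) (M ∘ punchIn j)) ⟩
    ε (rotate j) *ℤ detᶻ (M i ◂ (M ∘ punchIn j)) ∎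
    where open Algebra.Properties.CommutativeSemigroup ℤ.*-commutativeSemigroup using (x∙yz≈y∙xz)
  det-rows : Dec (i ≡ j) → ε (rotate j) *ℤ detᶻ (M i ◂ (M ∘ punchIn j)) ≡ scalarᶻ (detᶻ M) i j
  det-rows (yes ≡.refl) = begin
    ε (rotate i) *ℤ detᶻ (M i ◂ (M ∘ punchIn i))
      ≡⟨ cong (ε (rotate i) *ℤ_) (ℤ-Sums.det-cong {M = M i ◂ (M ∘ punchIn i)} {M ∘ rotate i}
           λ { zero _ → ≡.refl ; (suc _) _ → ≡.refl }) ⟩
    ε (rotate i) *ℤ detᶻ (M ∘ rotate i)
      ≡⟨ cong (ε (rotate i) *ℤ_) (det-permute M (rotate-injective i)) ⟩
    ε (rotate i) *ℤ (ε (rotate i) *ℤ detᶻ M)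
      ≡⟨ ℤ.*-assoc (ε (rotate i)) (ε (rotate i)) (detᶻ M) ⟨
    (ε (rotate i) *ℤ ε (rotate i)) *ℤ detᶻ M
      ≡⟨ cong (_*ℤ detᶻ M) (ε²≡1 (rotate-injective i)) ⟩
    1ℤ *ℤ detᶻ M
      ≡⟨ ℤ.*-identityˡ (detᶻ M) ⟩
    detᶻ M
      ≡⟨ ℤ-Matrices.scalar-≡ (detᶻ M) i ⟨
    scalarᶻ (detᶻ M) i i ∎
  det-rows (no i≢j) = begin
    ε (rotate j) *ℤ detᶻ (M i ◂ (M ∘ punchIn j))
      ≡⟨ cong (ε (rotate j) *ℤ_) (det-equal-rows (M i ◂ (M ∘ punchIn j)) {zero} {suc (punchOut (i≢j ∘ ≡.sym))}
           (λ ()) λ k → cong (λ r → M r k) (≡.sym (Fin.punchIn-punchOut (i≢j ∘ ≡.sym)))) ⟩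
    ε (rotate j) *ℤ 0ℤ
      ≡⟨ ℤ.*-zeroʳ (ε (rotate j)) ⟩
    0ℤ
      ≡⟨ ℤ-Matrices.scalar-≢ (detᶻ M) i≢j ⟨
    scalarᶻ (detᶻ M) i j ∎

Kernel : Matrix ℤ m n → Set
Kernel {n = n} M = ∃ λ (c : Fin n → ℤ) → (∃ λ j → c j ≢ 0ℤ) × ∀ i → sumᶻ (λ j → M i j *ℤ c j) ≡ 0ℤ

-- If D is a nonzero minor of the last columns, and no row completes D to a larger nonzero
-- minor, then the cofactors of the rows of D are a linear dependency.
kernel-or-minor : (M : Matrix ℤ m n) → Kernel M ⊎ (∃ λ (ρ : Fin n → Fin m) → detᶻ (M ∘ ρ) ≢ 0ℤ)
kernel-or-minor {n = zero}  M = inj₂ ((λ ()) , λ ())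
kernel-or-minor {n = suc n} M with kernel-or-minor (λ i j → M i (suc j))
... | inj₁ (c , (j , cj≢0) , Mc≡0) = inj₁ (0ℤ ◂ c , (suc j , cj≢0) , λ i →
  ≡.trans (cong₂ ℤ._+_ (ℤ.*-zeroʳ (M i zero)) (Mc≡0 i)) ≡.refl)
... | inj₂ (ρ , minor≢0) with Fin.any? (λ i → ¬? (detᶻ (M ∘ (i ◂ ρ)) ℤ.≟ 0ℤ))
...   | yes (i , det≢0) = inj₂ (i ◂ ρ , det≢0)
...   | no all≡0 = inj₁ (cofactor (M ∘ ρ) , (zero , λ eq → minor≢0 (≡.trans (≡.sym (ℤ.*-identityˡ _)) eq)) ,
    λ i → ≡.trans (sum-cofactor (M i) (M ∘ ρ)) (≡.trans
      (ℤ-Sums.det-cong {M = M i ◂ (M ∘ ρ)} {M ∘ (i ◂ ρ)} λ { zero _ → ≡.refl ; (suc _) _ → ≡.refl })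
      (decidable-stable (detᶻ (M ∘ (i ◂ ρ)) ℤ.≟ 0ℤ) λ ≢0 → all≡0 (i , ≢0))))

-- For a square matrix, a minor on rows chosen by `ρ` is the determinant up to sign if `ρ` is a
-- permutation, and has a repeated row otherwise. Either way it vanishes, which leaves the kernel
-- vector.
singular⇒kernel : (M : Matrix ℤ n n) → detᶻ M ≡ 0ℤ → Kernel M
singular⇒kernel M detM≡0 with kernel-or-minor M
... | inj₁ kernel = kernel
... | inj₂ (ρ , minor≢0) with injective? ρ
...   | yes ρ-inj = contradiction
  (≡.trans (det-permute M ρ-inj) (≡.trans (cong (ε ρ *ℤ_) detM≡0) (ℤ.*-zeroʳ (ε ρ)))) minor≢0
...   | no ¬ρ-inj = contradiction collide minor≢0
  where
  collide : detᶻ (M ∘ ρ) ≡ 0ℤ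
  collide = let i , j , i≢j , eq = collision ρ ¬ρ-inj in
    det-equal-rows (M ∘ ρ) i≢j λ k → cong (λ r → M r k) eq

-- Apply `left-from-right` to `M`, its adjugate `E` and the adjugate of `E`, then cancel `detᶻ E`.
-- This is nonzero: `E c = 0` implies `detᶻ M · c = M E c = 0`, so `E` has trivial kernel.
adjugate-⊛ : (M : Matrix ℤ n n) → detᶻ M ≢ 0ℤ → ∀ i j → (adjugate M ⊛ᶻ M) i j ≡ scalarᶻ (detᶻ M) i j
adjugate-⊛ M detM≢0 i j = ℤ.*-cancelʳ-≡ ((E ⊛ᶻ M) i j) (scalarᶻ (detᶻ M) i j) (detᶻ E) {{ℤ.≢-nonZero detE≢0}} (≡.trans
  (ℤ-Matrices.left-from-right M E (adjugate E) (⊛-adjugate M) (⊛-adjugate E) i j) (swap (i Fin.≟ j)))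
  where
  E = adjugate M
  open ≡.≡-Reasoning
  detE≢0 : detᶻ E ≢ 0ℤ
  detE≢0 eq with singular⇒kernel E eq
  ... | c , (j , cj≢0) , Ec≡0 with ℤ.i*j≡0⇒i≡0∨j≡0 (detᶻ M) (begin
      detᶻ M *ℤ c j
        ≡⟨ ℤ-Matrices.scalar-⊛ (detᶻ M) C j zero ⟨
      (scalarᶻ (detᶻ M) ⊛ᶻ C) j zero
        ≡⟨ ℤ-Matrices.⊛-congˡ {X = M ⊛ᶻ E} {scalarᶻ (detᶻ M)} C (⊛-adjugate M) j zero ⟨
      ((M ⊛ᶻ E) ⊛ᶻ C) j zero
        ≡⟨ ℤ-Matrices.⊛-assoc M E C j zero ⟩
      (M ⊛ᶻ (E ⊛ᶻ C)) j zero
        ≡⟨ ℤ-Sums.sum-0 {f = λ k → M j k *ℤ (E ⊛ᶻ C) k zero}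
             (λ k → ≡.trans (cong (M j k *ℤ_) (Ec≡0 k)) (ℤ.*-zeroʳ (M j k))) ⟩
      0ℤ ∎)
    where
    C : Matrix ℤ _ 1
    C k _ = c k
  ... | inj₁ detM≡0 = detM≢0 detM≡0
  ... | inj₂ cj≡0   = cj≢0 cj≡0
  swap : Dec (i ≡ j) → detᶻ M *ℤ scalarᶻ (detᶻ E) i j ≡ scalarᶻ (detᶻ M) i j *ℤ detᶻ E
  swap (yes ≡.refl) = ≡.trans (cong (detᶻ M *ℤ_) (ℤ-Matrices.scalar-≡ (detᶻ E) i))
    (cong (_*ℤ detᶻ E) (≡.sym (ℤ-Matrices.scalar-≡ (detᶻ M) i)))
  swap (no i≢j) = ≡.trans (cong (detᶻ M *ℤ_) (ℤ-Matrices.scalar-≢ (detᶻ E) i≢j))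
    (≡.trans (ℤ.*-zeroʳ (detᶻ M)) (cong (_*ℤ detᶻ E) (≡.sym (ℤ-Matrices.scalar-≢ (detᶻ M) i≢j))))

-- Integers as real numbers

module ℝ-Ring = CommutativeRing ℝ-commutativeRing
module ℚ-LinearAlgebra = LinearAlgebra ℚ.+-*-commutativeRing

constant∼ : ∀ r → (λ _ → r) ∼ (λ _ → r)
constant∼ r = mk∼ λ e e>0 → 0 , λ _ _ _ _ →
  subst (λ y → ℚ.∣ y ∣ ℚ.< e) (≡.sym (ℚ.+-inverseʳ r)) e>0

constant : ℚ → ℝ
constant r = real (λ _ → r) (constant∼ r)

opaque
  unfolding _+ʳ_

  constant-0 : 0ʳ ≃ constant 0ℚ
  constant-0 = mk≃ (constant∼ 0ℚ)

  constant-+ : ∀ x y → constant x +ʳ constant y ≃ constant (x ℚ.+ y)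
  constant-+ x y = mk≃ (constant∼ (x ℚ.+ y))

  constant-1 : 1ʳ ≃ constant 1ℚ
  constant-1 = mk≃ (constant∼ 1ℚ)

  constant-neg : ∀ x → -ʳ constant x ≃ constant (ℚ.- x)
  constant-neg x = mk≃ (constant∼ (ℚ.- x))

  constant-inverse : ∀ x .{{_ : ℚ.NonZero x}} → constant x *ʳ constant (ℚ.1/ x) ≃ 1ʳ
  constant-inverse x = mk≃ (subst (λ y → (λ _ → y) ∼ (λ _ → 1ℚ)) (≡.sym (ℚ.*-inverseʳ x)) (constant∼ 1ℚ))

  -- At precision 1/2 the two constant sequences would have to be less than 1/2 apart.
  1≄0 : ¬ 1ʳ ≃ 0ʳ
  1≄0 (mk≃ (mk∼ close)) = let N , h = close ½ (ℚ.positive⁻¹ ½) in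
    ℚ.<-asym (h N N ℕ.≤-refl ℕ.≤-refl) (ℚ.*<* (ℤ.+<+ (s≤s (s≤s z≤n))))

constant-fromℕ : ∀ n → ℝ-LinearAlgebra.fromℤ (ℤ.+ n) ≃ constant (ℚ-LinearAlgebra.fromℤ (ℤ.+ n))
constant-fromℕ zero    = constant-0
constant-fromℕ (suc n) = ℝ-Ring.trans (ℝ-Ring.+-cong constant-1 (constant-fromℕ n))
  (constant-+ 1ℚ (ℚ-LinearAlgebra.fromℤ (ℤ.+ n)))

constant-fromℤ : ∀ k → ℝ-LinearAlgebra.fromℤ k ≃ constant (ℚ-LinearAlgebra.fromℤ k)
constant-fromℤ (ℤ.+ n)    = constant-fromℕ n
constant-fromℤ ℤ.-[1+ n ] = ℝ-Ring.trans (ℝ-Ring.-‿cong (constant-fromℕ (suc n)))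
  (constant-neg (ℚ-LinearAlgebra.fromℤ (ℤ.+ suc n)))

fromℤ-ℚ-nonneg : ∀ n → 0ℚ ℚ.≤ ℚ-LinearAlgebra.fromℤ (ℤ.+ n)
fromℤ-ℚ-nonneg zero    = ℚ.≤-refl
fromℤ-ℚ-nonneg (suc n) = ℚ.+-mono-≤ (ℚ.<⇒≤ (ℚ.positive⁻¹ 1ℚ)) (fromℤ-ℚ-nonneg n)

fromℤ-ℚ-pos : ∀ n → 0ℚ ℚ.< ℚ-LinearAlgebra.fromℤ (ℤ.+ suc n)
fromℤ-ℚ-pos n = ℚ.+-mono-<-≤ (ℚ.positive⁻¹ 1ℚ) (fromℤ-ℚ-nonneg n)

fromℤ-ℚ-≢0 : ∀ {k} → k ≢ 0ℤ → ℚ-LinearAlgebra.fromℤ k ≢ 0ℚ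
fromℤ-ℚ-≢0 {ℤ.+ zero}    k≢0 _  = k≢0 ≡.refl
fromℤ-ℚ-≢0 {ℤ.+ (suc n)} _   eq = ℚ.<⇒≢ (fromℤ-ℚ-pos n) (≡.sym eq)
fromℤ-ℚ-≢0 {ℤ.-[1+ n ]}  _   eq = ℚ.<⇒≢ (fromℤ-ℚ-pos n) (≡.sym (ℚ.neg-injective eq))

-- Only images of integers are ever inverted. They are constant sequences, so the reciprocal is the
-- constant sequence of a rational reciprocal.
fromℤ-inverse : ∀ {k} → k ≢ 0ℤ → ∃ λ r → ℝ-LinearAlgebra.fromℤ k *ʳ r ≃ 1ʳ
fromℤ-inverse {k} k≢0 = constant (ℚ.1/ x) ,
  ℝ-Ring.trans (ℝ-Ring.*-congʳ (constant-fromℤ k)) (constant-inverse x)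
  where
  x = ℚ-LinearAlgebra.fromℤ k
  instance
    x-nonZero : ℚ.NonZero x
    x-nonZero = ℚ.≢-nonZero (fromℤ-ℚ-≢0 k≢0)

fromℤ-ℝ-≄0 : ∀ {k} → k ≢ 0ℤ → ¬ ℝ-LinearAlgebra.fromℤ k ≃ 0ʳ
fromℤ-ℝ-≄0 k≢0 k≃0 = let r , kr≃1 = fromℤ-inverse k≢0 in
  1≄0 (ℝ-Ring.trans (ℝ-Ring.sym kr≃1) (ℝ-Ring.trans (ℝ-Ring.*-congʳ k≃0) (ℝ-Ring.zeroˡ r)))

-- Invertible matrices and vectors supported on a subset

Elements-≡ : {S : Subset n} {x y : Elements S} → proj₁ x ≡ proj₁ y → x ≡ y
Elements-≡ {x = i , p} {_ , q} ≡.refl = cong (i ,_) ([]=-irrelevant p q)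

element-from : (S : Subset n) (x : Elements S) → element S (from (increasing S) x) ≡ proj₁ x
element-from S x = cong proj₁ (strictlyInverseˡ (increasing S) x)

element-∈ : (S : Subset n) (k : Fin ∣ S ∣) → element S k ∈ S
element-∈ S k = proj₂ (to (increasing S) k)

module Extension {c ℓ} (A : CommutativeRing c ℓ) where
  open CommutativeRing A hiding (zero)

  extend : (S : Subset n) → (Fin ∣ S ∣ → Carrier) → Fin n → Carrier
  extend S a i with i ∈? S
  ... | yes i∈S = a (from (increasing S) (i , i∈S))
  ... | no _    = 0#

  extend-∉ : (S : Subset n) (a : Fin ∣ S ∣ → Carrier) → ∀ i → i ∉ S → extend S a i ≈ 0#
  extend-∉ S a i i∉S with i ∈? S
  ... | yes i∈S = contradiction i∈S i∉S
  ... | no _    = refl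

  extend-element : (S : Subset n) (a : Fin ∣ S ∣ → Carrier) → ∀ k → extend S a (element S k) ≈ a k
  extend-element S a k with element S k ∈? S
  ... | yes p = reflexive (cong a (≡.trans (cong (from (increasing S)) (Elements-≡ ≡.refl))
                                           (strictlyInverseʳ (increasing S) k)))
  ... | no ∉  = contradiction (element-∈ S k) ∉

module Inverses {c ℓ} (A : CommutativeRing c ℓ) where
  open Algebra.Properties.CommutativeSemigroup (CommutativeRing.*-commutativeSemigroup A) using (xy∙z≈xz∙y)
  open CommutativeRing A hiding (zero)
  open LinearAlgebra A
  open RingSums A
  open RingMatrices A
  open Relation.Binary.Reasoning.Setoid setoid

  Invertible : Matrix Carrier n n → Set _
  Invertible {n} D = ∃ λ (E : Matrix Carrier n n) →
    (∀ i j → (D ⊛ E) i j ≈ Id i j) × (∀ i j → (E ⊛ D) i j ≈ Id i j)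

  solvable : {D : Matrix Carrier n n} → Invertible D → (b : Fin n → Carrier) →
    ∃ λ (a : Fin n → Carrier) → ∀ i → (sum λ j → D i j * a j) ≈ b i
  solvable {n} {D} (E , DE , _) b = (λ j → (E ⊛ B) j zero) , λ i → begin
    (D ⊛ (E ⊛ B)) i zero  ≈⟨ ⊛-assoc D E B i zero ⟨
    ((D ⊛ E) ⊛ B) i zero  ≈⟨ ⊛-congˡ B DE i zero ⟩
    (Id ⊛ B) i zero       ≈⟨ scalar-⊛ 1# B i zero ⟩
    1# * b i              ≈⟨ *-identityˡ (b i) ⟩
    b i                   ∎
    where
    B : Matrix Carrier n 1
    B i _ = b i

  kernel-0 : {D : Matrix Carrier n n} → Invertible D → (a : Fin n → Carrier) →
    (∀ i → (sum λ j → D i j * a j) ≈ 0#) → ∀ i → a i ≈ 0#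
  kernel-0 {n} {D} (E , _ , ED) a Da≈0 i = begin
    a i                   ≈⟨ *-identityˡ (a i) ⟨
    1# * a i              ≈⟨ scalar-⊛ 1# C i zero ⟨
    (Id ⊛ C) i zero       ≈⟨ ⊛-congˡ C ED i zero ⟨
    ((E ⊛ D) ⊛ C) i zero  ≈⟨ ⊛-assoc E D C i zero ⟩
    (E ⊛ (D ⊛ C)) i zero  ≈⟨ sum-0 (λ k → trans (*-congˡ (Da≈0 k)) (zeroʳ _)) ⟩
    0#                    ∎
    where
    C : Matrix Carrier n 1
    C i _ = a i

  cokernel-0 : {D : Matrix Carrier n n} → Invertible D → (a : Fin n → Carrier) →
    (∀ j → (sum λ i → a i * D i j) ≈ 0#) → ∀ i → a i ≈ 0#
  cokernel-0 {n} {D} (E , DE , _) a aD≈0 i = begin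
    a i                   ≈⟨ *-identityʳ (a i) ⟨
    a i * 1#              ≈⟨ ⊛-scalar 1# C zero i ⟨
    (C ⊛ Id) zero i       ≈⟨ ⊛-congʳ C DE zero i ⟨
    (C ⊛ (D ⊛ E)) zero i  ≈⟨ ⊛-assoc C D E zero i ⟨
    ((C ⊛ D) ⊛ E) zero i  ≈⟨ sum-0 (λ k → trans (*-congʳ (aD≈0 k)) (zeroˡ _)) ⟩
    0#                    ∎
    where
    C : Matrix Carrier 1 n
    C _ i = a i

  fromℤ-invertible : (M : Matrix ℤ n n) → detᶻ M ≢ 0ℤ →
    (∃ λ r → fromℤ (detᶻ M) * r ≈ 1#) → Invertible (λ i j → fromℤ (M i j))
  fromℤ-invertible {n} M det≢0 (r , kr≈1) = E , right , left
    where
    k = detᶻ M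
    E : Matrix Carrier n n
    E i j = fromℤ (adjugate M i j) * r
    scale : ∀ i j → fromℤ (scalarᶻ k i j) * r ≈ Id i j
    scale i j with i Fin.≟ j
    ... | yes _ = kr≈1
    ... | no _  = zeroˡ r
    fromℤ-⊛ : (X Y : Matrix ℤ n n) → ∀ i j →
      fromℤ ((X ⊛ᶻ Y) i j) ≈ sum λ l → fromℤ (X i l) * fromℤ (Y l j)
    fromℤ-⊛ X Y i j = trans (fromℤ-sum λ l → X i l *ℤ Y l j) (sum-cong λ l → fromℤ-* (X i l) (Y l j))
    right : ∀ i j → (sum λ l → fromℤ (M i l) * (fromℤ (adjugate M l j) * r)) ≈ Id i j
    right i j = begin
      (sum λ l → fromℤ (M i l) * (fromℤ (adjugate M l j) * r))
        ≈⟨ sum-cong (λ l → *-assoc (fromℤ (M i l)) (fromℤ (adjugate M l j)) r) ⟨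
      (sum λ l → fromℤ (M i l) * fromℤ (adjugate M l j) * r)
        ≈⟨ Sum.*-distribʳ-sum r (λ l → fromℤ (M i l) * fromℤ (adjugate M l j)) ⟨
      (sum λ l → fromℤ (M i l) * fromℤ (adjugate M l j)) * r
        ≈⟨ *-congʳ (fromℤ-⊛ M (adjugate M) i j) ⟨
      fromℤ ((M ⊛ᶻ adjugate M) i j) * r
        ≈⟨ *-congʳ (reflexive (cong fromℤ (⊛-adjugate M i j))) ⟩
      fromℤ (scalarᶻ k i j) * r
        ≈⟨ scale i j ⟩
      Id i j ∎
    left : ∀ i j → (sum λ l → fromℤ (adjugate M i l) * r * fromℤ (M l j)) ≈ Id i j
    left i j = begin
      (sum λ l → fromℤ (adjugate M i l) * r * fromℤ (M l j))
        ≈⟨ sum-cong (λ l → xy∙z≈xz∙y (fromℤ (adjugate M i l)) r (fromℤ (M l j))) ⟩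
      (sum λ l → fromℤ (adjugate M i l) * fromℤ (M l j) * r)
        ≈⟨ Sum.*-distribʳ-sum r (λ l → fromℤ (adjugate M i l) * fromℤ (M l j)) ⟨
      (sum λ l → fromℤ (adjugate M i l) * fromℤ (M l j)) * r
        ≈⟨ *-congʳ (fromℤ-⊛ (adjugate M) M i j) ⟨
      fromℤ ((adjugate M ⊛ᶻ M) i j) * r
        ≈⟨ *-congʳ (reflexive (cong fromℤ (adjugate-⊛ M det≢0 i j))) ⟩
      fromℤ (scalarᶻ k i j) * r
        ≈⟨ scale i j ⟩
      Id i j ∎

-- Rooted forests and nonzero minors

selectedRow : Matrix ℤ p q → Fin (suc q) → Fin p → Fin p → ℤ
selectedRow δ zero    = scalarᶻ 1ℤ
selectedRow δ (suc f) = λ _ j → δ j f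

-- A partial map h from rows to columns, with zero for "undefined", selects for each row i
-- either the unit vector of i or the column h i of δ.
selection : Matrix ℤ p q → (Fin p → Fin (suc q)) → Matrix ℤ p p
selection δ h i = selectedRow δ (h i) i

-- K_h of the overview. If `h` codes a bijection from the complement of `R` to `F`, expansion along
-- the unit rows shows that this is, up to sign, the determinant of ∂ restricted to these rows and
-- columns.
minor : Matrix ℤ p q → (Fin p → Fin (suc q)) → ℤ
minor δ h = detᶻ (selection δ h)

module _ {R : Subset p} {F : Subset q} where

  code : (Elements (∁ R) → Elements F) → Fin p → Fin (suc q)
  code φ i with i ∈? R
  ... | yes _  = zero
  ... | no i∉R = suc (proj₁ (φ (i , x∉p⇒x∈∁p i∉R)))

  code-∈ : ∀ φ {i} → i ∈ R → code φ i ≡ zero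
  code-∈ φ {i} i∈R with i ∈? R
  ... | yes _  = ≡.refl
  ... | no i∉R = contradiction i∈R i∉R

  code-∉ : ∀ φ (r : Elements (∁ R)) → code φ (proj₁ r) ≡ suc (proj₁ (φ r))
  code-∉ φ (i , i∈∁R) with i ∈? R
  ... | yes i∈R = contradiction i∈R (x∈∁p⇒x∉p i∈∁R)
  ... | no _    = cong (suc ∘ proj₁ ∘ φ) (Elements-≡ ≡.refl)

module _ (G : SimplicialComplex n) (d : ℕ) where
  private
    module S = RingSums ℝ-commutativeRing
    module M = RingMatrices ℝ-commutativeRing
  open ℝ-LinearAlgebra
  open CommutativeRing ℝ-commutativeRing
    using (_*_; _≈_; 0#; 1#; +-commutativeMonoid; *-congʳ; *-congˡ; setoid; zeroˡ; zeroʳ; *-identityˡ)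
    renaming (trans to ≃-trans; sym to ≃-sym; refl to ≃-refl; reflexive to ≃-reflexive; *-comm to *ʳ-comm)
  open SubsetSums +-commutativeMonoid using (sum-element-support)
  open Extension ℝ-commutativeRing
  open Inverses ℝ-commutativeRing

  module _ {F : Subset (∣faces∣ G (suc d))} {R : Subset (∣faces∣ G d)} (φ : Elements (∁ R) ↔ Elements F) where
    private
      h = code (to φ)
      D = selection (∂ G d) h
      Dℝ : Matrix ℝ (∣faces∣ G d) (∣faces∣ G d)
      Dℝ i j = fromℤ (D i j)
      ψ : Fin ∣ ∁ R ∣ ↔ Fin ∣ F ∣
      ψ = ↔.↔-trans (increasing (∁ R)) (↔.↔-trans φ (↔.↔-sym (increasing F)))

    D-∈ : ∀ {i} → i ∈ R → ∀ j → D i j ≡ scalarᶻ 1ℤ i j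
    D-∈ {i} i∈R j = cong (λ a → selectedRow (∂ G d) a i j) (code-∈ (to φ) i∈R)

    D-∉ : ∀ r j → D (proj₁ r) j ≡ ∂ G d j (proj₁ (to φ r))
    D-∉ r j = cong (λ a → selectedRow (∂ G d) a (proj₁ r) j) (code-∉ (to φ) r)

    Dℝ-∈ : ∀ {i} → i ∈ R → ∀ j → Dℝ i j ≈ Id i j
    Dℝ-∈ {i} i∈R j rewrite D-∈ i∈R j with i Fin.≟ j
    ... | yes _ = S.fromℤ-1
    ... | no _  = ≃-refl

    element-ψ : ∀ l → element F (to ψ l) ≡ proj₁ (to φ (to (increasing (∁ R)) l))
    element-ψ l = element-from F (to φ (to (increasing (∁ R)) l))

    Dℝ-element : ∀ l j → Dℝ (element (∁ R) l) j ≈ ∂ℝ G d j (element F (to ψ l))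
    Dℝ-element l j = ≃-reflexive (cong fromℤ (≡.trans (D-∉ (to (increasing (∁ R)) l) j)
      (cong (∂ G d j) (≡.sym (element-ψ l)))))

    module _ (D⁻¹ : Invertible Dℝ) where
      -- The columns in `F` are the nonroot rows of `Dℝ`. A dependency among them, extended by zero
      -- to the root rows, annihilates `Dℝ` from the left.
      invertible⇒forest : IsForest G d F
      invertible⇒forest a eq k = ≃-trans (≃-reflexive (cong a (≡.sym (strictlyInverseˡ ψ k))))
        (≃-trans (≃-sym (extend-element (∁ R) (a ∘ to ψ) (from ψ k)))
          (cokernel-0 D⁻¹ b bD≈0 (element (∁ R) (from ψ k))))
        where
        open Relation.Binary.Reasoning.Setoid setoid
        b : Fin (∣faces∣ G d) → ℝ
        b = extend (∁ R) (a ∘ to ψ)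
        bD≈0 : ∀ j → (sum λ i → b i * Dℝ i j) ≈ 0#
        bD≈0 j = begin
          (sum λ i → b i * Dℝ i j)
            ≈⟨ sum-element-support (∁ R) (λ i → b i * Dℝ i j) (λ i i∉ →
                 ≃-trans (*-congʳ (extend-∉ (∁ R) (a ∘ to ψ) i i∉)) (zeroˡ (Dℝ i j))) ⟨
          (sum λ l → b (element (∁ R) l) * Dℝ (element (∁ R) l) j)
            ≈⟨ S.sum-cong (λ l → CommutativeRing.*-cong ℝ-commutativeRing
                 (extend-element (∁ R) (a ∘ to ψ) l) (Dℝ-element l j)) ⟩
          (sum λ l → a (to ψ l) * ∂ℝ G d j (element F (to ψ l)))
            ≈⟨ S.Sum.sum-permute (λ k → a k * ∂ℝ G d j (element F k)) ψ ⟨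
          (sum λ k → a k * ∂ℝ G d j (element F k))
            ≈⟨ eq j ⟩
          0# ∎

      -- A dependency among the nonroot rows of the forest matrix, extended by zero to `R`, lies in
      -- the right kernel of `Dℝ`: a unit row reads off a zero coefficient, and the row of a nonroot
      -- `r` evaluates the dependency at column `φ r`.
      invertible⇒root : IsRoot G d F R
      invertible⇒root = (λ k → Id (element (∁ R) k) , λ j → ≃-sym (≃-trans
               (M.scalar-⊛ 1# (∂ℝ^ G d F) (element (∁ R) k) j) (*-identityˡ _)))
           , independent , spanning
        where
        open Relation.Binary.Reasoning.Setoid setoid
        independent : LinearlyIndependent (λ k → ∂ℝ^ G d F (element (∁ R) k))
        independent a eq k = ≃-trans (≃-sym (extend-element (∁ R) a k))
          (kernel-0 D⁻¹ b Db≈0 (element (∁ R) k))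
          where
          b : Fin (∣faces∣ G d) → ℝ
          b = extend (∁ R) a
          Db-∈ : ∀ {i} → i ∈ R → (sum λ j → Dℝ i j * b j) ≈ 0#
          Db-∈ {i} i∈R = begin
            (sum λ j → Dℝ i j * b j)  ≈⟨ S.sum-cong (λ j → *-congʳ (Dℝ-∈ i∈R j)) ⟩
            (sum λ j → Id i j * b j)  ≈⟨ M.scalar-⊛ 1# (λ j (_ : Fin 1) → b j) i zero ⟩
            1# * b i                  ≈⟨ *-congˡ (extend-∉ (∁ R) a i (x∈p⇒x∉∁p i∈R)) ⟩
            1# * 0#                   ≈⟨ zeroʳ 1# ⟩
            0#                        ∎
          Db-∉ : ∀ r → (sum λ j → Dℝ (proj₁ r) j * b j) ≈ 0#
          Db-∉ r = begin
            (sum λ j → Dℝ i j * b j)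
              ≈⟨ sum-element-support (∁ R) (λ j → Dℝ i j * b j) (λ j j∉ →
                   ≃-trans (*-congˡ (extend-∉ (∁ R) a j j∉)) (zeroʳ (Dℝ i j))) ⟨
            (sum λ l → Dℝ i (element (∁ R) l) * b (element (∁ R) l))
              ≈⟨ S.sum-cong (λ l → ≃-trans (*ʳ-comm (Dℝ i (element (∁ R) l)) (b (element (∁ R) l)))
                   (CommutativeRing.*-cong ℝ-commutativeRing (extend-element (∁ R) a l)
                     (≃-reflexive (cong fromℤ (≡.trans (D-∉ r (element (∁ R) l))
                       (cong (∂ G d (element (∁ R) l)) (≡.sym (element-from F (to φ r))))))))) ⟩
            (sum λ l → a l * ∂ℝ G d (element (∁ R) l) (element F (from (increasing F) (to φ r))))
              ≈⟨ eq (from (increasing F) (to φ r)) ⟩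
            0# ∎
            where i = proj₁ r
          Db≈0 : ∀ i → (sum λ j → Dℝ i j * b j) ≈ 0#
          Db≈0 i = case i ∈? R of λ where
            (yes i∈R) → Db-∈ i∈R
            (no i∉R)  → Db-∉ (i , x∉p⇒x∈∁p i∉R)

        -- Prescribe `t` as `u`, carried over by `φ`, on the nonroots and as 0 on `R`, and solve
        -- `Dℝ c = t`. The unit rows force `c` to vanish on `R`, so only nonroot rows enter the
        -- combination.
        spanning : ∀ u → RowSpace (∂ℝ^ G d F) u → Span (λ k → ∂ℝ^ G d F (element (∁ R) k)) u
        spanning u _ = (λ k → c (element (∁ R) k)) , λ k → begin
          u k
            ≈⟨ ≃-reflexive (cong u (strictlyInverseˡ ψ k)) ⟨
          u (to ψ (from ψ k))
            ≈⟨ extend-element (∁ R) (u ∘ to ψ) (from ψ k) ⟨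
          t (element (∁ R) (from ψ k))
            ≈⟨ Dc≈t (element (∁ R) (from ψ k)) ⟨
          (sum λ j → Dℝ (element (∁ R) (from ψ k)) j * c j)
            ≈⟨ S.sum-cong (λ j → ≃-trans (*ʳ-comm _ (c j)) (*-congˡ (≃-trans (Dℝ-element (from ψ k) j)
                 (≃-reflexive (cong (λ k → ∂ℝ G d j (element F k)) (strictlyInverseˡ ψ k)))))) ⟩
          (sum λ j → c j * ∂ℝ^ G d F j k)
            ≈⟨ sum-element-support (∁ R) (λ j → c j * ∂ℝ^ G d F j k)
                 (λ j j∉ → ≃-trans (*-congʳ (c-∈ (x∉∁p⇒x∈p j∉))) (zeroˡ (∂ℝ^ G d F j k))) ⟨
          (sum λ l → c (element (∁ R) l) * ∂ℝ^ G d F (element (∁ R) l) k) ∎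
          where
          t : Fin (∣faces∣ G d) → ℝ
          t = extend (∁ R) (u ∘ to ψ)
          c : Fin (∣faces∣ G d) → ℝ
          c = proj₁ (solvable D⁻¹ t)
          Dc≈t : ∀ i → (sum λ j → Dℝ i j * c j) ≈ t i
          Dc≈t = proj₂ (solvable D⁻¹ t)
          c-∈ : ∀ {i} → i ∈ R → c i ≈ 0#
          c-∈ {i} i∈R = begin
            c i                       ≈⟨ *-identityˡ (c i) ⟨
            1# * c i                  ≈⟨ M.scalar-⊛ 1# (λ j (_ : Fin 1) → c j) i zero ⟨
            (sum λ j → Id i j * c j)  ≈⟨ S.sum-cong (λ j → *-congʳ (Dℝ-∈ i∈R j)) ⟨
            (sum λ j → Dℝ i j * c j)  ≈⟨ Dc≈t i ⟩
            t i                       ≈⟨ extend-∉ (∁ R) (u ∘ to ψ) i (x∈p⇒x∉∁p i∈R) ⟩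
            0#                        ∎

    rooted-forest : minor (∂ G d) h ≢ 0ℤ → IsForest G d F × IsRoot G d F R
    rooted-forest det≢0 = invertible⇒forest D⁻¹ , invertible⇒root D⁻¹
      where
      D⁻¹ : Invertible Dℝ
      D⁻¹ = fromℤ-invertible D det≢0 (fromℤ-inverse det≢0)

    -- A singular `D` has a nonzero integer kernel vector `c`. Its unit rows make `c` vanish on `R`;
    -- its other rows make `c` a real dependency among the nonroot rows, hence zero there too, since
    -- a nonzero integer is nonzero in `ℝ`.
    root⇒minor≢0 : IsRoot G d F R → minor (∂ G d) h ≢ 0ℤ
    root⇒minor≢0 (_ , independent , _) det≡0 with singular⇒kernel D det≡0
    ... | c , (j , cj≢0) , Dc≡0 = cj≢0 (c≡0 j)
      where
      open Relation.Binary.Reasoning.Setoid setoid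
      c-∈ : ∀ {i} → i ∈ R → c i ≡ 0ℤ
      c-∈ {i} i∈R = ≡.trans (≡.sym (ℤ.*-identityˡ (c i))) (≡.trans
        (≡.sym (ℤ-Matrices.scalar-⊛ 1ℤ (λ j (_ : Fin 1) → c j) i zero))
        (≡.trans (ℤ-Sums.sum-cong λ j → cong (_*ℤ c j) (≡.sym (D-∈ i∈R j))) (Dc≡0 i)))
      dependency : ∀ k → (sum λ l → fromℤ (c (element (∁ R) l)) * ∂ℝ^ G d F (element (∁ R) l) k) ≈ 0#
      dependency k = begin
        (sum λ l → fromℤ (c (element (∁ R) l)) * ∂ℝ^ G d F (element (∁ R) l) k)
          ≈⟨ sum-element-support (∁ R) (λ j → fromℤ (c j) * ∂ℝ^ G d F j k) (λ j j∉ →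
               ≃-trans (*-congʳ (≃-reflexive (cong fromℤ (c-∈ (x∉∁p⇒x∈p j∉))))) (zeroˡ (∂ℝ^ G d F j k))) ⟩
        (sum λ j → fromℤ (c j) * ∂ℝ^ G d F j k)
          ≈⟨ S.sum-cong (λ j → ≃-trans (*ʳ-comm (fromℤ (c j)) _) (*-congʳ (≃-trans
               (≃-reflexive (cong (λ k → ∂ℝ^ G d F j k) (≡.sym (strictlyInverseˡ ψ k))))
               (≃-sym (Dℝ-element (from ψ k) j))))) ⟩
        (sum λ j → Dℝ i j * fromℤ (c j))
          ≈⟨ S.sum-cong (λ j → S.fromℤ-* (D i j) (c j)) ⟨
        (sum λ j → fromℤ (D i j *ℤ c j))
          ≈⟨ S.fromℤ-sum (λ j → D i j *ℤ c j) ⟨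
        fromℤ (sumᶻ λ j → D i j *ℤ c j)
          ≈⟨ ≃-reflexive (cong fromℤ (Dc≡0 i)) ⟩
        0# ∎
        where i = element (∁ R) (from ψ k)
      c≡0 : ∀ j → c j ≡ 0ℤ
      c≡0 j with j ∈? R
      ... | yes j∈R = c-∈ j∈R
      ... | no j∉R = decidable-stable (c j ℤ.≟ 0ℤ) λ cj≢0 → fromℤ-ℝ-≄0 cj≢0 (≃-trans
        (≃-reflexive (cong (fromℤ ∘ c) (≡.sym (element-from (∁ R) (j , x∉p⇒x∈∁p j∉R)))))
        (independent (λ l → fromℤ (c (element (∁ R) l))) dependency (from (increasing (∁ R)) (j , x∉p⇒x∈∁p j∉R))))

-- Encoding of bi-directed rooted forests

module _ {ℓ} {P : Pred (Fin n) ℓ} (P? : Decidable P) where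

  opaque
    comprehension : Subset n
    comprehension = tabulate λ i → ⌊ P? i ⌋

    ∈-comprehension⁺ : ∀ {i} → P i → i ∈ comprehension
    ∈-comprehension⁺ {i} Pi = lookup⇒[]= i comprehension
      (≡.trans (lookup∘tabulate (λ i → ⌊ P? i ⌋) i) (isYes (P? i)))
      where
      isYes : (d : Dec (P i)) → ⌊ d ⌋ ≡ inside
      isYes (yes _) = ≡.refl
      isYes (no ¬p) = contradiction Pi ¬p

    ∈-comprehension⁻ : ∀ {i} → i ∈ comprehension → P i
    ∈-comprehension⁻ {i} i∈ = witness (P? i)
      (≡.trans (≡.sym (lookup∘tabulate (λ i → ⌊ P? i ⌋) i)) ([]=⇒lookup i∈))
      where
      witness : (d : Dec (P i)) → ⌊ d ⌋ ≡ inside → P i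
      witness (yes p) _ = p

-- The classes correspond to the codes that occur. Listing these in increasing order enumerates the
-- setoid, and the decision of `image?` supplies a representative of each.
enumerate : ∀ {c ℓ} (S : Setoid c ℓ) (κ : Setoid.Carrier S → Fin m) →
  (∀ {x y} → Setoid._≈_ S x y → κ x ≡ κ y) → (∀ {x y} → κ x ≡ κ y → Setoid._≈_ S x y) →
  (∀ k → Dec (∃ λ x → κ x ≡ k)) → Enumeration S
enumerate S κ κ-cong κ-inj image? = ∣ U ∣ , record
  { to        = value
  ; from      = index
  ; to-cong   = λ { ≡.refl → refl }
  ; from-cong = λ x≈y → cong (from (increasing U)) (Elements-≡ (κ-cong x≈y))
  ; inverse   = (λ { ≡.refl → κ-inj (≡.trans (κ-value _) (element-from U _)) })
              , (λ {k} x≈ → ≡.trans (cong (from (increasing U)) (Elements-≡ (≡.trans (κ-cong x≈) (κ-value k))))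
                                    (strictlyInverseʳ (increasing U) k))
  }
  where
  open Setoid S using (Carrier; refl)
  U : Subset _
  U = comprehension image?
  value : Fin ∣ U ∣ → Carrier
  value k = proj₁ (∈-comprehension⁻ image? (element-∈ U k))
  κ-value : ∀ k → κ (value k) ≡ element U k
  κ-value k = proj₂ (∈-comprehension⁻ image? (element-∈ U k))
  index : Carrier → Fin ∣ U ∣
  index x = from (increasing U) (κ x , ∈-comprehension⁺ image? (x , ≡.refl))

funToFin-cong : {f g : Fin m → Fin n} → f ≗ g → funToFin f ≡ funToFin g
funToFin-cong {zero}  f≗g = ≡.refl
funToFin-cong {suc m} f≗g = cong₂ combine (f≗g zero) (funToFin-cong (f≗g ∘ suc))

funToFin-injective : {f g : Fin m → Fin n} → funToFin f ≡ funToFin g → f ≗ g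
funToFin-injective {f = f} {g} eq i = ≡.trans (≡.sym (Fin.finToFun-funToFin f i))
  (≡.trans (cong (λ k → finToFun k i) eq) (Fin.finToFun-funToFin g i))

↔-injective : ∀ {a b} {A : Set a} {B : Set b} (e : A ↔ B) {x y : A} → to e x ≡ to e y → x ≡ y
↔-injective e {x} {y} eq = ≡.trans (≡.sym (strictlyInverseʳ e x))
  (≡.trans (cong (from e) eq) (strictlyInverseʳ e y))

module _ {R : Subset p} where

  data Position (i : Fin p) : Set where
    root    : i ∈ R → Position i
    nonroot : (i∈∁R : i ∈ ∁ R) → Position i

  position : ∀ i → Position i
  position i with i ∈? R
  ... | yes i∈R = root i∈R
  ... | no i∉R  = nonroot (x∉p⇒x∈∁p i∉R)

module _ {R : Subset p} {F : Subset q} where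

  code-zero : ∀ (φ : Elements (∁ R) → Elements F) {i} → code φ i ≡ zero → i ∈ R
  code-zero φ {i} eq with i ∈? R
  ... | yes i∈R = i∈R

  code-suc : ∀ (φ : Elements (∁ R) → Elements F) {i f} → code φ i ≡ suc f →
    ∃ λ (i∈∁R : i ∈ ∁ R) → proj₁ (φ (i , i∈∁R)) ≡ f
  code-suc φ {i} eq with i ∈? R
  ... | no i∉R = x∉p⇒x∈∁p i∉R , Fin.suc-injective eq

  transition : (φ φ′ : Elements (∁ R) ↔ Elements F) → Fin p → Fin p
  transition φ φ′ i with i ∈? R
  ... | yes _  = i
  ... | no i∉R = proj₁ (from φ′ (to φ (i , x∉p⇒x∈∁p i∉R)))

  transition-∈ : ∀ φ φ′ {i} → i ∈ R → transition φ φ′ i ≡ i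
  transition-∈ φ φ′ {i} i∈R with i ∈? R
  ... | yes _  = ≡.refl
  ... | no i∉R = contradiction i∈R i∉R

  transition-∉ : ∀ φ φ′ (r : Elements (∁ R)) → transition φ φ′ (proj₁ r) ≡ proj₁ (from φ′ (to φ r))
  transition-∉ φ φ′ (i , i∈∁R) with i ∈? R
  ... | yes i∈R = contradiction i∈R (x∈∁p⇒x∉p i∈∁R)
  ... | no _    = cong (proj₁ ∘ from φ′ ∘ to φ) (Elements-≡ ≡.refl)

  transition-injective : ∀ φ φ′ → IsInjective (transition φ φ′)
  transition-injective φ φ′ {i} {j} eq with position i | position j
  ... | root i∈R | root j∈R =
    ≡.trans (≡.sym (transition-∈ φ φ′ i∈R)) (≡.trans eq (transition-∈ φ φ′ j∈R))
  ... | root i∈R | nonroot j∈∁R = contradiction (subst (_∈ R) (≡.trans (≡.sym (transition-∈ φ φ′ i∈R))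
    (≡.trans eq (transition-∉ φ φ′ (j , j∈∁R)))) i∈R) (x∈∁p⇒x∉p (proj₂ (from φ′ (to φ (j , j∈∁R)))))
  ... | nonroot i∈∁R | root j∈R = contradiction (subst (_∈ R) (≡.trans (≡.sym (transition-∈ φ φ′ j∈R))
    (≡.trans (≡.sym eq) (transition-∉ φ φ′ (i , i∈∁R)))) j∈R) (x∈∁p⇒x∉p (proj₂ (from φ′ (to φ (i , i∈∁R)))))
  ... | nonroot i∈∁R | nonroot j∈∁R = cong proj₁ (↔-injective φ
    (↔-injective (↔.↔-sym φ′)
      (Elements-≡ (≡.trans (≡.sym (transition-∉ φ φ′ (i , i∈∁R))) (≡.trans eq (transition-∉ φ φ′ (j , j∈∁R)))))))

minor-cong : (δ : Matrix ℤ p q) {h h′ : Fin p → Fin (suc q)} → h ≗ h′ → minor δ h ≡ minor δ h′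
minor-cong δ {h} {h′} h≗h′ = ℤ-Sums.det-cong {M = selection δ h} {selection δ h′}
  λ i j → cong (λ a → selectedRow δ a i j) (h≗h′ i)

minor-collision : (δ : Matrix ℤ p q) {h : Fin p → Fin (suc q)} {i j : Fin p} {f : Fin q} →
  i ≢ j → h i ≡ suc f → h j ≡ suc f → minor δ h ≡ 0ℤ
minor-collision δ {h} {i} {j} i≢j hi hj = det-equal-rows (selection δ h) i≢j λ k →
  ≡.trans (cong (λ a → selectedRow δ a i k) hi) (≡.sym (cong (λ a → selectedRow δ a j k) hj))

incidence-⊄ : {r f : Subset n} → ¬ r ⊂ f → incidence r f ≡ 0ℤ
incidence-⊄ {r = r} {f} r⊄f with Fin.any? (λ j → ≡-dec Bool._≟_ r (f ∖ element f j))
... | yes (j , ≡.refl) = contradiction (x∈p⇒p-x⊂p (element-∈ f j)) r⊄f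
... | no _ = ≡.refl

module Encoding (G : SimplicialComplex n) (d : ℕ) where
  private
    p′ = ∣faces∣ G d
    q′ = ∣faces∣ G (suc d)
    module B = BiDirectedRootedForest

  Fits : Fin (suc q′) → Fin p′ → Set
  Fits zero    r = ⊤
  Fits (suc f) r = vertices G r ⊂ vertices G f

  fits? : ∀ a r → Dec (Fits a r)
  fits? zero    r = yes tt
  fits? (suc f) r = vertices G r ⊂? vertices G f

  selectedRow-¬Fits : ∀ {a r} → ¬ Fits a r → ∀ i → selectedRow (∂ G d) a i r ≡ 0ℤ
  selectedRow-¬Fits {zero}  ¬fits = contradiction tt ¬fits
  selectedRow-¬Fits {suc f} ¬fits i = incidence-⊄ ¬fits

  -- The image of the encoding. Injectivity of `h` off the roots follows from `minor≢0`; `fits′` is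
  -- the fitting condition for φ′ at `σ i`, because φ′(σ i) = φ(i).
  record Valid (h : Fin p′ → Fin (suc q′)) (σ : Fin p′ → Fin p′) : Set where
    field
      minor≢0   : minor (∂ G d) h ≢ 0ℤ
      injective : IsInjective σ
      fixed     : ∀ i → h i ≡ zero → σ i ≡ i
      fits      : ∀ i → Fits (h i) i
      fits′     : ∀ i → Fits (h i) (σ i)

  Valid-cong : ∀ {h h′ σ σ′} → h ≗ h′ → σ ≗ σ′ → Valid h σ → Valid h′ σ′
  Valid-cong {h} {h′} {σ} {σ′} h≗h′ σ≗σ′ v = record
    { minor≢0   = λ eq → minor≢0 (≡.trans (minor-cong (∂ G d) h≗h′) eq)
    ; injective = λ {i} {j} eq → injective (≡.trans (σ≗σ′ i) (≡.trans eq (≡.sym (σ≗σ′ j))))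
    ; fixed     = λ i eq → ≡.trans (≡.sym (σ≗σ′ i)) (fixed i (≡.trans (h≗h′ i) eq))
    ; fits      = λ i → subst (λ a → Fits a i) (h≗h′ i) (fits i)
    ; fits′     = λ i → ≡.subst₂ Fits (h≗h′ i) (σ≗σ′ i) (fits′ i)
    }
    where open Valid v

  -- Positive evidence, rather than a mere negation of `Valid`: each constructor points to what
  -- makes the summand of `h` and `σ` vanish.
  data Failure (h : Fin p′ → Fin (suc q′)) (σ : Fin p′ → Fin p′) : Set where
    minor≡0  : minor (∂ G d) h ≡ 0ℤ → Failure h σ
    ¬inj     : ¬ IsInjective σ → Failure h σ
    moved    : ∀ i → h i ≡ zero → σ i ≢ i → Failure h σ
    misfit   : ∀ i → ¬ Fits (h i) i → Failure h σ
    misfit′  : ∀ i → ¬ Fits (h i) (σ i) → Failure h σ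

  validate : ∀ h σ → Valid h σ ⊎ Failure h σ
  validate h σ with minor (∂ G d) h ℤ.≟ 0ℤ | injective? σ
    | Fin.any? (λ i → h i Fin.≟ zero ×-dec ¬? (σ i Fin.≟ i))
    | Fin.any? (λ i → ¬? (fits? (h i) i)) | Fin.any? (λ i → ¬? (fits? (h i) (σ i)))
  ... | yes eq | _ | _ | _ | _ = inj₂ (minor≡0 eq)
  ... | _ | no ¬i | _ | _ | _ = inj₂ (¬inj ¬i)
  ... | _ | _ | yes (i , eq , neq) | _ | _ = inj₂ (moved i eq neq)
  ... | _ | _ | _ | yes (i , ¬fits) | _ = inj₂ (misfit i ¬fits)
  ... | _ | _ | _ | _ | yes (i , ¬fits) = inj₂ (misfit′ i ¬fits)
  ... | no neq | yes inj | no ¬moved | no ¬misfit | no ¬misfit′ = inj₁ record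
    { minor≢0   = neq
    ; injective = inj
    ; fixed     = λ i eq → decidable-stable (σ i Fin.≟ i) λ σi≢i → ¬moved (i , eq , σi≢i)
    ; fits      = λ i → decidable-stable (fits? (h i) i) λ ¬fits → ¬misfit (i , ¬fits)
    ; fits′     = λ i → decidable-stable (fits? (h i) (σ i)) λ ¬fits → ¬misfit′ (i , ¬fits)
    }

  failure⇒¬valid : ∀ {h σ} → Failure h σ → ¬ Valid h σ
  failure⇒¬valid (minor≡0 eq)      v = Valid.minor≢0 v eq
  failure⇒¬valid (¬inj ¬i)         v = ¬i (Valid.injective v)
  failure⇒¬valid (moved i eq neq)  v = neq (Valid.fixed v i eq)
  failure⇒¬valid (misfit i ¬fits)  v = ¬fits (Valid.fits v i)
  failure⇒¬valid (misfit′ i ¬fits) v = ¬fits (Valid.fits′ v i)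

  private
    bij : ∀ {T} → FittingOrientation G d T → Elements (∁ (RootedForest.R T)) ↔ Elements (RootedForest.F T)
    bij = FittingOrientation.bijection

  codeᵀ : BiDirectedRootedForest G d → Fin p′ → Fin (suc q′)
  codeᵀ T = code (to (bij (B.φ T)))

  transitionᵀ : BiDirectedRootedForest G d → Fin p′ → Fin p′
  transitionᵀ T = transition (bij (B.φ T)) (bij (B.φ′ T))

  encode-valid : ∀ T → Valid (codeᵀ T) (transitionᵀ T)
  encode-valid T = record
    { minor≢0   = root⇒minor≢0 G d φ (B.isRoot T)
    ; injective = transition-injective φ φ′
    ; fixed     = λ i eq → transition-∈ φ φ′ (code-zero (to φ) eq)
    ; fits      = λ i → fits i (position i)
    ; fits′     = λ i → fits′ i (position i)
    }
    where
    φ = bij (B.φ T)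
    φ′ = bij (B.φ′ T)
    fits : ∀ i → Position {R = B.R T} i → Fits (codeᵀ T i) i
    fits i (root i∈R)     = subst (λ a → Fits a i) (≡.sym (code-∈ (to φ) i∈R)) tt
    fits i (nonroot i∈∁R) = subst (λ a → Fits a i) (≡.sym (code-∉ (to φ) (i , i∈∁R)))
      (FittingOrientation.fits (B.φ T) (i , i∈∁R))
    fits′ : ∀ i → Position {R = B.R T} i → Fits (codeᵀ T i) (transitionᵀ T i)
    fits′ i (root i∈R)     = subst (λ a → Fits a (transitionᵀ T i)) (≡.sym (code-∈ (to φ) i∈R)) tt
    fits′ i (nonroot i∈∁R) = ≡.subst₂ Fits
      (≡.trans (cong (suc ∘ proj₁) (strictlyInverseˡ φ′ (to φ r))) (≡.sym (code-∉ (to φ) r)))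
      (≡.sym (transition-∉ φ φ′ r))
      (FittingOrientation.fits (B.φ′ T) (from φ′ (to φ r)))
      where r = i , i∈∁R

  private
    open Setoid (BiDirectedRootedForests G d) using (_≈_)

    R-⊆ : ∀ {T T′} → codeᵀ T ≗ codeᵀ T′ → ∀ {i} → i ∈ B.R T → i ∈ B.R T′
    R-⊆ {T} {T′} eq {i} i∈R = code-zero (to (bij (B.φ T′)))
      (≡.trans (≡.sym (eq i)) (code-∈ (to (bij (B.φ T))) i∈R))

    F-⊆ : ∀ {T T′} → codeᵀ T ≗ codeᵀ T′ → ∀ {f} → f ∈ B.F T → f ∈ B.F T′
    F-⊆ {T} {T′} eq {f} f∈F = subst (_∈ B.F T′) (proj₂ hit) (proj₂ (to (bij (B.φ T′)) (proj₁ r , proj₁ hit)))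
      where
      φ = bij (B.φ T)
      r = from φ (f , f∈F)
      hit = code-suc (to (bij (B.φ T′))) (≡.trans (≡.sym (eq (proj₁ r)))
        (≡.trans (code-∉ (to φ) r) (cong (suc ∘ proj₁) (strictlyInverseˡ φ (f , f∈F)))))

  -- `h` determines `R` as its zero set, `F` as its image, and φ. The value of φ′ at `r` is then
  -- that of φ at the preimage of `r` under σ.
  decode-injective : ∀ {T T′} → codeᵀ T ≗ codeᵀ T′ → transitionᵀ T ≗ transitionᵀ T′ → T ≈ T′
  decode-injective {T} {T′} h≗h′ σ≗σ′ =
      ⊆-antisym (F-⊆ {T} {T′} h≗h′) (F-⊆ {T′} {T} (≡.sym ∘ h≗h′))
    , ⊆-antisym (R-⊆ {T} {T′} h≗h′) (R-⊆ {T′} {T} (≡.sym ∘ h≗h′))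
    , same-φ , same-φ′
    where
    φ  = bij (B.φ T)
    φ′ = bij (B.φ′ T)
    ψ  = bij (B.φ T′)
    ψ′ = bij (B.φ′ T′)
    same-φ : ∀ r p q → proj₁ (to φ (r , p)) ≡ proj₁ (to ψ (r , q))
    same-φ r p q = Fin.suc-injective (≡.trans (≡.sym (code-∉ (to φ) (r , p)))
      (≡.trans (h≗h′ r) (code-∉ (to ψ) (r , q))))
    same-φ′ : ∀ r p q → proj₁ (to φ′ (r , p)) ≡ proj₁ (to ψ′ (r , q))
    same-φ′ r p q = begin
      proj₁ (to φ′ (r , p))               ≡⟨ cong proj₁ (strictlyInverseˡ φ (to φ′ (r , p))) ⟨
      proj₁ (to φ s)                      ≡⟨ same-φ (proj₁ s) (proj₂ s) s∈′ ⟩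
      proj₁ (to ψ s′)                     ≡⟨ cong proj₁ (strictlyInverseˡ ψ′ (to ψ s′)) ⟨
      proj₁ (to ψ′ (from ψ′ (to ψ s′)))   ≡⟨ cong (proj₁ ∘ to ψ′) (Elements-≡ back) ⟩
      proj₁ (to ψ′ (r , q))               ∎
      where
      open ≡.≡-Reasoning
      s = from φ (to φ′ (r , p))
      s∈′ : proj₁ s ∈ ∁ (B.R T′)
      s∈′ = x∉p⇒x∈∁p (x∈∁p⇒x∉p (proj₂ s) ∘ R-⊆ {T′} {T} (≡.sym ∘ h≗h′))
      s′ = proj₁ s , s∈′
      back : proj₁ (from ψ′ (to ψ s′)) ≡ r
      back = begin
        proj₁ (from ψ′ (to ψ s′))   ≡⟨ transition-∉ ψ ψ′ s′ ⟨
        transitionᵀ T′ (proj₁ s)    ≡⟨ σ≗σ′ (proj₁ s) ⟨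
        transitionᵀ T (proj₁ s)     ≡⟨ transition-∉ φ φ′ s ⟩
        proj₁ (from φ′ (to φ s))    ≡⟨ cong (proj₁ ∘ from φ′) (strictlyInverseˡ φ (to φ′ (r , p))) ⟩
        proj₁ (from φ′ (to φ′ (r , p))) ≡⟨ cong proj₁ (strictlyInverseʳ φ′ (r , p)) ⟩
        r                           ∎

  codeᵀ-cong : ∀ {T T′} → T ≈ T′ → codeᵀ T ≗ codeᵀ T′
  codeᵀ-cong {T} {T′} (_ , R≡ , φ≡ , _) i with position {R = B.R T} i
  ... | root i∈R     = ≡.trans (code-∈ (to (bij (B.φ T))) i∈R)
    (≡.sym (code-∈ (to (bij (B.φ T′))) (subst (i ∈_) R≡ i∈R)))
  ... | nonroot i∈∁R = ≡.trans (code-∉ (to (bij (B.φ T))) (i , i∈∁R)) (≡.trans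
    (cong suc (φ≡ i i∈∁R i∈′)) (≡.sym (code-∉ (to (bij (B.φ T′))) (i , i∈′))))
    where i∈′ = subst (λ R → i ∈ ∁ R) R≡ i∈∁R

  transitionᵀ-cong : ∀ {T T′} → T ≈ T′ → transitionᵀ T ≗ transitionᵀ T′
  transitionᵀ-cong {T} {T′} (_ , R≡ , φ≡ , φ′≡) i with position {R = B.R T} i
  ... | root i∈R     = ≡.trans (transition-∈ (bij (B.φ T)) (bij (B.φ′ T)) i∈R)
    (≡.sym (transition-∈ (bij (B.φ T′)) (bij (B.φ′ T′)) (subst (i ∈_) R≡ i∈R)))
  ... | nonroot i∈∁R = begin
    transitionᵀ T i                   ≡⟨ transition-∉ φ φ′ (i , i∈∁R) ⟩
    proj₁ s                           ≡⟨ cong proj₁ (strictlyInverseʳ ψ′ s′) ⟨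
    proj₁ (from ψ′ (to ψ′ s′))        ≡⟨ cong (proj₁ ∘ from ψ′) (Elements-≡ same) ⟩
    proj₁ (from ψ′ (to ψ (i , i∈′)))  ≡⟨ transition-∉ ψ ψ′ (i , i∈′) ⟨
    transitionᵀ T′ i                  ∎
    where
    open ≡.≡-Reasoning
    φ  = bij (B.φ T)
    φ′ = bij (B.φ′ T)
    ψ  = bij (B.φ T′)
    ψ′ = bij (B.φ′ T′)
    i∈′ = subst (λ R → i ∈ ∁ R) R≡ i∈∁R
    s = from φ′ (to φ (i , i∈∁R))
    s′ = proj₁ s , subst (λ R → proj₁ s ∈ ∁ R) R≡ (proj₂ s)
    same : proj₁ (to ψ′ s′) ≡ proj₁ (to ψ (i , i∈′))
    same = begin
      proj₁ (to ψ′ s′)          ≡⟨ φ′≡ (proj₁ s) (proj₂ s) (proj₂ s′) ⟨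
      proj₁ (to φ′ s)           ≡⟨ cong proj₁ (strictlyInverseˡ φ′ (to φ (i , i∈∁R))) ⟩
      proj₁ (to φ (i , i∈∁R))   ≡⟨ φ≡ i i∈∁R i∈′ ⟩
      proj₁ (to ψ (i , i∈′))    ∎

  module Decoding {h : Fin p′ → Fin (suc q′)} {σ : Fin p′ → Fin p′} (valid : Valid h σ) where
    open Valid valid

    zero? : ∀ i → Dec (h i ≡ zero)
    zero? i = h i Fin.≟ zero

    hit? : ∀ f → Dec (∃ λ i → h i ≡ suc f)
    hit? f = Fin.any? λ i → h i Fin.≟ suc f

    R : Subset p′
    R = comprehension zero?

    F : Subset q′
    F = comprehension hit?

    value : ∀ {i} → i ∈ ∁ R → ∃ λ f → h i ≡ suc f
    value {i} i∈∁R with h i in eq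
    ... | zero  = contradiction (∈-comprehension⁺ zero? eq) (x∈∁p⇒x∉p i∈∁R)
    ... | suc f = f , ≡.refl

    ∈∁R : ∀ {i f} → h i ≡ suc f → i ∈ ∁ R
    ∈∁R {i} eq = x∉p⇒x∈∁p λ i∈R → case ≡.trans (≡.sym eq) (∈-comprehension⁻ zero? i∈R) of λ ()

    -- A column selected twice would give the minor two equal rows.
    h-injective : ∀ {i j f} → h i ≡ suc f → h j ≡ suc f → i ≡ j
    h-injective {i} {j} hi hj = decidable-stable (i Fin.≟ j) λ i≢j →
      minor≢0 (minor-collision (∂ G d) i≢j hi hj)

    φ : Elements (∁ R) ↔ Elements F
    φ = mk↔ₛ′
      (λ (i , i∈) → let f , eq = value i∈ in f , ∈-comprehension⁺ hit? (i , eq))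
      (λ (f , f∈) → let i , eq = ∈-comprehension⁻ hit? f∈ in i , ∈∁R eq)
      (λ (f , f∈) → let i , eq = ∈-comprehension⁻ hit? f∈ in
        Elements-≡ (Fin.suc-injective (≡.trans (≡.sym (proj₂ (value (∈∁R eq)))) eq)))
      (λ (i , i∈) → let f , eq = value i∈ in
        Elements-≡ (h-injective (proj₂ (∈-comprehension⁻ hit? (∈-comprehension⁺ hit? (i , eq)))) eq))

    φ-value : ∀ r → h (proj₁ r) ≡ suc (proj₁ (to φ r))
    φ-value (i , i∈) = proj₂ (value i∈)

    σ-∁R : ∀ {i} → i ∈ ∁ R → σ i ∈ ∁ R
    σ-∁R {i} i∈ = x∉p⇒x∈∁p λ σi∈R → x∈∁p⇒x∉p i∈
      (subst (_∈ R) (injective (fixed (σ i) (∈-comprehension⁻ zero? σi∈R))) σi∈R)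

    σ⁻¹-∁R : ∀ {i} → σ i ∈ ∁ R → i ∈ ∁ R
    σ⁻¹-∁R {i} σi∈ = x∉p⇒x∈∁p λ i∈R → x∈∁p⇒x∉p σi∈
      (subst (_∈ R) (≡.sym (fixed i (∈-comprehension⁻ zero? i∈R))) i∈R)

    σ̄ : Elements (∁ R) ↔ Elements (∁ R)
    σ̄ = mk↔ₛ′
      (λ (i , i∈) → σ i , σ-∁R i∈)
      (λ (j , j∈) → let i , eq = injection⇒surjection injective j in
        i , σ⁻¹-∁R (subst (_∈ ∁ R) (≡.sym eq) j∈))
      (λ (j , _) → Elements-≡ (proj₂ (injection⇒surjection injective j)))
      (λ (i , _) → Elements-≡ (injective (proj₂ (injection⇒surjection injective (σ i)))))

    -- φ ∘ σ⁻¹ on the nonroots, the only choice for which φ′⁻¹ ∘ φ is σ.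
    φ′ : Elements (∁ R) ↔ Elements F
    φ′ = ↔.↔-trans (↔.↔-sym σ̄) φ

    code-φ : code (to φ) ≗ h
    code-φ i = case position {R = R} i of λ where
      (root i∈R)     → ≡.trans (code-∈ (to φ) i∈R) (≡.sym (∈-comprehension⁻ zero? i∈R))
      (nonroot i∈∁R) → ≡.trans (code-∉ (to φ) (i , i∈∁R)) (≡.sym (φ-value (i , i∈∁R)))

    transition-φ : transition φ φ′ ≗ σ
    transition-φ i = case position {R = R} i of λ where
      (root i∈R)     → ≡.trans (transition-∈ φ φ′ i∈R) (≡.sym (fixed i (∈-comprehension⁻ zero? i∈R)))
      (nonroot i∈∁R) → ≡.trans (transition-∉ φ φ′ (i , i∈∁R))
        (cong (proj₁ ∘ to σ̄) (strictlyInverseʳ φ (i , i∈∁R)))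

    decoded : BiDirectedRootedForest G d
    decoded = record
      { forest = record { F = F ; R = R ; isForest = proj₁ rooted ; isRoot = proj₂ rooted }
      ; φ  = record { bijection = φ  ; fits = λ r → subst (λ a → Fits a (proj₁ r)) (φ-value r) (fits (proj₁ r)) }
      ; φ′ = record { bijection = φ′ ; fits = λ r → ≡.subst₂ Fits (φ-value (from σ̄ r))
               (proj₂ (injection⇒surjection injective (proj₁ r))) (fits′ (proj₁ (from σ̄ r))) }
      }
      where
      rooted : IsForest G d F × IsRoot G d F R
      rooted = rooted-forest G d φ λ eq → minor≢0 (≡.trans (minor-cong (∂ G d) (≡.sym ∘ code-φ)) eq)

  open Decoding using (decoded; code-φ; transition-φ)

  κ : BiDirectedRootedForest G d → Fin ((suc q′ ℕ.^ p′) ℕ.* (p′ ℕ.^ p′))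
  κ T = combine (funToFin (codeᵀ T)) (funToFin (transitionᵀ T))

  -- Whether a number codes a forest is decided by the finite and integer conditions of `Valid`,
  -- with no test on real numbers.
  enumeration : Enumeration (BiDirectedRootedForests G d)
  enumeration = enumerate (BiDirectedRootedForests G d) κ
    (λ {T} {T′} eq → cong₂ combine (funToFin-cong (codeᵀ-cong {T} {T′} eq))
                                   (funToFin-cong (transitionᵀ-cong {T} {T′} eq)))
    (λ {T} {T′} eq → let eq₁ , eq₂ = Fin.combine-injective (funToFin (codeᵀ T)) _ (funToFin (codeᵀ T′)) _ eq in
      decode-injective {T} {T′} (funToFin-injective eq₁) (funToFin-injective eq₂))
    image?
    where
    image? : ∀ k → Dec (∃ λ T → κ T ≡ k)
    image? k with Fin.combine-surjective {suc q′ ℕ.^ p′} {p′ ℕ.^ p′} k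
    ... | a , b , ≡.refl with validate (finToFun a) (finToFun b)
    ...   | inj₁ valid   = yes (decoded valid , cong₂ combine
      (≡.trans (funToFin-cong (code-φ valid)) (Fin.funToFin-finToFin {p′} a))
      (≡.trans (funToFin-cong (transition-φ valid)) (Fin.funToFin-finToFin {p′} b)))
    ...   | inj₂ failure = no λ (T , eq) →
      let eq₁ , eq₂ = Fin.combine-injective (funToFin (codeᵀ T)) (funToFin (transitionᵀ T)) a b eq in
      failure⇒¬valid failure (Valid-cong
        (λ i → ≡.trans (≡.sym (Fin.finToFun-funToFin (codeᵀ T) i)) (cong (λ k → finToFun k i) eq₁))
        (λ i → ≡.trans (≡.sym (Fin.finToFun-funToFin (transitionᵀ T) i)) (cong (λ k → finToFun k i) eq₂))
        (encode-valid T))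

-- The expansion of the determinant

module _ {R : Subset p} {F : Subset q} (φ φ′ : Elements (∁ R) ↔ Elements F) where
  private
    α = increasing (∁ R)

  restricted : Fin ∣ ∁ R ∣ → Fin ∣ ∁ R ∣
  restricted l = from α (from φ′ (to φ (to α l)))

  restricted-injective : IsInjective restricted
  restricted-injective eq = ↔-injective α (↔-injective φ (↔-injective (↔.↔-sym φ′)
    (↔-injective (↔.↔-sym α) eq)))

  element-restricted : ∀ l → element (∁ R) (restricted l) ≡ transition φ φ′ (element (∁ R) l)
  element-restricted l = ≡.trans (element-from (∁ R) (from φ′ (to φ (to α l))))
    (≡.sym (transition-∉ φ φ′ (to α l)))

  ε-transition : ε (transition φ φ′) ≡ ε restricted
  ε-transition = ε-restriction (∁ R) (transition-injective φ φ′)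
    (λ i eq → transition-∈ φ φ′ (x∉∁p⇒x∈p λ i∈ → case ≡.trans (≡.sym eq) ([]=⇒lookup i∈) of λ ()))
    element-restricted

  -- A root row contributes a diagonal entry of the identity. A nonroot row `i` contributes the
  -- entry of δ at σ(i) and φ(i) = φ′(σ(i)); reindexing by σ leaves the product for φ′.
  product-selection : (δ : Matrix ℤ p q) →
    productᶻ (λ i → selection δ (code (to φ)) i (transition φ φ′ i))
      ≡ productᶻ (λ l → δ (element (∁ R) l) (proj₁ (to φ′ (to α l))))
  product-selection δ = begin
    productᶻ (λ i → entry i)
      ≡⟨ productᶻ-split R entry ⟩
    productᶻ (λ l → entry (element (∁ R) l)) *ℤ productᶻ (λ k → entry (element R k))
      ≡⟨ cong₂ _*ℤ_ (productᶻ-cong nonroots) (productᶻ-1 roots) ⟩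
    productᶻ (λ l → Q (restricted l)) *ℤ 1ℤ
      ≡⟨ ℤ.*-identityʳ (productᶻ λ l → Q (restricted l)) ⟩
    productᶻ (λ l → Q (restricted l))
      ≡⟨ productᶻ-reindex restricted-injective Q ⟩
    productᶻ Q ∎
    where
    open ≡.≡-Reasoning
    entry : Fin p → ℤ
    entry i = selection δ (code (to φ)) i (transition φ φ′ i)
    Q : Fin ∣ ∁ R ∣ → ℤ
    Q l = δ (element (∁ R) l) (proj₁ (to φ′ (to α l)))
    roots : ∀ k → entry (element R k) ≡ 1ℤ
    roots k = ≡.trans
      (cong₂ (λ a j → selectedRow δ a i j) (code-∈ (to φ) i∈R) (transition-∈ φ φ′ i∈R))
      (ℤ-Matrices.scalar-≡ 1ℤ i)
      where
      i = element R k
      i∈R = element-∈ R k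
    nonroots : ∀ l → entry (element (∁ R) l) ≡ Q (restricted l)
    nonroots l = ≡.trans
      (cong (λ a → selectedRow δ a (element (∁ R) l) (transition φ φ′ (element (∁ R) l))) (code-∉ (to φ) (to α l)))
      (cong₂ δ (≡.sym (element-restricted l)) (cong proj₁ (≡.sym (≡.trans
        (cong (to φ′) (strictlyInverseˡ α (from φ′ (to φ (to α l)))))
        (strictlyInverseˡ φ′ (to φ (to α l)))))))

-- Products of signs of fitting orientations

sign² : ∀ s → (s ℤ.◃ 1) *ℤ (s ℤ.◃ 1) ≡ 1ℤ
sign² Sign.+ = ≡.refl
sign² Sign.- = ≡.refl

module _ {G : SimplicialComplex n} (T : RootedForest G d) where
  open RootedForest T
  open FittingOrientation using (bijection; image)

  incidenceProduct : FittingOrientation G d T → ℤ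
  incidenceProduct φ = productᶻ λ l → ∂ G d (element R̄ l) (image φ (to (increasing R̄) l))

  module _ (β : Fin ∣ R̄ ∣ ↔ Elements F) (φ φ′ : FittingOrientation G d T) where
    open Signs T (increasing R̄) β

    π-restricted : π φ ≗ π φ′ ∘ restricted (bijection φ) (bijection φ′)
    π-restricted l = cong (from β) (≡.sym (≡.trans
      (cong (to (bijection φ′)) (strictlyInverseˡ (increasing R̄) _))
      (strictlyInverseˡ (bijection φ′) _)))

    π-injective : ∀ ψ → IsInjective (π ψ)
    π-injective ψ eq = ↔-injective (increasing R̄) (↔-injective (bijection ψ) (↔-injective (↔.↔-sym β) eq))

    -- `π φ` is `π φ′` preceded by the restriction of φ′⁻¹ ∘ φ, so the two signs differ by the sign
    -- of that permutation, whatever the ordering `β`.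
    signPerm-* : signPerm (π φ) *ℤ signPerm (π φ′) ≡ ε (transition (bijection φ) (bijection φ′))
    signPerm-* = begin
      signPerm (π φ) *ℤ signPerm (π φ′)
        ≡⟨ cong₂ _*ℤ_ (signPerm≡ε (π-injective φ)) (signPerm≡ε (π-injective φ′)) ⟩
      ε (π φ) *ℤ ε (π φ′)
        ≡⟨ cong (_*ℤ ε (π φ′)) (≡.trans (ε-cong π-restricted) (ε-∘ (π φ′) σ̄-injective)) ⟩
      (ε σ̄ *ℤ ε (π φ′)) *ℤ ε (π φ′)
        ≡⟨ ℤ.*-assoc (ε σ̄) (ε (π φ′)) (ε (π φ′)) ⟩
      ε σ̄ *ℤ (ε (π φ′) *ℤ ε (π φ′))
        ≡⟨ cong (ε σ̄ *ℤ_) (ε²≡1 (π-injective φ′)) ⟩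
      ε σ̄ *ℤ 1ℤ
        ≡⟨ ℤ.*-identityʳ (ε σ̄) ⟩
      ε σ̄
        ≡⟨ ε-transition (bijection φ) (bijection φ′) ⟨
      ε (transition (bijection φ) (bijection φ′)) ∎
      where
      open ≡.≡-Reasoning
      σ̄ = restricted (bijection φ) (bijection φ′)
      σ̄-injective = restricted-injective (bijection φ) (bijection φ′)

    -- Both orientations carry the same factor `signDet`, whose square is 1.
    Λ[]-* : Λ[] φ *ℤ Λ[] φ′ ≡
      ε (transition (bijection φ) (bijection φ′)) *ℤ (incidenceProduct φ *ℤ incidenceProduct φ′)
    Λ[]-* = begin
      (s *ℤ (signPerm (π φ) *ℤ P)) *ℤ (s *ℤ (signPerm (π φ′) *ℤ P′))
        ≡⟨ *-interchange s (signPerm (π φ) *ℤ P) s (signPerm (π φ′) *ℤ P′) ⟩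
      (s *ℤ s) *ℤ ((signPerm (π φ) *ℤ P) *ℤ (signPerm (π φ′) *ℤ P′))
        ≡⟨ cong₂ _*ℤ_ (sign² (ℤ.sign (detᶻ orderedMatrix)))
             (*-interchange (signPerm (π φ)) P (signPerm (π φ′)) P′) ⟩
      1ℤ *ℤ ((signPerm (π φ) *ℤ signPerm (π φ′)) *ℤ (P *ℤ P′))
        ≡⟨ ℤ.*-identityˡ _ ⟩
      (signPerm (π φ) *ℤ signPerm (π φ′)) *ℤ (P *ℤ P′)
        ≡⟨ cong (_*ℤ (P *ℤ P′)) signPerm-* ⟩
      ε (transition (bijection φ) (bijection φ′)) *ℤ (P *ℤ P′) ∎
      where
      open ≡.≡-Reasoning
      s = signDet
      P = incidenceProduct φ
      P′ = incidenceProduct φ′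

  -- `Λ` transports the ordering of `F` along an equality of sizes obtained from the orientation
  -- itself. Equality proofs in ℕ are unique, so both signs use the same `β`.
  Λ-* : (φ φ′ : FittingOrientation G d T) → Λ φ *ℤ Λ φ′ ≡
    ε (transition (bijection φ) (bijection φ′)) *ℤ (incidenceProduct φ *ℤ incidenceProduct φ′)
  Λ-* φ φ′ = ≡.trans (cong₂ _*ℤ_ (Λ≡ φ) (Λ≡ φ′)) (Λ[]-* (β (size φ)) φ φ′)
    where
    size : FittingOrientation G d T → ∣ F ∣ ≡ ∣ R̄ ∣
    size ψ = ≡.sym (↔⇒≡ (↔.↔-trans (increasing R̄) (↔.↔-trans (bijection ψ) (↔.↔-sym (increasing F)))))
    β : ∣ F ∣ ≡ ∣ R̄ ∣ → Fin ∣ R̄ ∣ ↔ Elements F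
    β eq = subst (λ k → Fin k ↔ Elements F) eq (increasing F)
    Λ≡ : ∀ ψ → Λ ψ ≡ Signs.Λ[] T (increasing R̄) (β (size φ)) ψ
    Λ≡ ψ = cong (λ eq → Signs.Λ[] T (increasing R̄) (β eq) ψ) (ℕ.≡-irrelevant (size ψ) (size φ))

-- Matching the terms of the determinant with the forests

module Expansion {c ℓ} (A : CommutativeRing c ℓ) (G : SimplicialComplex n) (d : ℕ)
  (w : Face G d → Face G (suc d) → CommutativeRing.Carrier A)
  (x : Face G d → CommutativeRing.Carrier A) where
  open CommutativeRing A hiding (zero)
  open LinearAlgebra A
  open RingSums A
  open RingMatrices A using (scalar-≡; scalar-≢)
  open Encoding G d
  open SubsetSums *-commutativeMonoid using (sum-split)
  open Relation.Binary.Reasoning.Setoid setoid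
  private
    p′ = ∣faces∣ G d
    q′ = ∣faces∣ G (suc d)
    module B = BiDirectedRootedForest
    open FittingOrientation using (bijection; image)

    δ : Matrix ℤ p′ q′
    δ = ∂ G d

  weight : Fin p′ → Fin (suc q′) → Carrier
  weight i zero    = x i
  weight i (suc f) = ∂ʷ A G d w i f

  entries : (Fin p′ → Fin (suc q′)) → (Fin p′ → Fin p′) → Carrier
  entries h σ = fromℤ (ε σ) * product λ i → fromℤ (selection δ h i (σ i))

  -- The guard removes the Leibniz terms of a vanishing minor, which cancel in total but may be
  -- nonzero individually.
  term : (Fin p′ → Fin (suc q′)) → (Fin p′ → Fin p′) → Carrier
  term h σ = ((product λ i → weight i (h i)) * entries h σ) if ¬? (minor δ h ℤ.≟ 0ℤ)

  sum-entries : ∀ h → sumF (entries h) ≈ fromℤ (minor δ h)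
  sum-entries h = trans (sym (leibniz (λ i j → fromℤ (selection δ h i j)))) (sym (fromℤ-det (selection δ h)))

  weightedLaplacian-entry : ∀ i j → (weightedLaplacian A G d w ⊕ diagonal x) i j
    ≈ sum λ a → weight i a * fromℤ (selectedRow δ a i j)
  weightedLaplacian-entry i j = trans (+-comm _ (diagonal x i j)) (+-congʳ (unit (i Fin.≟ j)))
    where
    unit : (i≟j : Dec (i ≡ j)) → (x i if i≟j) ≈ x i * fromℤ (if ⌊ i≟j ⌋ then 1ℤ else 0ℤ)
    unit (yes _) = sym (trans (*-congˡ fromℤ-1) (*-identityʳ (x i)))
    unit (no _)  = sym (zeroʳ (x i))

  det-expansion : det (weightedLaplacian A G d w ⊕ diagonal x) ≈ sumF λ h → sumF (term h)
  det-expansion = begin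
    det (weightedLaplacian A G d w ⊕ diagonal x)
      ≈⟨ det-cong weightedLaplacian-entry ⟩
    det (λ i j → sum λ a → weight i a * fromℤ (selectedRow δ a i j))
      ≈⟨ det-sum weight (λ a i j → fromℤ (selectedRow δ a i j)) ⟩
    (sumF λ h → (product λ i → weight i (h i)) * det (λ i j → fromℤ (selection δ h i j)))
      ≈⟨ sumF-cong (λ h → *-congˡ (fromℤ-det (selection δ h))) ⟨
    (sumF λ h → (product λ i → weight i (h i)) * fromℤ (minor δ h))
      ≈⟨ sumF-cong (λ h → distribute h (minor δ h ℤ.≟ 0ℤ)) ⟩
    (sumF λ h → sumF (term h)) ∎
    where
    distribute : ∀ h (z? : Dec (minor δ h ≡ 0ℤ)) → (product λ i → weight i (h i)) * fromℤ (minor δ h)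
      ≈ sumF λ σ → ((product λ i → weight i (h i)) * entries h σ) if ¬? z?
    distribute h (yes eq) = trans (*-congˡ (reflexive (cong fromℤ eq)))
      (trans (zeroʳ _) (sym (sumF-0 {m = p′} {n = p′} λ _ → refl)))
    distribute h (no _)   = trans (*-congˡ (sym (sum-entries h))) (*-distribˡ-sumF _ (entries h))

  -- A singular minor closes the guard, a non-injective σ has sign 0, a moved root meets an
  -- off-diagonal entry of the identity, and a misfit meets a zero incidence, in the weight for φ or
  -- in the selected column for φ′.
  term-failure : ∀ {h σ} → Failure h σ → term h σ ≈ 0#
  term-failure {h} {σ} failure = vanish (minor δ h ℤ.≟ 0ℤ) (factor failure)
    where
    W = product λ i → weight i (h i)
    vanish : (z? : Dec (minor δ h ≡ 0ℤ)) → (minor δ h ≡ 0ℤ) ⊎ (W * entries h σ ≈ 0#) →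
      ((W * entries h σ) if ¬? z?) ≈ 0#
    vanish (yes _) _           = refl
    vanish (no ≢0) (inj₁ ≡0)   = contradiction ≡0 ≢0
    vanish (no _)  (inj₂ zero≈) = zero≈
    entry-0 : ∀ i → selection δ h i (σ i) ≡ 0ℤ → W * entries h σ ≈ 0#
    entry-0 i eq = trans (*-congˡ (trans (*-congˡ
      (product-0 (λ i → fromℤ (selection δ h i (σ i))) i (reflexive (cong fromℤ eq)))) (zeroʳ _))) (zeroʳ W)
    weight-0 : ∀ i a → ¬ Fits a i → weight i a ≈ 0#
    weight-0 i zero    ¬fits = contradiction _ ¬fits
    weight-0 i (suc f) ¬fits = trans (*-congˡ (reflexive (cong fromℤ (incidence-⊄ ¬fits)))) (zeroʳ (w i f))
    factor : Failure h σ → (minor δ h ≡ 0ℤ) ⊎ (W * entries h σ ≈ 0#)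
    factor (minor≡0 eq)      = inj₁ eq
    factor (¬inj ¬σ-inj)     = inj₂ (trans (*-congˡ (trans
      (*-congʳ (reflexive (cong fromℤ (ε-¬injective σ ¬σ-inj)))) (zeroˡ _))) (zeroʳ W))
    factor (moved i hi≡0 σi≢i) = inj₂ (entry-0 i (≡.trans (cong (λ a → selectedRow δ a i (σ i)) hi≡0)
      (ℤ-Matrices.scalar-≢ 1ℤ (σi≢i ∘ ≡.sym))))
    factor (misfit i ¬fits)  = inj₂ (trans (*-congʳ
      (product-0 (λ i → weight i (h i)) i (weight-0 i (h i) ¬fits))) (zeroˡ _))
    factor (misfit′ i ¬fits) = inj₂ (entry-0 i (selectedRow-¬Fits {h i} ¬fits i))

  term-cong : ∀ {h h′ σ σ′} → h ≗ h′ → σ ≗ σ′ → term h σ ≈ term h′ σ′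
  term-cong {h} {h′} {σ} {σ′} h≗h′ σ≗σ′ = if-cong (¬? (minor δ h ℤ.≟ 0ℤ)) (¬? (minor δ h′ ℤ.≟ 0ℤ))
    (subst (_≢ 0ℤ) (minor-cong δ h≗h′)) (subst (_≢ 0ℤ) (≡.sym (minor-cong δ h≗h′)))
    (*-cong (product-cong λ i → reflexive (cong (weight i) (h≗h′ i)))
      (*-cong (reflexive (cong fromℤ (ε-cong σ≗σ′)))
        (product-cong λ i → reflexive (cong fromℤ
          (cong₂ (λ a j → selectedRow δ a i j) (h≗h′ i) (σ≗σ′ i))))))

  contribution : BiDirectedRootedForest G d → Carrier
  contribution T = fromℤ (Λ (B.φ T) *ℤ Λ (B.φ′ T))
    * ∏ A (B.R̄ T) (λ r → w (proj₁ r) (image (B.φ T) r))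
    * ∏ A (B.R T) (λ r → x (proj₁ r))

  product-weight : ∀ T → (product λ i → weight i (codeᵀ T i))
    ≈ ∏ A (B.R̄ T) (λ r → w (proj₁ r) (image (B.φ T) r))
      * fromℤ (incidenceProduct (B.forest T) (B.φ T))
      * ∏ A (B.R T) (λ r → x (proj₁ r))
  product-weight T = trans (sum-split R (λ i → weight i (codeᵀ T i))) (*-cong
    (trans (product-cong λ l → reflexive (cong (weight (element (∁ R) l)) (code-∉ φ (to (increasing (∁ R)) l))))
      (trans (Product.∑-distrib-+ (λ l → w (element (∁ R) l) (f l)) (λ l → fromℤ (δ (element (∁ R) l) (f l))))
        (*-congˡ (sym (fromℤ-product λ l → δ (element (∁ R) l) (f l))))))
    (product-cong λ k → reflexive (cong (weight (element R k)) (code-∈ φ (element-∈ R k)))))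
    where
    open RootedForest (B.forest T) using (R; F)
    φ : Elements (∁ R) → Elements F
    φ = to (bijection (B.φ T))
    f : Fin ∣ ∁ R ∣ → Fin q′
    f l = proj₁ (φ (to (increasing (∁ R)) l))

  -- The weights supply the incidences of φ and the Leibniz product those of φ′; with `ε σ` they
  -- make up the product of the two signs by `Λ-*`.
  contribution≈term : ∀ T → contribution T ≈ term (codeᵀ T) (transitionᵀ T)
  contribution≈term T = sym (begin
    term h σ
      ≈⟨ if-yes (¬? (minor δ h ℤ.≟ 0ℤ)) _ (Valid.minor≢0 (encode-valid T)) ⟩
    (product λ i → weight i (h i)) * (fromℤ (ε σ) * product λ i → fromℤ (selection δ h i (σ i)))
      ≈⟨ *-cong (product-weight T) (*-congˡ (trans (sym (fromℤ-product λ i → selection δ h i (σ i)))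
           (reflexive (cong fromℤ (product-selection (bijection (B.φ T)) (bijection (B.φ′ T)) δ))))) ⟩
    W * fromℤ P * X * (fromℤ (ε σ) * fromℤ P′)
      ≈⟨ solve 5 (λ W P X e P′ → ((W ⊞ P) ⊞ X) ⊞ (e ⊞ P′) ⊜ ((e ⊞ (P ⊞ P′)) ⊞ W) ⊞ X) refl
           W (fromℤ P) X (fromℤ (ε σ)) (fromℤ P′) ⟩
    fromℤ (ε σ) * (fromℤ P * fromℤ P′) * W * X
      ≈⟨ *-congʳ (*-congʳ (trans (fromℤ-* (ε σ) (P *ℤ P′)) (*-congˡ (fromℤ-* P P′)))) ⟨
    fromℤ (ε σ *ℤ (P *ℤ P′)) * W * X
      ≈⟨ *-congʳ (*-congʳ (reflexive (cong fromℤ (Λ-* (B.forest T) (B.φ T) (B.φ′ T))))) ⟨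
    contribution T ∎)
    where
    open Algebra.Solver.CommutativeMonoid *-commutativeMonoid using (solve; _⊜_) renaming (_⊕_ to _⊞_)
    h = codeᵀ T
    σ = transitionᵀ T
    P = incidenceProduct (B.forest T) (B.φ T)
    P′ = incidenceProduct (B.forest T) (B.φ′ T)
    W = ∏ A (B.R̄ T) (λ r → w (proj₁ r) (image (B.φ T) r))
    X = ∏ A (B.R T) (λ r → x (proj₁ r))

  expansion : (E : Enumeration (BiDirectedRootedForests G d)) →
    ∑ A E contribution ≈ det (weightedLaplacian A G d w ⊕ diagonal x)
  expansion (N , e) = begin
    (sum λ k → contribution (to e k))
      ≈⟨ sum-cong (λ k → contribution≈term (to e k)) ⟩
    (sum λ k → term (codeᵀ (to e k)) (transitionᵀ (to e k)))
      ≈⟨ sum-image term term-cong (λ k → codeᵀ (to e k)) (λ k → transitionᵀ (to e k)) distinct occurs ⟩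
    (sumF λ h → sumF (term h))
      ≈⟨ det-expansion ⟨
    det (weightedLaplacian A G d w ⊕ diagonal x) ∎
    where
    distinct : ∀ {i j} → codeᵀ (to e i) ≗ codeᵀ (to e j) → transitionᵀ (to e i) ≗ transitionᵀ (to e j) → i ≡ j
    distinct {i} {j} h≗ σ≗ = ≡.trans (≡.sym (strictlyInverseʳ e i)) (≡.trans
      (Inverse.from-cong e {to e i} {to e j} (decode-injective {to e i} {to e j} h≗ σ≗)) (strictlyInverseʳ e j))
    occurs : ∀ h σ → term h σ ≈ 0# ⊎ (∃ λ k → codeᵀ (to e k) ≗ h × transitionᵀ (to e k) ≗ σ)
    occurs h σ with validate h σ
    ... | inj₂ failure = inj₁ (term-failure failure)
    ... | inj₁ valid   = inj₂ (k
      , (λ i → ≡.trans (codeᵀ-cong {to e k} {T} k≈T i) (Decoding.code-φ valid i))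
      , (λ i → ≡.trans (transitionᵀ-cong {to e k} {T} k≈T i) (Decoding.transition-φ valid i)))
      where
      T = Decoding.decoded valid
      k = from e T
      k≈T = strictlyInverseˡ e T

-- An enumeration is provided first, so that the sums exist; the formulas then hold for every
-- enumeration, so the sums do not depend on its choice.
theorem32 : ∀ {c ℓ} {n d : ℕ} (G : SimplicialComplex n) → HasDimension G d →
    Enumeration (BiDirectedRootedForests G d) ×
    (∀ (B : Enumeration (BiDirectedRootedForests G d)) (A : CommutativeRing c ℓ) →
      let open CommutativeRing A
          open LinearAlgebra A
          open BiDirectedRootedForest
          open FittingOrientation
      in
      (∀ (x : Carrier) →
        ∑ A B (λ T → fromℤ (Λ (φ T) *ℤ Λ (φ′ T)) * x ^ ∣ R T ∣)
          ≈ det (Laplacian A G d ⊕ x · Id))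
      ×
      (∀ (w : Face G d → Face G (suc d) → Carrier) (x : Face G d → Carrier) →
        ∑ A B (λ T → fromℤ (Λ (φ T) *ℤ Λ (φ′ T))
                     * ∏ A (R̄ T) (λ r → w (proj₁ r) (image (φ T) r))
                     * ∏ A (R T) (λ r → x (proj₁ r)))
          ≈ det (weightedLaplacian A G d w ⊕ diagonal x)))
theorem32 {c} {ℓ} {d = d} G _ =
  Encoding.enumeration G d , λ B A → unweighted B A , λ w x → Expansion.expansion A G d w x B
  where
  module _ (B : Enumeration (BiDirectedRootedForests G d)) (A : CommutativeRing c ℓ) where
    open CommutativeRing A
    open LinearAlgebra A
    open RingSums A
    open BiDirectedRootedForest
    open FittingOrientation
    open Relation.Binary.Reasoning.Setoid setoid

    -- The weighted formula with every `w` equal to 1 and every variable equal to `x`.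
    unweighted : ∀ x → ∑ A B (λ T → fromℤ (Λ (φ T) *ℤ Λ (φ′ T)) * x ^ ∣ R T ∣)
      ≈ det (Laplacian A G d ⊕ x · Id)
    unweighted x = begin
      ∑ A B (λ T → fromℤ (Λ (φ T) *ℤ Λ (φ′ T)) * x ^ ∣ R T ∣)
        ≈⟨ sum-cong (λ k → monomial (to (proj₂ B) k)) ⟩
      ∑ A B (λ T → fromℤ (Λ (φ T) *ℤ Λ (φ′ T)) * ∏ A (R̄ T) (λ _ → 1#) * ∏ A (R T) (λ _ → x))
        ≈⟨ Expansion.expansion A G d (λ _ _ → 1#) (λ _ → x) B ⟩
      det (weightedLaplacian A G d (λ _ _ → 1#) ⊕ diagonal (λ _ → x))
        ≈⟨ det-cong (λ i j → +-cong
             (sum-cong λ f → *-congʳ (*-identityˡ (∂ᴬ A G d i f))) (scaled (i Fin.≟ j))) ⟩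
      det (Laplacian A G d ⊕ x · Id) ∎
      where
      monomial : ∀ T → fromℤ (Λ (φ T) *ℤ Λ (φ′ T)) * x ^ ∣ R T ∣
        ≈ fromℤ (Λ (φ T) *ℤ Λ (φ′ T)) * ∏ A (R̄ T) (λ _ → 1#) * ∏ A (R T) (λ _ → x)
      monomial T = sym (*-cong
        (trans (*-congˡ (Product.sum-replicate-zero ∣ R̄ T ∣)) (*-identityʳ _))
        (Product.sum-replicate ∣ R T ∣))
      scaled : ∀ {i j : Face G d} (i≟j : Dec (i ≡ j)) →
        (if ⌊ i≟j ⌋ then x else 0#) ≈ x * (if ⌊ i≟j ⌋ then 1# else 0#)
      scaled (yes _) = sym (*-identityʳ x)
      scaled (no _)  = sym (zeroʳ x)
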